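{- Every braced triangulation $G=(P,B)$ with $|B|=2$ can be constructed by a sequence of topological vertex splitting moves starting from one of the following five braced triangulations: (I) vertices $1,\dots,6$; $P$ is the octahedron, whose edges are all pairs except $\{1,4\},\{2,5\},\{3,6\}$; $B=\{14,25\}$. (II) vertices $a,t,c,m,h,k$; $P$ has edges $at,tc,ca,am,mc,ha,hm,hc,th,mk,kh,kc$; $B=\{tm,ka\}$. (III) the same $P$ as in (II), with $B=\{tm,tk\}$. (IV) vertices $s_1,s_2,s_3,s_4,v_1,v_2,v_3$; $P$ has edges $s_1s_3,s_3v_2,v_2s_1,s_4v_1,v_1s_2,s_2v_2,s_4s_1,v_1s_1,s_2s_1,s_2s_3,v_1s_3,s_4s_3,s_4v_3,v_3s_1,v_3s_3$; $B=\{v_1v_2,v_1v_3\}$. (V) vertices $s_1,s_2,s_3,s_4,v_1,v_2,v_3$; $P$ has edges $s_1s_3,s_3v_2,v_2s_1,s_4v_1,v_1s_2,s_2v_2,s_4s_1,v_1s_1,s_2s_1,s_2s_3,v_1s_3,s_4v_3,v_3s_1,v_3s_3,v_1v_3$; $B=\{v_1v_2,s_4s_3\}$.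
   Context: A sphere graph is a simple graph with a fixed embedding in the 2-sphere without edge crossings. A (sphere) triangulation $P$ is a maximal sphere graph with at least 3 vertices. An edge $e$ of $P$ is contractible in $P$ if it belongs to precisely two 3-cycles of $P$; then the contraction $P/e$ (with the induced embedding) is again a triangulation. A braced triangulation $G=(P,B)$ is the simple graph obtained from a triangulation $P$ by adjoining a set $B$ of additional edges (braces) joining pairs of vertices non-adjacent in $P$. An edge $e$ of $P$ is contractible in $G$ if $e$ is contractible in $P$ and $e$ does not belong to any 3-cycle of $G$ containing a brace; in that case $(P/e,B)$ is again a braced triangulation. If $G'=(P,B)$ is a braced triangulation and $e$ is an edge of $P$ contractible in $G'$, then $G'$ is said to be obtained from $G=(P/e,B)$ by a topological vertex splitting move. Braced triangulations are identified up to isomorphism (bijections of vertices mapping triangulation edges to triangulation edges and braces to braces). -}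

module Defs where

open import Data.Nat using (ℕ; zero; suc; _+_; _≤_; _≡ᵇ_; _<ᵇ_)
open import Data.Fin using (Fin; toℕ)
import Data.Fin as F
open import Data.Bool using (Bool; true; false; _∧_; _∨_; if_then_else_)
open import Data.List using (List; []; _∷_)
open import Data.Product using (Σ; ∃; _×_; _,_; proj₁; proj₂)
open import Data.Sum using (_⊎_)
open import Relation.Nullary using (¬_)
open import Relation.Binary.PropositionalEquality using (_≡_; _≢_)
open import Relation.Binary.Construct.Closure.ReflexiveTransitive using (Star)
open import Function.Bundles using (_⇔_)

Adj : ℕ → Set
Adj n = Fin n → Fin n → Bool

IsSimple : ∀ {n} → Adj n → Set
IsSimple {n} A = (∀ x y → A x y ≡ A y x) × (∀ x → A x x ≡ false)

Connected : ∀ {n} → Adj n → Set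
Connected {n} A = ∀ (x y : Fin n) → Star (λ a b → A a b ≡ true) x y

addEdge : ∀ {n} → Adj n → Fin n → Fin n → Adj n
addEdge A u v x y =
  A x y ∨ (((toℕ x ≡ᵇ toℕ u) ∧ (toℕ y ≡ᵇ toℕ v)) ∨ ((toℕ x ≡ᵇ toℕ v) ∧ (toℕ y ≡ᵇ toℕ u)))

sumFin : ∀ {n} → (Fin n → ℕ) → ℕ
sumFin {zero}  f = 0
sumFin {suc n} f = f F.zero + sumFin (λ i → f (F.suc i))

bit : Bool → ℕ
bit true  = 1
bit false = 0

numEdges : ∀ {n} → Adj n → ℕ
numEdges A = sumFin (λ x → sumFin (λ y → bit ((toℕ x <ᵇ toℕ y) ∧ A x y)))

iter : {X : Set} → ℕ → (X → X) → X → X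
iter zero    f x = x
iter (suc k) f x = f (iter k f x)

Dart : ∀ {n} → Adj n → Set
Dart {n} A = Σ (Fin n × Fin n) (λ p → A (proj₁ p) (proj₂ p) ≡ true)

tail : ∀ {n} {A : Adj n} → Dart A → Fin n
tail d = proj₁ (proj₁ d)

rev : ∀ {n} {A : Adj n} → (∀ x y → A x y ≡ A y x) → Dart A → Dart A
rev {A = A} sym ((u , v) , e) = (v , u) , Relation.Binary.PropositionalEquality.trans (sym v u) e

record Rotation {n} (A : Adj n) : Set where
  field
    σ      : Dart A → Dart A
    σ⁻¹    : Dart A → Dart A
    σσ⁻¹   : ∀ d → σ (σ⁻¹ d) ≡ d
    σ⁻¹σ   : ∀ d → σ⁻¹ (σ d) ≡ d
    σ-tail : ∀ d → tail {A = A} (σ d) ≡ tail {A = A} d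
    σ-cyc  : ∀ d d' → tail {A = A} d ≡ tail {A = A} d' → ∃ λ k → iter k σ d ≡ d'

-- The rotation system has F faces (orbits of the face permutation σ ∘ rev),
-- witnessed by a surjective labelling of darts by Fin F whose fibres are the orbits.
HasFaces : ∀ {n} {A : Adj n} → (∀ x y → A x y ≡ A y x) → Rotation A → ℕ → Set
HasFaces {A = A} sym R F =
  Σ (Dart A → Fin F) λ face →
    (∀ f → ∃ λ d → face d ≡ f) ×
    (∀ d d' → (face d ≡ face d') ⇔ (∃ λ k → iter k (λ e → Rotation.σ R (rev sym e)) d ≡ d'))

-- Sphere graph: a connected simple graph with a combinatorial embedding of
-- Euler characteristic 2 (V - E + F = 2), i.e. a cellular embedding in the 2-sphere.
SphereGraph : ∀ {n} → Adj n → Set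
SphereGraph {n} A =
  Σ (IsSimple A) λ s →
    Connected A ×
    Σ (Rotation A) λ R → Σ ℕ λ F →
      HasFaces (proj₁ s) R F × (n + F ≡ numEdges A + 2)

Triangulation : ∀ {n} → Adj n → Set
Triangulation {n} P =
  3 ≤ n × SphereGraph P ×
  (∀ u v → u ≢ v → P u v ≡ false → ¬ SphereGraph (addEdge P u v))

record Braced : Set where
  constructor braced
  field
    n : ℕ
    P : Adj n
    B : Adj n
open Braced public

IsBracedTriangulation : Braced → Set
IsBracedTriangulation G =
  Triangulation (P G) × IsSimple (B G) ×
  (∀ x y → B G x y ≡ true → P G x y ≡ false)

Gr : (G : Braced) → Adj (n G)
Gr G x y = P G x y ∨ B G x y

ContractibleInP : ∀ {n} → Adj n → Fin n → Fin n → Set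
ContractibleInP P u v =
  P u v ≡ true ×
  Σ _ λ w₁ → Σ _ λ w₂ → w₁ ≢ w₂ ×
    P u w₁ ≡ true × P v w₁ ≡ true × P u w₂ ≡ true × P v w₂ ≡ true ×
    (∀ w → P u w ≡ true → P v w ≡ true → w ≡ w₁ ⊎ w ≡ w₂)

ContractibleIn : (G : Braced) → Fin (n G) → Fin (n G) → Set
ContractibleIn G u v =
  ContractibleInP (P G) u v ×
  (∀ w → ¬ ((B G u w ≡ true × Gr G v w ≡ true) ⊎ (Gr G u w ≡ true × B G v w ≡ true)))

-- G' is obtained from G by a topological vertex splitting move:
-- G' is a braced triangulation, uv is an edge of P' contractible in G',
-- and G is (isomorphic to) (P'/uv , B'), witnessed by the quotient map f
-- identifying exactly u and v.
Split : Braced → Braced → Set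
Split G G' =
  IsBracedTriangulation G' ×
  Σ (Fin (n G') → Fin (n G)) λ f → Σ (Fin (n G')) λ u → Σ (Fin (n G')) λ v →
    ContractibleIn G' u v ×
    f u ≡ f v ×
    (∀ x → ∃ λ a → f a ≡ x) ×
    (∀ a b → f a ≡ f b → a ≡ b ⊎ ((a ≡ u ⊎ a ≡ v) × (b ≡ u ⊎ b ≡ v))) ×
    (∀ x y → (P G x y ≡ true) ⇔
       (x ≢ y × ∃ λ a → ∃ λ b → f a ≡ x × f b ≡ y × P G' a b ≡ true)) ×
    (∀ x y → (B G x y ≡ true) ⇔
       (∃ λ a → ∃ λ b → f a ≡ x × f b ≡ y × B G' a b ≡ true))

Iso : Braced → Braced → Set
Iso G H =
  Σ (Fin (n G) → Fin (n H)) λ f → Σ (Fin (n H) → Fin (n G)) λ g →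
    (∀ x → g (f x) ≡ x) × (∀ y → f (g y) ≡ y) ×
    (∀ x y → P H (f x) (f y) ≡ P G x y) ×
    (∀ x y → B H (f x) (f y) ≡ B G x y)

mem : List (ℕ × ℕ) → ℕ → ℕ → Bool
mem []             a b = false
mem ((p , q) ∷ es) a b =
  (((a ≡ᵇ p) ∧ (b ≡ᵇ q)) ∨ ((a ≡ᵇ q) ∧ (b ≡ᵇ p))) ∨ mem es a b

fromList : ∀ {n} → List (ℕ × ℕ) → Adj n
fromList es x y = mem es (toℕ x) (toℕ y)

-- (I) vertices 1..6 ↦ 0..5; octahedron
octaEdges : List (ℕ × ℕ)
octaEdges = (0 , 1) ∷ (0 , 2) ∷ (0 , 4) ∷ (0 , 5) ∷ (1 , 2) ∷ (1 , 3) ∷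
            (1 , 5) ∷ (2 , 3) ∷ (2 , 4) ∷ (3 , 4) ∷ (3 , 5) ∷ (4 , 5) ∷ []

baseI : Braced
baseI = braced 6 (fromList octaEdges) (fromList ((0 , 3) ∷ (1 , 4) ∷ []))

-- (II),(III) vertices a,t,c,m,h,k ↦ 0,1,2,3,4,5
P₂ : List (ℕ × ℕ)
P₂ = (0 , 1) ∷ (1 , 2) ∷ (2 , 0) ∷ (0 , 3) ∷ (3 , 2) ∷ (4 , 0) ∷
     (4 , 3) ∷ (4 , 2) ∷ (1 , 4) ∷ (3 , 5) ∷ (5 , 4) ∷ (5 , 2) ∷ []

baseII : Braced
baseII = braced 6 (fromList P₂) (fromList ((1 , 3) ∷ (5 , 0) ∷ []))

baseIII : Braced
baseIII = braced 6 (fromList P₂) (fromList ((1 , 3) ∷ (1 , 5) ∷ []))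

-- (IV),(V) vertices s1,s2,s3,s4,v1,v2,v3 ↦ 0,1,2,3,4,5,6
P₄ : List (ℕ × ℕ)
P₄ = (0 , 2) ∷ (2 , 5) ∷ (5 , 0) ∷ (3 , 4) ∷ (4 , 1) ∷ (1 , 5) ∷ (3 , 0) ∷
     (4 , 0) ∷ (1 , 0) ∷ (1 , 2) ∷ (4 , 2) ∷ (3 , 2) ∷ (3 , 6) ∷ (6 , 0) ∷
     (6 , 2) ∷ []

baseIV : Braced
baseIV = braced 7 (fromList P₄) (fromList ((4 , 5) ∷ (4 , 6) ∷ []))

P₅ : List (ℕ × ℕ)
P₅ = (0 , 2) ∷ (2 , 5) ∷ (5 , 0) ∷ (3 , 4) ∷ (4 , 1) ∷ (1 , 5) ∷ (3 , 0) ∷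
     (4 , 0) ∷ (1 , 0) ∷ (1 , 2) ∷ (4 , 2) ∷ (3 , 6) ∷ (6 , 0) ∷ (6 , 2) ∷
     (4 , 6) ∷ []

baseV : Braced
baseV = braced 7 (fromList P₅) (fromList ((4 , 5) ∷ (3 , 2) ∷ []))

base : Fin 5 → Braced
base F.zero                                   = baseI
base (F.suc F.zero)                           = baseII
base (F.suc (F.suc F.zero))                   = baseIII
base (F.suc (F.suc (F.suc F.zero)))           = baseIV
base (F.suc (F.suc (F.suc (F.suc F.zero))))   = baseV

data Constructible : Braced → Set where
  start : ∀ {G} (i : Fin 5) → Iso (base i) G → Constructible G
  step  : ∀ {G G'} → Constructible G → Split G G' → Constructible G'

{-# OPTIONS --safe #-}

-- Contracting a contractible edge leaves a braced triangulation from which the original one is recovered by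
-- a vertex splitting move, so by induction on the number of vertices it suffices to show that a braced
-- triangulation with two braces and without contractible edges is one of the five.
--
-- The topology of the sphere enters through homology. On a connected map with V + F = E + 2 the coboundary
-- operators ℤ^F → ℤ^E (across an edge) and ℤ^V → ℤ^E (along an edge) have orthogonal images; counting
-- dimensions, a nonzero multiple of every cycle is the coboundary of a function on the faces. For a 3-cycle
-- this function takes two values, and a 3-cycle thus has two sides. For instance, a maximal sphere graph has
-- only triangular faces: in a longer face a, b, c, d, … the vertices a, c and b, d would be adjacent, but b
-- and d lie on different sides of the 3-cycle abc.
--
-- Without contractible edges, every edge of P lies in a non-facial 3-cycle of P or in a 3-cycle with a brace.
-- An inclusion-minimal side of a non-facial 3-cycle abc meets only edges of the second kind, which forces it
-- to consist of a single brace end ξ of degree three (a cap). Suppose the other end η of the brace at ξ is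
-- adjacent to a, b, c. Exactly one of the 3-cycles abη, bcη, caη is not a face, and its side away from ξ
-- contains another cap ζ. As some edge contractible in P leads from each vertex of a non-facial 3-cycle into
-- either side, and such an edge must meet the brace at ζ, each of a, b, η (say) is a neighbour of ζ or
-- its partner; this leaves (II), (IV) and (V). The other possibilities lead to (III), and to (I) if there is
-- no non-facial 3-cycle.

module Submission where

open import Defs
open import Data.Nat using (ℕ; zero; suc; _+_; _*_; _∸_; _≤_; _<_; _<ᵇ_; _≡ᵇ_; z≤n; s≤s)
import Data.Nat.Properties as ℕₚ
open import Data.Nat.Induction using (Acc; acc; <-wellFounded)
open import Data.Nat.Tactic.RingSolver using (solve-∀)
import Data.Integer as ℤ
open import Data.Integer using (ℤ; 0ℤ; 1ℤ) renaming (_+_ to _+ᶻ_; _*_ to _*ᶻ_; _-_ to _-ᶻ_; -_ to -ᶻ_)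
import Data.Integer.Properties as ℤₚ
import Data.Integer.Tactic.RingSolver as ℤSolver
open import Data.Fin as Fin using (Fin; zero; suc; toℕ; punchIn; punchOut)
import Data.Fin.Properties as Finₚ
open import Data.Fin.Patterns using (0F; 1F; 2F; 3F; 4F; 5F; 6F)
open import Data.Fin.Permutation using (permutation)
open import Data.Bool using (Bool; true; false; not; _∧_; _∨_; if_then_else_)
import Data.Bool.Properties as Boolₚ
open import Data.Vec using (Vec; []; _∷_; lookup; zipWith; replicate)
import Data.Vec.Properties
open import Data.List as List using (List; []; _∷_; length; _++_; filter; allFin; cartesianProduct)
import Data.List.Properties as Listₚ
open import Data.List.Membership.Propositional using (_∈_; _∉_)
open import Data.List.Membership.Propositional.Properties
open import Data.List.Relation.Unary.Any as Any using (here; there)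
import Data.List.Relation.Unary.Any.Properties as Anyₚ
open import Data.List.Relation.Unary.All as All using (All; []; _∷_)
import Data.List.Relation.Unary.All.Properties as Allₚ
open import Data.List.Relation.Unary.AllPairs using ([]; _∷_)
open import Data.List.Relation.Unary.Unique.Propositional using (Unique)
import Data.List.Relation.Unary.Unique.Propositional.Properties as Uniqueₚ
open import Data.List.Relation.Binary.Subset.Propositional using (_⊆_)
open import Data.Product using (∃; ∃₂; _×_; _,_; proj₁; proj₂; swap; uncurry)
open import Data.Product.Properties using (≡-dec; ,-injectiveˡ; ,-injectiveʳ)
open import Data.Sum using (_⊎_; inj₁; inj₂; [_,_]′)
open import Data.Empty using (⊥; ⊥-elim)
open import Axiom.UniquenessOfIdentityProofs.WithK using (uip)
open import Function using (_∘_; id; case_of_)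
open import Function.Bundles using (_⇔_; mk⇔; Equivalence)
open import Relation.Nullary using (¬_; Dec; yes; no; does; contradiction)
open import Relation.Nullary.Decidable using (True; toWitness; _→-dec_; _×-dec_; _⊎-dec_; ¬?; dec-true; dec-false; decidable-stable)
open import Relation.Unary using (Decidable)
open import Relation.Binary.PropositionalEquality
  using (_≡_; _≢_; refl; sym; trans; cong; cong₂; subst; subst₂; ≢-sym; _≗_; module ≡-Reasoning)
open import Relation.Binary.Construct.Closure.ReflexiveTransitive using (Star; ε; _◅_; gmap)
open import Relation.Binary using (tri<; tri≈; tri>)
open import Algebra.Properties.CommutativeMonoid.Sum ℤₚ.+-0-commutativeMonoid
  using (sum; sum-cong-≗; ∑-distrib-+; ∑-comm; sum-permute; sum-replicate-zero)
open import Algebra.Properties.Semiring.Sum ℤₚ.+-*-semiring using (*-distribˡ-sum)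

-- No embedding is carried through the induction. A stage consists of the function `t`, giving the
-- third vertex of the face to the left of a dart, and of the inequality E + 6 ≤ 3V. Contracting an
-- edge loses one vertex and at least three edges, so the inequality survives without any count of
-- faces. It suffices to recover the sphere: with 2E ≤ 3F it gives E + 2 ≤ V + F, and the opposite
-- inequality holds for every connected map, by the same linear system that produces the potentials.
-- Maximality is again a count, since one more edge would violate E + 6 ≤ 3V. The obstacle in the
-- classification is a minimal side all of whose vertices are brace ends and whose cycle has three
-- different apexes. Two of these apexes form a brace. Too few brace ends are then left for the
-- vertices of the cycle, and the brace triangles at the edges between apexes and cycle make one
-- apex adjacent to the whole cycle.

private variable
  X : Set

pattern here₁ p = there (here p)
pattern here₂ p = there (here₁ p)
pattern here₃ p = there (here₂ p)
pattern here₄ p = there (here₃ p)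
pattern here₅ p = there (here₄ p)

pattern alt₂ p = inj₂ (inj₁ p)
pattern alt₃ p = inj₂ (alt₂ p)
pattern alt₄ p = inj₂ (inj₂ (inj₂ p))


-- Counting in lists; darts and edges of a graph

⊆-drop-∉ : ∀ {x : X} {xs ys zs} → x ∉ xs → xs ⊆ ys ++ x ∷ zs → xs ⊆ ys ++ zs
⊆-drop-∉ {ys = ys} x∉ sub v∈ with ∈-++⁻ ys (sub v∈)
... | inj₁ p           = ∈-++⁺ˡ p
... | inj₂ (here refl) = contradiction v∈ x∉
... | inj₂ (there p)   = ∈-++⁺ʳ ys p

-- Serves as the pigeonhole principle throughout: contradictions of the form "four distinct vertices
-- among three" are instances of it.
unique-⊆⇒length≤ : ∀ {xs ys : List X} → Unique xs → xs ⊆ ys → length xs ≤ length ys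
unique-⊆⇒length≤ [] sub = z≤n
unique-⊆⇒length≤ {xs = x ∷ xs} (x≢ ∷ uniq) sub with ∈-∃++ (sub (here refl))
... | ys , zs , refl = subst (suc (length xs) ≤_) eq (s≤s (unique-⊆⇒length≤ uniq
        (⊆-drop-∉ {ys = ys} (Allₚ.All¬⇒¬Any x≢) (sub ∘ there))))
  where
  eq : suc (length (ys ++ zs)) ≡ length (ys ++ x ∷ zs)
  eq rewrite Listₚ.length-++ ys {zs} | Listₚ.length-++ ys {x ∷ zs} = sym (ℕₚ.+-suc _ _)

lookup-injective : ∀ {xs : List X} → Unique xs → ∀ i j → List.lookup xs i ≡ List.lookup xs j → i ≡ j
lookup-injective (_ ∷ _) zero zero eq = refl
lookup-injective {xs = _ ∷ xs} (x≢ ∷ _) zero (suc j) eq = ⊥-elim (All.lookup x≢ (∈-lookup {xs = xs} j) eq)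
lookup-injective {xs = _ ∷ xs} (x≢ ∷ _) (suc i) zero eq = ⊥-elim (All.lookup x≢ (∈-lookup {xs = xs} i) (sym eq))
lookup-injective (_ ∷ u) (suc i) (suc j) eq = cong suc (lookup-injective u i j eq)

length-filter-tabulate : ∀ {P : X → Set} (P? : Decidable P) {k} (f : Fin k → X) →
  length (filter P? (List.tabulate f)) ≡ sumFin (λ i → bit (does (P? (f i))))
length-filter-tabulate P? {zero} f = refl
length-filter-tabulate P? {suc k} f with does (P? (f zero))
... | true  = cong suc (length-filter-tabulate P? (f ∘ suc))
... | false = length-filter-tabulate P? (f ∘ suc)

length-filter-product : ∀ {X Y : Set} {P : X × Y → Set} (P? : Decidable P) {k l} (f : Fin k → X) (g : Fin l → Y) →
  length (filter P? (cartesianProduct (List.tabulate f) (List.tabulate g)))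
    ≡ sumFin (λ i → sumFin (λ j → bit (does (P? (f i , g j)))))
length-filter-product P? {zero} f g = refl
length-filter-product P? {suc k} f g = begin
  length (filter P? (List.map (f zero ,_) (List.tabulate g) ++ rest))
    ≡⟨ cong length (Listₚ.filter-++ P? (List.map (f zero ,_) (List.tabulate g)) rest) ⟩
  length (filter P? (List.map (f zero ,_) (List.tabulate g)) ++ filter P? rest)
    ≡⟨ Listₚ.length-++ (filter P? (List.map (f zero ,_) (List.tabulate g))) ⟩
  length (filter P? (List.map (f zero ,_) (List.tabulate g))) + length (filter P? rest)
    ≡⟨ cong₂ _+_ (trans (cong (length ∘ filter P?) (Listₚ.map-tabulate g (f zero ,_)))
                        (length-filter-tabulate P? (λ j → f zero , g j)))
                 (length-filter-product P? (f ∘ suc) g) ⟩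
  _ ∎
  where
  open ≡-Reasoning
  rest = cartesianProduct (List.tabulate (f ∘ suc)) (List.tabulate g)

sumFin-cong : ∀ {k} {f g : Fin k → ℕ} → f ≗ g → sumFin f ≡ sumFin g
sumFin-cong {zero} e = refl
sumFin-cong {suc k} e = cong₂ _+_ (e zero) (sumFin-cong (e ∘ suc))

_≟²_ : ∀ {n} (p q : Fin n × Fin n) → Dec (p ≡ q)
_≟²_ = ≡-dec Fin._≟_ Fin._≟_

pairs : ∀ n → List (Fin n × Fin n)
pairs n = cartesianProduct (allFin n) (allFin n)

∈-pairs : ∀ {n} (p : Fin n × Fin n) → p ∈ pairs n
∈-pairs (u , v) = ∈-cartesianProduct⁺ (∈-allFin u) (∈-allFin v)

pairs-unique : ∀ n → Unique (pairs n)
pairs-unique n = Uniqueₚ.cartesianProduct⁺ (Uniqueₚ.allFin⁺ n) (Uniqueₚ.allFin⁺ n)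

IsDart IsEdge : ∀ {n} → Adj n → Fin n × Fin n → Set
IsDart A (u , v) = A u v ≡ true
IsEdge A (u , v) = ((toℕ u <ᵇ toℕ v) ∧ A u v) ≡ true

isDart? : ∀ {n} (A : Adj n) → Decidable (IsDart A)
isDart? A (u , v) = A u v Boolₚ.≟ true

isEdge? : ∀ {n} (A : Adj n) → Decidable (IsEdge A)
isEdge? A (u , v) = ((toℕ u <ᵇ toℕ v) ∧ A u v) Boolₚ.≟ true

darts edges : ∀ {n} → Adj n → List (Fin n × Fin n)
darts A = filter (isDart? A) (pairs _)
edges A = filter (isEdge? A) (pairs _)

module _ {n} (A : Adj n) where

  darts-unique : Unique (darts A)
  darts-unique = Uniqueₚ.filter⁺ (isDart? A) (pairs-unique n)

  edges-unique : Unique (edges A)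
  edges-unique = Uniqueₚ.filter⁺ (isEdge? A) (pairs-unique n)

  ∈-darts : ∀ {u v} → A u v ≡ true → (u , v) ∈ darts A
  ∈-darts = ∈-filter⁺ (isDart? A) (∈-pairs _)

  ∈-darts⁻ : ∀ {u v} → (u , v) ∈ darts A → A u v ≡ true
  ∈-darts⁻ = proj₂ ∘ ∈-filter⁻ (isDart? A) {xs = pairs n}

  ∈-edges : ∀ {u v} → toℕ u < toℕ v → A u v ≡ true → (u , v) ∈ edges A
  ∈-edges u<v e = ∈-filter⁺ (isEdge? A) (∈-pairs _) (cong₂ _∧_ (<ᵇ-true u<v) e)
    where
    <ᵇ-true : ∀ {i j} → i < j → (i <ᵇ j) ≡ true
    <ᵇ-true p = Equivalence.to Boolₚ.T-≡ (ℕₚ.<⇒<ᵇ p)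

  ∈-edges⁻ : ∀ {u v} → (u , v) ∈ edges A → toℕ u < toℕ v × A u v ≡ true
  ∈-edges⁻ {u} {v} p with ∈-filter⁻ (isEdge? A) {xs = pairs n} p
  ... | _ , e = ℕₚ.<ᵇ⇒< _ _ (Equivalence.from Boolₚ.T-≡ (Boolₚ.∧-conicalˡ _ _ e)) , Boolₚ.∧-conicalʳ (toℕ u <ᵇ toℕ v) _ e

  length-edges : length (edges A) ≡ numEdges A
  length-edges = trans (length-filter-product (isEdge? A) id id)
    (sumFin-cong λ u → sumFin-cong λ v → cong bit (lem ((toℕ u <ᵇ toℕ v) ∧ A u v)))
    where
    lem : ∀ b → does (b Boolₚ.≟ true) ≡ b
    lem true = refl
    lem false = refl

  module _ (simple : IsSimple A) where

    edges² : List (Fin n × Fin n)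
    edges² = edges A ++ List.map swap (edges A)

    length-edges² : length edges² ≡ 2 * numEdges A
    length-edges² rewrite Listₚ.length-++ (edges A) {List.map swap (edges A)}
      | Listₚ.length-map swap (edges A) | length-edges | ℕₚ.+-identityʳ (numEdges A) = refl

    edges²-unique : Unique edges²
    edges²-unique = Uniqueₚ.++⁺ edges-unique
      (Uniqueₚ.map⁺ (λ { refl → refl }) edges-unique)
      λ { (p , q) → case ∈-map⁻ swap q of λ { (_ , r , refl) →
          ℕₚ.<-asym (proj₁ (∈-edges⁻ p)) (proj₁ (∈-edges⁻ r)) } }

    edges²⊆darts : edges² ⊆ darts A
    edges²⊆darts p with ∈-++⁻ (edges A) p
    ... | inj₁ q = ∈-darts (proj₂ (∈-edges⁻ q))
    ... | inj₂ q with ∈-map⁻ swap q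
    ... | _ , r , refl = ∈-darts (trans (proj₁ simple _ _) (proj₂ (∈-edges⁻ r)))

    darts⊆edges² : darts A ⊆ edges²
    darts⊆edges² {u , v} p with ℕₚ.<-cmp (toℕ u) (toℕ v)
    ... | tri< lt _ _ = ∈-++⁺ˡ (∈-edges lt (∈-darts⁻ p))
    ... | tri> _ _ gt = ∈-++⁺ʳ (edges A) (∈-map⁺ swap (∈-edges gt (trans (proj₁ simple _ _) (∈-darts⁻ p))))
    ... | tri≈ _ eq _ with Finₚ.toℕ-injective eq
    ... | refl with trans (sym (∈-darts⁻ p)) (proj₂ simple u)
    ... | ()

    length-darts : length (darts A) ≡ 2 * numEdges A
    length-darts = trans (ℕₚ.≤-antisym (unique-⊆⇒length≤ darts-unique darts⊆edges²)
                                       (unique-⊆⇒length≤ edges²-unique edges²⊆darts)) length-edges²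

length-allFin : ∀ n → length (allFin n) ≡ n
length-allFin n = Listₚ.length-tabulate id

unique⇒length≤n : ∀ {n} {xs : List (Fin n)} → Unique xs → length xs ≤ n
unique⇒length≤n {n} {xs} u = subst (length xs ≤_) (length-allFin n) (unique-⊆⇒length≤ u λ _ → ∈-allFin _)

covering⇒n≤length : ∀ {n} (xs : List (Fin n)) → (∀ v → v ∈ xs) → n ≤ length xs
covering⇒n≤length {n} xs cov = subst (_≤ length xs) (length-allFin n) (unique-⊆⇒length≤ (Uniqueₚ.allFin⁺ n) λ _ → cov _)

-- Linear algebra over ℤ


dot : ∀ {N} → Vec ℤ N → Vec ℤ N → ℤ
dot []       []       = 0ℤ
dot (a ∷ as) (x ∷ xs) = a *ᶻ x +ᶻ dot as xs

lin : ∀ {N} → ℤ → ℤ → Vec ℤ N → Vec ℤ N → Vec ℤ N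
lin p q = zipWith (λ a b → p *ᶻ a +ᶻ q *ᶻ b)

scale : ∀ {N} → ℤ → Vec ℤ N → Vec ℤ N
scale p = Data.Vec.map (p *ᶻ_)

dot-lin : ∀ {N} p q (a b x : Vec ℤ N) → dot (lin p q a b) x ≡ p *ᶻ dot a x +ᶻ q *ᶻ dot b x
dot-lin p q [] [] [] = ring p q
  where
  ring : ∀ p q → 0ℤ ≡ p *ᶻ 0ℤ +ᶻ q *ᶻ 0ℤ
  ring = ℤSolver.solve-∀
dot-lin p q (a ∷ as) (b ∷ bs) (x ∷ xs) rewrite dot-lin p q as bs xs = ring p q a b x (dot as xs) (dot bs xs)
  where
  ring : ∀ p q a b x s t → (p *ᶻ a +ᶻ q *ᶻ b) *ᶻ x +ᶻ (p *ᶻ s +ᶻ q *ᶻ t) ≡ p *ᶻ (a *ᶻ x +ᶻ s) +ᶻ q *ᶻ (b *ᶻ x +ᶻ t)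
  ring = ℤSolver.solve-∀

dot-scale : ∀ {N} p (a x : Vec ℤ N) → dot a (scale p x) ≡ p *ᶻ dot a x
dot-scale p [] [] = sym (ℤₚ.*-zeroʳ p)
dot-scale p (a ∷ as) (x ∷ xs) rewrite dot-scale p as xs = ring p a x (dot as xs)
  where
  ring : ∀ p a x s → a *ᶻ (p *ᶻ x) +ᶻ p *ᶻ s ≡ p *ᶻ (a *ᶻ x +ᶻ s)
  ring = ℤSolver.solve-∀

unit : ∀ {N} → Fin N → Vec ℤ N
unit zero    = 1ℤ ∷ replicate _ 0ℤ
unit (suc i) = 0ℤ ∷ unit i

dot-zero : ∀ {N} (x : Vec ℤ N) → dot (replicate N 0ℤ) x ≡ 0ℤ
dot-zero [] = refl
dot-zero (x ∷ xs) rewrite dot-zero xs = refl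

dot-unit : ∀ {N} i (x : Vec ℤ N) → dot (unit i) x ≡ lookup x i
dot-unit zero (x ∷ xs) rewrite dot-zero xs = ring x
  where
  ring : ∀ x → 1ℤ *ᶻ x +ᶻ 0ℤ ≡ x
  ring = ℤSolver.solve-∀
dot-unit (suc i) (x ∷ xs) rewrite dot-unit i xs = ℤₚ.+-identityˡ _

Solves : ∀ {N} → Vec ℤ N → Vec ℤ N → Set
Solves x e = dot e x ≡ 0ℤ

headZero : ∀ {N} → Vec ℤ (suc N) → Set
headZero e = Data.Vec.head e ≡ 0ℤ

-- The list `e ∷ es′` rearranges `es` with a pivot row in front; apart from the length, only the
-- transfer of solutions back to `es` is recorded.
pivot : ∀ {N} (es : List (Vec ℤ (suc N))) → All headZero es ⊎
  ∃₂ λ e es′ → ¬ headZero e × length es ≡ suc (length es′) × (∀ {x} → All (Solves x) (e ∷ es′) → All (Solves x) es)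
pivot [] = inj₁ []
pivot (e ∷ es) with Data.Vec.head e ℤ.≟ 0ℤ
... | no  e≢0 = inj₂ (e , es , e≢0 , refl , id)
... | yes e≡0 with pivot es
...   | inj₁ all = inj₁ (e≡0 ∷ all)
...   | inj₂ (e′ , es′ , e′≢0 , len , back) =
        inj₂ (e′ , e ∷ es′ , e′≢0 , cong suc len , λ { (p ∷ q ∷ r) → q ∷ back (p ∷ r) })

-- Division-free row operation: `p` times the second row minus `q` times the first has leading entry
-- zero, which is dropped.
eliminate : ∀ {N} → Vec ℤ (suc N) → Vec ℤ (suc N) → Vec ℤ N
eliminate (p ∷ a) (q ∷ b) = lin p (-ᶻ q) b a

-- Gaussian elimination over ℤ. If no equation involves the first unknown, the first unit vector is
-- a solution; otherwise one equation and one unknown are eliminated together.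
underdetermined : ∀ {N} (es : List (Vec ℤ N)) → length es < N →
  ∃ λ x → (∃ λ i → lookup x i ≢ 0ℤ) × All (Solves x) es
underdetermined {suc N} es lt with pivot es
... | inj₁ zeros = unit zero , (zero , λ ()) , All.map (λ {e} → first e) zeros
  where
  dot-comm-zero : ∀ {N} (x : Vec ℤ N) → dot x (replicate N 0ℤ) ≡ 0ℤ
  dot-comm-zero [] = refl
  dot-comm-zero (x ∷ xs) rewrite dot-comm-zero xs = trans (ℤₚ.+-identityʳ _) (ℤₚ.*-zeroʳ x)
  first : ∀ (e : Vec ℤ (suc N)) → headZero e → Solves (unit zero) e
  first (_ ∷ a) refl = trans (cong (0ℤ +ᶻ_) (dot-comm-zero a)) refl
... | inj₂ (p ∷ a , es′ , p≢0 , len , back)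
  with underdetermined (List.map (eliminate (p ∷ a)) es′)
         (subst (_< N) (sym (Listₚ.length-map _ es′)) (ℕₚ.≤-pred (subst (_< suc N) len lt)))
... | y , (i , yᵢ≢0) , sols = x , (suc i , xᵢ≢0) , back (solves-e ∷ All.map (λ {e} → solves e) (Allₚ.map⁻ sols))
  where
  -- Back substitution without division: the smaller solution is scaled by the pivot `p`, and it
  -- stays nonzero because ℤ has no zero divisors.
  x = (-ᶻ dot a y) ∷ scale p y
  xᵢ≢0 : lookup x (suc i) ≢ 0ℤ
  xᵢ≢0 eq with ℤₚ.i*j≡0⇒i≡0∨j≡0 p (trans (sym (Data.Vec.Properties.lookup-map i (p *ᶻ_) y)) eq)
  ... | inj₁ p≡0 = p≢0 p≡0
  ... | inj₂ y≡0 = yᵢ≢0 y≡0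
  solves-e : Solves x (p ∷ a)
  solves-e rewrite dot-scale p a y = ring p (dot a y)
    where
    ring : ∀ p s → p *ᶻ (-ᶻ s) +ᶻ p *ᶻ s ≡ 0ℤ
    ring = ℤSolver.solve-∀
  solves : ∀ e → Solves y (eliminate (p ∷ a) e) → Solves x e
  solves (q ∷ b) sol rewrite dot-scale p b y =
    trans (ring p q (dot a y) (dot b y)) (trans (sym (dot-lin p (-ᶻ q) b a y)) sol)
    where
    ring : ∀ p q s t → q *ᶻ (-ᶻ s) +ᶻ p *ᶻ t ≡ p *ᶻ t +ᶻ (-ᶻ q) *ᶻ s
    ring = ℤSolver.solve-∀

-- Maps on the sphere and their homology


sum-zero : ∀ {k} (f : Fin k → ℤ) → (∀ i → f i ≡ 0ℤ) → sum f ≡ 0ℤ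
sum-zero {k} f z = trans (sum-cong-≗ {x = f} {y = λ _ → 0ℤ} z) (sum-replicate-zero k)

sum-nonneg : ∀ {k} (f : Fin k → ℤ) → (∀ i → 0ℤ ℤ.≤ f i) → 0ℤ ℤ.≤ sum f
sum-nonneg {zero}  f nn = ℤₚ.≤-refl
sum-nonneg {suc k} f nn = ℤₚ.+-mono-≤ (nn zero) (sum-nonneg (f ∘ suc) (nn ∘ suc))

+-nonneg-zero : ∀ {i j} → 0ℤ ℤ.≤ i → 0ℤ ℤ.≤ j → i +ᶻ j ≡ 0ℤ → i ≡ 0ℤ × j ≡ 0ℤ
+-nonneg-zero {ℤ.+_ i} {ℤ.+_ j} _ _ eq with ℤₚ.+-injective eq
... | eq′ = cong ℤ.+_ (ℕₚ.m+n≡0⇒m≡0 i eq′) , cong ℤ.+_ (ℕₚ.m+n≡0⇒n≡0 i eq′)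

sum-nonneg-zero : ∀ {k} (f : Fin k → ℤ) → (∀ i → 0ℤ ℤ.≤ f i) → sum f ≡ 0ℤ → ∀ i → f i ≡ 0ℤ
sum-nonneg-zero {suc k} f nn eq i with +-nonneg-zero (nn zero) (sum-nonneg (f ∘ suc) (nn ∘ suc)) eq
sum-nonneg-zero f nn eq zero    | p , q = p
sum-nonneg-zero f nn eq (suc i) | p , q = sum-nonneg-zero (f ∘ suc) (nn ∘ suc) q i

sum² : ∀ {k} → (Fin k → Fin k → ℤ) → ℤ
sum² f = sum λ u → sum (f u)

sum²-cong : ∀ {k} {f g : Fin k → Fin k → ℤ} → (∀ u v → f u v ≡ g u v) → sum² f ≡ sum² g
sum²-cong {f = f} {g} e = sum-cong-≗ {x = λ u → sum (f u)} {y = λ u → sum (g u)} λ u → sum-cong-≗ {x = f u} {y = g u} (e u)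

sum²-+ : ∀ {k} (f g : Fin k → Fin k → ℤ) → sum² (λ u v → f u v +ᶻ g u v) ≡ sum² f +ᶻ sum² g
sum²-+ f g = trans (sum-cong-≗ {y = λ u → sum (f u) +ᶻ sum (g u)} λ u → ∑-distrib-+ (f u) (g u))
                   (∑-distrib-+ (λ u → sum (f u)) (λ u → sum (g u)))

square-nonneg : ∀ i → 0ℤ ℤ.≤ i *ᶻ i
square-nonneg (ℤ.+ zero)   = ℤ.+≤+ z≤n
square-nonneg (ℤ.+ suc k)  = ℤ.+≤+ z≤n
square-nonneg (ℤ.-[1+ k ]) = ℤ.+≤+ z≤n

square-zero : ∀ i → i *ᶻ i ≡ 0ℤ → i ≡ 0ℤ
square-zero i eq with ℤₚ.i*j≡0⇒i≡0∨j≡0 i eq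
... | inj₁ p = p
... | inj₂ p = p

false≢true : ∀ {A : Set} {b : Bool} → b ≡ true → b ≡ false → A
false≢true refl ()

-- Every N u and M u is a permutation of all vertices, fixing the non-neighbours of u.
record Map {n} (A : Adj n) (F : ℕ) : Set where
  field
    simple     : IsSimple A
    connected  : Connected A
    N M        : Fin n → Fin n → Fin n
    N-edge     : ∀ {u v} → A u v ≡ true → A u (N u v) ≡ true
    N-fix      : ∀ {u v} → A u v ≡ false → N u v ≡ v
    NM         : ∀ u v → N u (M u v) ≡ v
    MN         : ∀ u v → M u (N u v) ≡ v
    cyclic     : ∀ u {v w} → A u v ≡ true → A u w ≡ true → ∃ λ k → iter k (N u) v ≡ w
    face       : Fin n → Fin n → Fin F
    face-step  : ∀ {u v} → A u v ≡ true → face u v ≡ face v (N v u)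
    face-sur   : ∀ f → ∃₂ λ u v → A u v ≡ true × face u v ≡ f
    face-orbit : ∀ {u v u′ v′} → A u v ≡ true → A u′ v′ ≡ true → face u v ≡ face u′ v′ →
                 ∃ λ k → iter k (λ p → proj₂ p , N (proj₂ p) (proj₁ p)) (u , v) ≡ (u′ , v′)

  symm : ∀ {u v} → A u v ≡ true → A v u ≡ true
  symm {u} {v} e = trans (proj₁ simple v u) e

  edge⇒≢ : ∀ {u v} → A u v ≡ true → u ≢ v
  edge⇒≢ e refl = false≢true e (proj₂ simple _)

  iter-edge : ∀ k {u v} → A u v ≡ true → A u (iter k (N u) v) ≡ true
  iter-edge zero    e = e
  iter-edge (suc k) e = N-edge (iter-edge k e)

  face-step′ : ∀ {u v} → A u v ≡ true → face v u ≡ face u (N u v)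
  face-step′ e = face-step (symm e)

module Homology {n} {A : Adj n} {F} (𝓜 : Map A F) where
  open Map 𝓜

  ind : Fin n → Fin n → ℤ
  ind u v = if A u v then 1ℤ else 0ℤ

  ind-sym : ∀ u v → ind u v ≡ ind v u
  ind-sym u v = cong (if_then 1ℤ else 0ℤ) (proj₁ simple u v)

  A-N : ∀ u v → A u (N u v) ≡ A u v
  A-N u v with A u v in e
  ... | true  = N-edge e
  ... | false = trans (cong (A u) (N-fix e)) e

  module _ (z : Fin n → Fin n → ℤ) (z-row : ∀ u → sum (z u) ≡ 0ℤ) (z-col : ∀ v → sum (λ u → z u v) ≡ 0ℤ)
           (z-off : ∀ {u v} → A u v ≡ false → z u v ≡ 0ℤ)
           (c : Fin F → ℤ) (h : Fin n → ℤ) (m : ℤ)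
           (eqn : ∀ {u v} → A u v ≡ true →
                  (c (face u v) -ᶻ c (face v u)) +ᶻ (h v -ᶻ h u) ≡ m *ᶻ z u v) where

    private
      C : Fin n → Fin n → ℤ
      C u v = c (face u v)

    -- The coboundary of h is orthogonal to every boundary and every cycle, hence to itself.
    gradient-zero : ∀ {u v} → A u v ≡ true → h v ≡ h u
    gradient-zero {u} {v} e = ℤₚ.i-j≡0⇒i≡j (h v) (h u) (square-zero _ (trans (sym (square-edge e))
      (sum-nonneg-zero (q u) (q-nonneg u) (sum-nonneg-zero (λ u → sum (q u)) (λ u → sum-nonneg (q u) (q-nonneg u)) Σq≡0 u) v)))
      where
      q : Fin n → Fin n → ℤ
      q u v = ind u v *ᶻ ((h v -ᶻ h u) *ᶻ (h v -ᶻ h u))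
      square-edge : ∀ {u v} → A u v ≡ true → q u v ≡ (h v -ᶻ h u) *ᶻ (h v -ᶻ h u)
      square-edge {u} {v} e rewrite e = ℤₚ.*-identityˡ _
      q-nonneg : ∀ u v → 0ℤ ℤ.≤ q u v
      q-nonneg u v with A u v
      ... | true  = subst (0ℤ ℤ.≤_) (sym (ℤₚ.*-identityˡ _)) (square-nonneg (h v -ᶻ h u))
      ... | false = ℤₚ.≤-reflexive (sym (ℤₚ.*-zeroˡ ((h v -ᶻ h u) *ᶻ (h v -ᶻ h u))))
      a₁ a₂ a₃ a₄ z₁ z₂ : Fin n → Fin n → ℤ
      a₁ u v = (ind u v *ᶻ h v) *ᶻ C u v
      a₂ u v = (ind u v *ᶻ h u) *ᶻ C u v
      a₃ u v = (ind u v *ᶻ h v) *ᶻ C v u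
      a₄ u v = (ind u v *ᶻ h u) *ᶻ C v u
      z₁ u v = (m *ᶻ h u) *ᶻ z u v
      z₂ u v = (m *ᶻ h v) *ᶻ z u v
      -- This is `eqn` multiplied by `h v -ᶻ h u`, with the negative terms moved across; off the
      -- edges both sides vanish.
      pointwise : ∀ u v → ((q u v +ᶻ a₁ u v) +ᶻ a₄ u v) +ᶻ z₁ u v ≡ (z₂ u v +ᶻ a₂ u v) +ᶻ a₃ u v
      pointwise u v with A u v in e
      ... | true  = trans (ring₁ (h u) (h v) (C u v) (C v u) m (z u v))
                   (trans (cong (λ t → (h v -ᶻ h u) *ᶻ t +ᶻ ((1ℤ *ᶻ h v) *ᶻ C v u +ᶻ ((1ℤ *ᶻ h u) *ᶻ C u v +ᶻ (m *ᶻ h u) *ᶻ z u v))) (eqn e))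
                          (ring₂ (h u) (h v) (C u v) (C v u) m (z u v)))
        where
        ring₁ : ∀ a b x y m z → ((1ℤ *ᶻ ((b -ᶻ a) *ᶻ (b -ᶻ a)) +ᶻ (1ℤ *ᶻ b) *ᶻ x) +ᶻ (1ℤ *ᶻ a) *ᶻ y) +ᶻ (m *ᶻ a) *ᶻ z
              ≡ (b -ᶻ a) *ᶻ ((x -ᶻ y) +ᶻ (b -ᶻ a)) +ᶻ ((1ℤ *ᶻ b) *ᶻ y +ᶻ ((1ℤ *ᶻ a) *ᶻ x +ᶻ (m *ᶻ a) *ᶻ z))
        ring₁ = ℤSolver.solve-∀
        ring₂ : ∀ a b x y m z → (b -ᶻ a) *ᶻ (m *ᶻ z) +ᶻ ((1ℤ *ᶻ b) *ᶻ y +ᶻ ((1ℤ *ᶻ a) *ᶻ x +ᶻ (m *ᶻ a) *ᶻ z))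
              ≡ ((m *ᶻ b) *ᶻ z +ᶻ (1ℤ *ᶻ a) *ᶻ x) +ᶻ (1ℤ *ᶻ b) *ᶻ y
        ring₂ = ℤSolver.solve-∀
      ... | false rewrite z-off e = ring (h u) (h v) (C u v) (C v u) m
        where
        ring : ∀ a b x y m → ((0ℤ *ᶻ ((b -ᶻ a) *ᶻ (b -ᶻ a)) +ᶻ (0ℤ *ᶻ b) *ᶻ x) +ᶻ (0ℤ *ᶻ a) *ᶻ y) +ᶻ (m *ᶻ a) *ᶻ 0ℤ
             ≡ ((m *ᶻ b) *ᶻ 0ℤ +ᶻ (0ℤ *ᶻ a) *ᶻ x) +ᶻ (0ℤ *ᶻ b) *ᶻ y
        ring = ℤSolver.solve-∀
      swap-sum : ∀ (f g : Fin n → Fin n → ℤ) → (∀ u v → f u v ≡ g v u) → sum² f ≡ sum² g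
      swap-sum f g e = trans (sum²-cong {f = f} e) (∑-comm (λ u v → g v u))
      -- The darts u → v and v → `N v u` have the same face. For fixed `v` the permutation `N v`
      -- therefore turns the sum over incoming darts into the sum over outgoing ones.
      a₁≡a₂ : sum² a₁ ≡ sum² a₂
      a₁≡a₂ = trans (swap-sum a₁ (λ v u → a₁ u v) λ u v → refl) (sum-cong-≗ {x = λ v → sum (λ u → a₁ u v)} {y = λ v → sum (a₂ v)} λ v →
        trans (sum-cong-≗ {x = λ u → a₁ u v} {y = λ u → a₂ v (N v u)} (rotate v))
              (sym (sum-permute (a₂ v) (permutation (N v) (M v) (NM v) (MN v)))))
        where
        rotate : ∀ v u → a₁ u v ≡ a₂ v (N v u)
        rotate v u with A u v in e
        ... | true  rewrite A-N v u | proj₁ simple v u | e | face-step e = refl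
        ... | false rewrite A-N v u | proj₁ simple v u | e =
                trans (cong (_*ᶻ C u v) (ℤₚ.*-zeroˡ (h v))) (trans (ℤₚ.*-zeroˡ (C u v))
                  (sym (trans (cong (_*ᶻ C v (N v u)) (ℤₚ.*-zeroˡ (h v))) (ℤₚ.*-zeroˡ (C v (N v u))))))
      a₃≡a₂ : sum² a₃ ≡ sum² a₂
      a₃≡a₂ = swap-sum a₃ a₂ λ u v → cong (λ t → (t *ᶻ h v) *ᶻ C v u) (ind-sym u v)
      a₄≡a₁ : sum² a₄ ≡ sum² a₁
      a₄≡a₁ = swap-sum a₄ a₁ λ u v → cong (λ t → (t *ᶻ h u) *ᶻ C v u) (ind-sym u v)
      z₁≡0 : sum² z₁ ≡ 0ℤ
      z₁≡0 = sum-zero _ λ u → trans (sym (*-distribˡ-sum (m *ᶻ h u) (z u)))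
                                    (trans (cong ((m *ᶻ h u) *ᶻ_) (z-row u)) (ℤₚ.*-zeroʳ (m *ᶻ h u)))
      z₂≡0 : sum² z₂ ≡ 0ℤ
      z₂≡0 = trans (∑-comm z₂) (sum-zero _ λ v → trans (sym (*-distribˡ-sum (m *ᶻ h v) (λ u → z u v)))
                                    (trans (cong ((m *ᶻ h v) *ᶻ_) (z-col v)) (ℤₚ.*-zeroʳ (m *ᶻ h v))))
      Σq≡0 : sum² q ≡ 0ℤ
      Σq≡0 = cancel (sum² q) (sum² a₁) (sum² a₂) (begin
        ((sum² q +ᶻ sum² a₁) +ᶻ sum² a₁) +ᶻ 0ℤ          ≡⟨ cong₂ (λ s t → ((sum² q +ᶻ sum² a₁) +ᶻ s) +ᶻ t) (sym a₄≡a₁) (sym z₁≡0) ⟩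
        ((sum² q +ᶻ sum² a₁) +ᶻ sum² a₄) +ᶻ sum² z₁     ≡⟨ cong (λ t → (t +ᶻ sum² a₄) +ᶻ sum² z₁) (sym (sum²-+ q a₁)) ⟩
        (sum² (λ u v → q u v +ᶻ a₁ u v) +ᶻ sum² a₄) +ᶻ sum² z₁ ≡⟨ cong (_+ᶻ sum² z₁) (sym (sum²-+ _ a₄)) ⟩
        sum² (λ u v → (q u v +ᶻ a₁ u v) +ᶻ a₄ u v) +ᶻ sum² z₁ ≡⟨ sym (sum²-+ _ z₁) ⟩
        sum² (λ u v → ((q u v +ᶻ a₁ u v) +ᶻ a₄ u v) +ᶻ z₁ u v) ≡⟨ sum²-cong pointwise ⟩
        sum² (λ u v → (z₂ u v +ᶻ a₂ u v) +ᶻ a₃ u v)     ≡⟨ sum²-+ _ a₃ ⟩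
        sum² (λ u v → z₂ u v +ᶻ a₂ u v) +ᶻ sum² a₃      ≡⟨ cong (_+ᶻ sum² a₃) (sum²-+ z₂ a₂) ⟩
        (sum² z₂ +ᶻ sum² a₂) +ᶻ sum² a₃                 ≡⟨ cong₂ (λ s t → (s +ᶻ sum² a₂) +ᶻ t) z₂≡0 a₃≡a₂ ⟩
        (0ℤ +ᶻ sum² a₂) +ᶻ sum² a₂ ∎) a₁≡a₂
        where
        open ≡-Reasoning
        cancel : ∀ s a b → ((s +ᶻ a) +ᶻ a) +ᶻ 0ℤ ≡ (0ℤ +ᶻ b) +ᶻ b → a ≡ b → s ≡ 0ℤ
        cancel s a .a eq refl = trans (ring₃ s a) (trans (cong (_-ᶻ ((0ℤ +ᶻ a) +ᶻ a)) eq) (ℤₚ.i≡j⇒i-j≡0 {(0ℤ +ᶻ a) +ᶻ a} refl))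
          where
          ring₃ : ∀ s a → s ≡ (((s +ᶻ a) +ᶻ a) +ᶻ 0ℤ) -ᶻ ((0ℤ +ᶻ a) +ᶻ a)
          ring₃ = ℤSolver.solve-∀

  star-constant : ∀ {T : Set} (h : Fin n → T) → (∀ {u v} → A u v ≡ true → h v ≡ h u) → ∀ u v → h v ≡ h u
  star-constant h inv u v = go (connected u v)
    where
    go : ∀ {u v} → Star (λ a b → A a b ≡ true) u v → h v ≡ h u
    go ε = refl
    go (e ◅ p) = trans (go p) (inv e)

  around : ∀ {T : Set} (d : Fin n → Fin n → T) u → (∀ {v} → A u v ≡ true → d u (N u v) ≡ d u v) →
           ∀ {v w} → A u v ≡ true → A u w ≡ true → d u w ≡ d u v
  around d u inv {v} e e′ with cyclic u e e′
  ... | k , refl = go k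
    where
    go : ∀ k → d u (iter k (N u) v) ≡ d u v
    go zero = refl
    go (suc k) = trans (inv (iter-edge k e)) (go k)

  -- The dual graph inherits connectedness: turning around a vertex crosses one edge at a time, and
  -- a path of vertices links the turns.
  flat : ∀ (c : Fin F → ℤ) → (∀ {u v} → A u v ≡ true → c (face u v) ≡ c (face v u)) → ∀ f g → c f ≡ c g
  flat c e f g with face-sur f | face-sur g
  ... | u , v , uv , refl | u′ , v′ , uv′ , refl = go uv (connected u u′)
    where
    d : Fin n → Fin n → ℤ
    d u v = c (face u v)
    turn : ∀ {u v w} → A u v ≡ true → A u w ≡ true → d u w ≡ d u v
    turn {u} = around d u λ uv → trans (sym (cong c (face-step′ uv))) (sym (e uv))
    go : ∀ {u v} → A u v ≡ true → Star (λ a b → A a b ≡ true) u u′ → d u v ≡ d u′ v′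
    go uv ε = turn uv′ uv
    go uv (uw ◅ p) = trans (turn uw uv) (trans (e uw) (go (symm uw) p))

  -- The unknowns are a function `c` on the faces, a function `h` on the vertices and a multiplier
  -- `m`. Each edge asks that the two coboundaries add up to `m` times `z`; two further equations
  -- normalise `c` and `h` at one place each, to remove the constants.
  module System (z : Fin n → Fin n → ℤ) (f₀ : Fin F) (v₀ : Fin n) where

    size : ℕ
    size = F + (n + 1)
    cᵢ : Fin F → Fin size
    cᵢ f = f Fin.↑ˡ (n + 1)
    hᵢ : Fin n → Fin size
    hᵢ v = F Fin.↑ʳ (v Fin.↑ˡ 1)
    mᵢ : Fin size
    mᵢ = F Fin.↑ʳ (n Fin.↑ʳ zero)

    equation : Fin n × Fin n → Vec ℤ size
    equation (u , v) = lin 1ℤ 1ℤ (lin 1ℤ (-ᶻ 1ℤ) (unit (cᵢ (face u v))) (unit (cᵢ (face v u))))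
      (lin 1ℤ (-ᶻ z u v) (lin 1ℤ (-ᶻ 1ℤ) (unit (hᵢ v)) (unit (hᵢ u))) (unit mᵢ))

    system : List (Vec ℤ size)
    system = unit (cᵢ f₀) ∷ unit (hᵢ v₀) ∷ List.map equation (edges A)

    length-system : length system ≡ 2 + numEdges A
    length-system = cong (2 +_) (trans (Listₚ.length-map equation (edges A)) (length-edges A))

    module Solution (z-row : ∀ u → sum (z u) ≡ 0ℤ) (z-col : ∀ v → sum (λ u → z u v) ≡ 0ℤ)
                    (z-off : ∀ {u v} → A u v ≡ false → z u v ≡ 0ℤ) (z-anti : ∀ u v → z v u ≡ -ᶻ z u v)
                    (x : Vec ℤ size) (sols : All (Solves x) system) where
      c : Fin F → ℤ
      c f = lookup x (cᵢ f)
      h : Fin n → ℤ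
      h v = lookup x (hᵢ v)
      m : ℤ
      m = lookup x mᵢ

      private
        sol-edge : ∀ {u v} → Solves x (equation (u , v)) →
          (c (face u v) -ᶻ c (face v u)) +ᶻ (h v -ᶻ h u) ≡ m *ᶻ z u v
        sol-edge {u} {v} s
          rewrite dot-lin 1ℤ 1ℤ (lin 1ℤ (-ᶻ 1ℤ) (unit (cᵢ (face u v))) (unit (cᵢ (face v u))))
                    (lin 1ℤ (-ᶻ z u v) (lin 1ℤ (-ᶻ 1ℤ) (unit (hᵢ v)) (unit (hᵢ u))) (unit mᵢ)) x
                | dot-lin 1ℤ (-ᶻ 1ℤ) (unit (cᵢ (face u v))) (unit (cᵢ (face v u))) x
                | dot-lin 1ℤ (-ᶻ z u v) (lin 1ℤ (-ᶻ 1ℤ) (unit (hᵢ v)) (unit (hᵢ u))) (unit mᵢ) x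
                | dot-lin 1ℤ (-ᶻ 1ℤ) (unit (hᵢ v)) (unit (hᵢ u)) x
                | dot-unit (cᵢ (face u v)) x | dot-unit (cᵢ (face v u)) x
                | dot-unit (hᵢ v) x | dot-unit (hᵢ u) x | dot-unit mᵢ x =
          trans (ring (c (face u v)) (c (face v u)) (h v) (h u) (z u v) m)
                (trans (cong (_+ᶻ m *ᶻ z u v) s) (ℤₚ.+-identityˡ _))
          where
          ring : ∀ a b s t z m → (a -ᶻ b) +ᶻ (s -ᶻ t) ≡
            (1ℤ *ᶻ (1ℤ *ᶻ a +ᶻ (-ᶻ 1ℤ) *ᶻ b) +ᶻ 1ℤ *ᶻ (1ℤ *ᶻ (1ℤ *ᶻ s +ᶻ (-ᶻ 1ℤ) *ᶻ t) +ᶻ (-ᶻ z) *ᶻ m)) +ᶻ m *ᶻ z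
          ring = ℤSolver.solve-∀

        sols′ : All (Solves x ∘ equation) (edges A)
        sols′ = Allₚ.map⁻ (All.tail (All.tail sols))

        eqn : ∀ {u v} → A u v ≡ true → (c (face u v) -ᶻ c (face v u)) +ᶻ (h v -ᶻ h u) ≡ m *ᶻ z u v
        eqn {u} {v} e with ∈-++⁻ (edges A) (darts⊆edges² A simple (∈-darts A e))
        ... | inj₁ p = sol-edge (All.lookup sols′ p)
        ... | inj₂ p with ∈-map⁻ swap p
        ... | _ , q , refl = trans (ring (c (face u v)) (c (face v u)) (h v) (h u))
              (trans (cong -ᶻ_ (sol-edge (All.lookup sols′ q)))
                (trans (ℤₚ.neg-distribʳ-* m (z v u)) (cong (m *ᶻ_) (sym (z-anti v u)))))
          where
          ring : ∀ a b s t → (a -ᶻ b) +ᶻ (s -ᶻ t) ≡ -ᶻ ((b -ᶻ a) +ᶻ (t -ᶻ s))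
          ring = ℤSolver.solve-∀

        h-const : ∀ {u v} → A u v ≡ true → h v ≡ h u
        h-const = gradient-zero z z-row z-col z-off c h m eqn

      potential-eqn : ∀ {u v} → A u v ≡ true → c (face u v) -ᶻ c (face v u) ≡ m *ᶻ z u v
      potential-eqn {u} {v} e = trans (ring (c (face u v)) (c (face v u)) (h v) (h u) (h-const e)) (eqn e)
        where
        ring : ∀ a b s t → s ≡ t → a -ᶻ b ≡ (a -ᶻ b) +ᶻ (s -ᶻ t)
        ring a b s .s refl = ring′ a b s
          where
          ring′ : ∀ a b s → a -ᶻ b ≡ (a -ᶻ b) +ᶻ (s -ᶻ s)
          ring′ = ℤSolver.solve-∀

      -- The coboundary of `h` always vanishes, and for `m = 0` so does that of `c`. Both functions
      -- are then constant, and the normalisations make them zero. Hence a nonzero solution has a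
      -- nonzero multiplier.
      trivial : m ≡ 0ℤ → ∀ i → lookup x i ≡ 0ℤ
      trivial m≡0 i = subst (λ i → lookup x i ≡ 0ℤ) (Finₚ.join-splitAt F (n + 1) i) (by-block (Fin.splitAt F i))
        where
        c≡0 : ∀ f → c f ≡ 0ℤ
        c≡0 f = trans (flat c (λ {u} {v} e → ℤₚ.i-j≡0⇒i≡j _ _ (trans (potential-eqn e)
                          (trans (cong (_*ᶻ z u v) m≡0) (ℤₚ.*-zeroˡ (z u v))))) f f₀)
                      (trans (sym (dot-unit (cᵢ f₀) x)) (All.lookup sols (here refl)))
        h≡0 : ∀ v → h v ≡ 0ℤ
        h≡0 v = trans (star-constant h h-const v₀ v)
                      (trans (sym (dot-unit (hᵢ v₀) x)) (All.lookup sols (here₁ refl)))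
        by-block′ : ∀ (j : Fin n ⊎ Fin 1) → lookup x (F Fin.↑ʳ Fin.join n 1 j) ≡ 0ℤ
        by-block′ (inj₁ v)    = h≡0 v
        by-block′ (inj₂ zero) = m≡0
        by-block : ∀ (i : Fin F ⊎ Fin (n + 1)) → lookup x (Fin.join F (n + 1) i) ≡ 0ℤ
        by-block (inj₁ f) = c≡0 f
        by-block (inj₂ j) = subst (λ j → lookup x (F Fin.↑ʳ j) ≡ 0ℤ) (Finₚ.join-splitAt n 1 j) (by-block′ (Fin.splitAt n j))

  -- There are E + 2 equations for F + n + 1 unknowns, so `bound` leaves a nonzero solution. Its
  -- multiplier is nonzero by `trivial`, and its part `h` drops out by `gradient-zero`.
  potential : numEdges A + 2 ≤ n + F → Fin F → Fin n → (z : Fin n → Fin n → ℤ) →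
    (∀ u → sum (z u) ≡ 0ℤ) → (∀ v → sum (λ u → z u v) ≡ 0ℤ) → (∀ {u v} → A u v ≡ false → z u v ≡ 0ℤ) →
    (∀ u v → z v u ≡ -ᶻ z u v) →
    ∃₂ λ (c : Fin F → ℤ) m → m ≢ 0ℤ × (∀ {u v} → A u v ≡ true → c (face u v) -ᶻ c (face v u) ≡ m *ᶻ z u v)
  potential bound f₀ v₀ z z-row z-col z-off z-anti with underdetermined system fewer
    where
    open System z f₀ v₀
    arith : ∀ E F n → E + 2 ≤ n + F → 2 + E < F + (n + 1)
    arith E F n p = subst₂ _≤_ (cong suc (ℕₚ.+-comm E 2)) (solve-eq F n) (s≤s p)
      where
      solve-eq : ∀ F n → suc (n + F) ≡ F + (n + 1)
      solve-eq = solve-∀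
    fewer : length system < size
    fewer = subst (_< size) (sym length-system) (arith (numEdges A) F n bound)
  ... | x , (i , xᵢ≢0) , sols = c , m , (λ m≡0 → xᵢ≢0 (trivial m≡0 i)) , potential-eqn
    where
    open System z f₀ v₀
    open Solution z-row z-col z-off z-anti x sols

  -- Nonnegativity of the genus. For `z = 0` the equation `m = 0` can be imposed in addition; if the
  -- inequality failed, there would still be fewer equations than unknowns, against `trivial`.
  euler-inequality : Fin F → Fin n → n + F ≤ numEdges A + 2
  euler-inequality f₀ v₀ = ℕₚ.≮⇒≥ λ bound →
    let x , (i , xᵢ≢0) , sols = underdetermined (unit mᵢ ∷ system) (fewer bound)
        open Solution (λ u → sum-zero {n} _ λ _ → refl) (λ v → sum-zero {n} _ λ _ → refl) (λ _ → refl) (λ _ _ → refl) x (All.tail sols)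
    in xᵢ≢0 (trivial (trans (sym (dot-unit mᵢ x)) (All.head sols)) i)
    where
    open System (λ _ _ → 0ℤ) f₀ v₀
    arith : ∀ E F n → E + 2 < n + F → 3 + E < F + (n + 1)
    arith E F n p = subst₂ _≤_ (cong (2 +_) (ℕₚ.+-comm E 2)) (solve-eq F n) (s≤s p)
      where
      solve-eq : ∀ F n → suc (n + F) ≡ F + (n + 1)
      solve-eq = solve-∀
    fewer : numEdges A + 2 < n + F → length (unit mᵢ ∷ system) < size
    fewer bound = subst (_< size) (cong suc (sym length-system)) (arith (numEdges A) F n bound)

-- Jordan curves

Off : ∀ {n} (a b c v : Fin n) → Set
Off a b c v = v ≢ a × v ≢ b × v ≢ c

-- The two sides of the curve abc, recorded as a colouring of the darts, that is, of the faces to their left.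
record Jordan {n} (A : Adj n) (N : Fin n → Fin n → Fin n) (a b c : Fin n) : Set where
  field
    s      : Fin n → Fin n → Bool
    s-face : ∀ {u v} → A u v ≡ true → s u v ≡ s v (N v u)
    s-off  : ∀ {u v} → A u v ≡ true → Off a b c v → s u v ≡ s v u
    s-ab   : s a b ≡ true
    s-bc   : s b c ≡ true
    s-ca   : s c a ≡ true
    s-ba   : s b a ≡ false
    s-cb   : s c b ≡ false
    s-ac   : s a c ≡ false

opaque
  single : ∀ {n} → Fin n → Fin n → ℤ
  single i u = if does (u Fin.≟ i) then 1ℤ else 0ℤ

  single-refl : ∀ {n} (i : Fin n) → single i i ≡ 1ℤ
  single-refl i rewrite dec-true (i Fin.≟ i) refl = refl

  single-≢ : ∀ {n} {i u : Fin n} → u ≢ i → single i u ≡ 0ℤ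
  single-≢ {i = i} {u} ne rewrite dec-false (u Fin.≟ i) ne = refl

  sum-single : ∀ {n} (i : Fin n) → sum (single i) ≡ 1ℤ
  sum-single {suc n} zero    = cong (1ℤ +ᶻ_) (sum-zero {n} _ λ _ → refl)
  sum-single {suc n} (suc i) = trans (ℤₚ.+-identityˡ _) (trans (sum-cong-≗ {n} {x = single (suc i) ∘ suc} {y = single i} (λ _ → refl)) (sum-single i))

sum-minus : ∀ {n} (f g : Fin n → ℤ) → sum f ≡ sum g → sum (λ i → f i +ᶻ (-ᶻ 1ℤ) *ᶻ g i) ≡ 0ℤ
sum-minus f g eq = begin
  sum (λ i → f i +ᶻ (-ᶻ 1ℤ) *ᶻ g i)        ≡⟨ ∑-distrib-+ f (λ i → (-ᶻ 1ℤ) *ᶻ g i) ⟩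
  sum f +ᶻ sum (λ i → (-ᶻ 1ℤ) *ᶻ g i)      ≡⟨ cong₂ _+ᶻ_ eq (sym (*-distribˡ-sum (-ᶻ 1ℤ) g)) ⟩
  sum g +ᶻ (-ᶻ 1ℤ) *ᶻ sum g                ≡⟨ ring (sum g) ⟩
  0ℤ ∎
  where
  open ≡-Reasoning
  ring : ∀ x → x +ᶻ (-ᶻ 1ℤ) *ᶻ x ≡ 0ℤ
  ring = ℤSolver.solve-∀

module ThreeCycle {n} (a b c : Fin n) where

  -- For distinct vertices `p` is the indicator of the darts a → b, b → c, c → a, and `z` is the
  -- unit flow around the cycle. Each vertex is entered as often as it is left, which is why rows
  -- and columns of `z` sum to zero.
  p z : Fin n → Fin n → ℤ
  p u v = (single a u *ᶻ single b v +ᶻ single b u *ᶻ single c v) +ᶻ single c u *ᶻ single a v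
  z u v = p u v +ᶻ (-ᶻ 1ℤ) *ᶻ p v u

  z-anti : ∀ u v → z v u ≡ -ᶻ z u v
  z-anti u v = ring (p u v) (p v u)
    where
    ring : ∀ x y → y +ᶻ (-ᶻ 1ℤ) *ᶻ x ≡ -ᶻ (x +ᶻ (-ᶻ 1ℤ) *ᶻ y)
    ring = ℤSolver.solve-∀

  private
    through : ∀ x (y : Fin n) → sum (λ v → x *ᶻ single y v) ≡ x
    through x y = trans (sym (*-distribˡ-sum x (single y))) (trans (cong (x *ᶻ_) (sum-single y)) (ℤₚ.*-identityʳ x))

    p-row : ∀ u → sum (p u) ≡ (single a u +ᶻ single b u) +ᶻ single c u
    p-row u = trans (∑-distrib-+ (λ v → single a u *ᶻ single b v +ᶻ single b u *ᶻ single c v) (λ v → single c u *ᶻ single a v))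
      (cong₂ _+ᶻ_ (trans (∑-distrib-+ (λ v → single a u *ᶻ single b v) (λ v → single b u *ᶻ single c v))
        (cong₂ _+ᶻ_ (through (single a u) b) (through (single b u) c))) (through (single c u) a))

    pᵗ : Fin n → Fin n → ℤ
    pᵗ v u = (single b v *ᶻ single a u +ᶻ single c v *ᶻ single b u) +ᶻ single a v *ᶻ single c u

    p-col : ∀ v → sum (λ u → p u v) ≡ (single a v +ᶻ single b v) +ᶻ single c v
    p-col v = trans (sum-cong-≗ {x = λ u → p u v} {y = pᵗ v} λ u → ring (single a u) (single b u) (single c u) (single a v) (single b v) (single c v))
      (trans (∑-distrib-+ (λ u → single b v *ᶻ single a u +ᶻ single c v *ᶻ single b u) (λ u → single a v *ᶻ single c u))
      (trans (cong₂ _+ᶻ_ (trans (∑-distrib-+ (λ u → single b v *ᶻ single a u) (λ u → single c v *ᶻ single b u))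
        (cong₂ _+ᶻ_ (through (single b v) a) (through (single c v) b))) (through (single a v) c))
        (rot (single a v) (single b v) (single c v))))
      where
      ring : ∀ au bu cu av bv cv → (au *ᶻ bv +ᶻ bu *ᶻ cv) +ᶻ cu *ᶻ av ≡ (bv *ᶻ au +ᶻ cv *ᶻ bu) +ᶻ av *ᶻ cu
      ring = ℤSolver.solve-∀
      rot : ∀ a b c → (b +ᶻ c) +ᶻ a ≡ (a +ᶻ b) +ᶻ c
      rot = ℤSolver.solve-∀

  z-row : ∀ u → sum (z u) ≡ 0ℤ
  z-row u = sum-minus (p u) (λ v → p v u) (trans (p-row u) (sym (p-col u)))

  z-col : ∀ v → sum (λ u → z u v) ≡ 0ℤ
  z-col v = sum-minus (λ u → p u v) (p v) (trans (p-col v) (sym (p-row v)))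

  single²-zero : ∀ (i j u v : Fin n) → (u ≡ i → v ≢ j) → single i u *ᶻ single j v ≡ 0ℤ
  single²-zero i j u v ne with u Fin.≟ i
  ... | no u≢i = trans (cong (_*ᶻ single j v) (single-≢ u≢i)) (ℤₚ.*-zeroˡ (single j v))
  ... | yes eq = trans (cong (single i u *ᶻ_) (single-≢ (ne eq))) (ℤₚ.*-zeroʳ (single i u))

  p-zero : ∀ {u v} → (u ≡ a → v ≢ b) → (u ≡ b → v ≢ c) → (u ≡ c → v ≢ a) → p u v ≡ 0ℤ
  p-zero {u} {v} ab bc ca = cong₂ _+ᶻ_ (cong₂ _+ᶻ_ (single²-zero a b u v ab) (single²-zero b c u v bc)) (single²-zero c a u v ca)

module _ {n} {A : Adj n} {F} (𝓜 : Map A F) where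
  open Map 𝓜
  open Homology 𝓜

  -- Walking around a from c to b crosses no edge of the 3-cycle, except possibly ac itself again.
  same-side : ∀ {a b c} (pot : Fin n → Fin n → ℤ) → b ≢ c → A a b ≡ true → A c a ≡ true →
    (∀ {w} → A a w ≡ true → pot w a ≡ pot a (N a w)) →
    (∀ {w} → A a w ≡ true → w ≢ b → w ≢ c → pot w a ≡ pot a w) → pot c a ≡ pot a b
  same-side {a} {b} {c} pot b≢c ab ca turn off with cyclic a (symm ca) ab
  ... | k , reach = go k c (symm ca) (inj₂ refl) reach
    where
    shift : ∀ k w → iter (suc k) (N a) w ≡ iter k (N a) (N a w)
    shift zero w = refl
    shift (suc k) w = cong (N a) (shift k w)
    go : ∀ k w → A a w ≡ true → pot a w ≡ pot c a ⊎ w ≡ c → iter k (N a) w ≡ b → pot c a ≡ pot a b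
    go zero w e (inj₁ eq) refl = sym eq
    go zero w e (inj₂ w≡c) w≡b = contradiction (trans (sym w≡b) w≡c) b≢c
    go (suc k) w e inv r with w Fin.≟ c | w Fin.≟ b | inv
    ... | yes refl | _ | _ = go k (N a w) (N-edge e) (inj₁ (sym (turn e))) (trans (sym (shift k w)) r)
    ... | no _ | yes refl | inj₁ eq = sym eq
    ... | no w≢c | no w≢b | inj₁ eq =
      go k (N a w) (N-edge e) (inj₁ (trans (sym (turn e)) (trans (off e w≢b w≢c) eq))) (trans (sym (shift k w)) r)
    ... | no w≢c | _ | inj₂ w≡c = contradiction w≡c w≢c

  module _ (bound : numEdges A + 2 ≤ n + F) {a b c : Fin n} (ab : A a b ≡ true) (bc : A b c ≡ true) (ca : A c a ≡ true) where
    private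
      a≢b = edge⇒≢ ab
      b≢c = edge⇒≢ bc
      c≢a = edge⇒≢ ca

    record CyclePotential : Set where
      field
        pot      : Fin n → Fin n → ℤ
        m        : ℤ
        m≢0      : m ≢ 0ℤ
        pot-face : ∀ {u v} → A u v ≡ true → pot u v ≡ pot v (N v u)
        pot-off  : ∀ {u v} → A u v ≡ true → Off a b c v → pot u v ≡ pot v u
        pot-ab   : pot a b -ᶻ pot b a ≡ m
        pot-bc   : pot b c -ᶻ pot c b ≡ m
        pot-ca   : pot c a -ᶻ pot a c ≡ m

    cyclePotential : CyclePotential
    cyclePotential = fromPotential (potential bound (face a b) a z z-row z-col (λ {u} {v} → z-off {u} {v}) z-anti)
      where
      open ThreeCycle a b c
      p-off : ∀ {u v} → A u v ≡ false → p u v ≡ 0ℤ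
      p-off {u} {v} e = p-zero {u} {v} (λ { refl refl → false≢true ab e }) (λ { refl refl → false≢true bc e }) (λ { refl refl → false≢true ca e })
      minus : ∀ {u v x y} → p u v ≡ x → p v u ≡ y → z u v ≡ x +ᶻ (-ᶻ 1ℤ) *ᶻ y
      minus = cong₂ (λ x y → x +ᶻ (-ᶻ 1ℤ) *ᶻ y)
      z-off : ∀ {u v} → A u v ≡ false → z u v ≡ 0ℤ
      z-off {u} {v} e = minus {u} {v} (p-off {u} {v} e) (p-off {v} {u} (trans (proj₁ simple v u) e))
      product-one : ∀ (i j : Fin n) → single i i *ᶻ single j j ≡ 1ℤ
      product-one i j = cong₂ _*ᶻ_ (single-refl i) (single-refl j)
      z-ab : z a b ≡ 1ℤ
      z-ab = minus {a} {b} (cong₂ _+ᶻ_ (cong₂ _+ᶻ_ (product-one a b)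
                 (single²-zero b c a b (λ a≡b → contradiction a≡b a≢b))) (single²-zero c a a b (λ a≡c → contradiction (sym a≡c) c≢a)))
               (p-zero {b} {a} (λ b≡a → contradiction (sym b≡a) a≢b) (λ _ → ≢-sym c≢a) (λ b≡c → contradiction b≡c b≢c))
      z-bc : z b c ≡ 1ℤ
      z-bc = minus {b} {c} (cong₂ _+ᶻ_ (cong₂ _+ᶻ_ (single²-zero a b b c (λ b≡a → contradiction (sym b≡a) a≢b))
                 (product-one b c)) (single²-zero c a b c (λ b≡c → contradiction b≡c b≢c)))
               (p-zero {c} {b} (λ c≡a → contradiction c≡a c≢a) (λ c≡b → contradiction (sym c≡b) b≢c) (λ _ → ≢-sym a≢b))
      z-ca : z c a ≡ 1ℤ
      z-ca = minus {c} {a} (cong₂ _+ᶻ_ (cong₂ _+ᶻ_ (single²-zero a b c a (λ c≡a → contradiction c≡a c≢a)) (single²-zero b c c a (λ c≡b → contradiction (sym c≡b) b≢c)))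
                 (product-one c a))
               (p-zero {a} {c} (λ _ → ≢-sym b≢c) (λ a≡b → contradiction a≡b a≢b) (λ a≡c → contradiction (sym a≡c) c≢a))
      z-Off : ∀ {u v} → Off a b c v → z u v ≡ 0ℤ
      z-Off {u} {v} (v≢a , v≢b , v≢c) = minus {u} {v} (p-zero {u} {v} (λ _ → v≢b) (λ _ → v≢c) (λ _ → v≢a))
        (p-zero {v} {u} (λ v≡a _ → v≢a v≡a) (λ v≡b _ → v≢b v≡b) (λ v≡c _ → v≢c v≡c))
      fromPotential : (∃₂ λ (pc : Fin F → ℤ) m → m ≢ 0ℤ × (∀ {u v} → A u v ≡ true → pc (face u v) -ᶻ pc (face v u) ≡ m *ᶻ z u v)) → CyclePotential
      fromPotential (pc , m , m≢0 , eqn) = record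
        { pot = λ u v → pc (face u v)
        ; m = m
        ; m≢0 = m≢0
        ; pot-face = λ e → cong pc (face-step e)
        ; pot-off = λ {u} {v} e off → ℤₚ.i-j≡0⇒i≡j _ _ (trans (eqn e) (trans (cong (m *ᶻ_) (z-Off {u} {v} off)) (ℤₚ.*-zeroʳ m)))
        ; pot-ab = trans (eqn ab) (trans (cong (m *ᶻ_) z-ab) (ℤₚ.*-identityʳ m))
        ; pot-bc = trans (eqn bc) (trans (cong (m *ᶻ_) z-bc) (ℤₚ.*-identityʳ m))
        ; pot-ca = trans (eqn ca) (trans (cong (m *ᶻ_) z-ca) (ℤₚ.*-identityʳ m))
        }

    -- The colour tests whether the potential equals its value to the left of a → b. Turning around
    -- `a` and around `b` shows that the faces to the left of all three edges share this value, and
    -- crossing an edge of the cycle changes it by `m`, which is nonzero.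
    jordan : Jordan A N a b c
    jordan = record
      { s = λ u v → side (pot u v)
      ; s-face = λ e → cong side (pot-face e)
      ; s-off = λ e off → cong side (pot-off e off)
      ; s-ab = dec-true (pot a b ℤ.≟ pot a b) refl
      ; s-bc = dec-true (pot b c ℤ.≟ pot a b) (sym ab≡bc)
      ; s-ca = dec-true (pot c a ℤ.≟ pot a b) ca≡ab
      ; s-ba = dec-false (pot b a ℤ.≟ pot a b) (jump (pot a b) (pot b a) pot-ab refl)
      ; s-cb = dec-false (pot c b ℤ.≟ pot a b) (jump (pot b c) (pot c b) pot-bc (sym ab≡bc))
      ; s-ac = dec-false (pot a c ℤ.≟ pot a b) (jump (pot c a) (pot a c) pot-ca ca≡ab)
      }
      where
      open CyclePotential cyclePotential
      side : ℤ → Bool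
      side x = does (x ℤ.≟ pot a b)
      ca≡ab : pot c a ≡ pot a b
      ca≡ab = same-side pot b≢c ab ca (λ e → pot-face (symm e))
        (λ e w≢b w≢c → sym (pot-off e (≢-sym (edge⇒≢ e) , w≢b , w≢c)))
      ab≡bc : pot a b ≡ pot b c
      ab≡bc = same-side pot c≢a bc ab (λ e → pot-face (symm e))
        (λ e w≢c w≢a → sym (pot-off e (w≢a , ≢-sym (edge⇒≢ e) , w≢c)))
      jump : ∀ x y → x -ᶻ y ≡ m → x ≡ pot a b → y ≢ pot a b
      jump x y d refl refl = m≢0 (trans (sym d) (ℤₚ.i≡j⇒i-j≡0 {x} refl))

-- Maps and sphere graphs

dart-≡ : ∀ {n} {A : Adj n} {d d′ : Dart A} → proj₁ d ≡ proj₁ d′ → d ≡ d′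
dart-≡ {d = p , e} {.p , e′} refl = cong (p ,_) (uip e e′)

closed-covers : ∀ {n} {A : Adj n} → Connected A → (xs : List (Fin n)) → ∀ {u} → u ∈ xs →
  (∀ {v w} → v ∈ xs → A v w ≡ true → w ∈ xs) → ∀ v → v ∈ xs
closed-covers {A = A} conn xs {u} u∈ closed v = go (conn u v) u∈
  where
  go : ∀ {u v} → Star (λ a b → A a b ≡ true) u v → u ∈ xs → v ∈ xs
  go ε p = p
  go (e ◅ es) p = go es (closed p e)

neighbour : ∀ {n} {A : Adj n} → Connected A → 2 ≤ n → ∀ u → ∃ λ v → A u v ≡ true
neighbour {suc (suc n)} {A} conn _ u = first (other≢ u) (conn u (other u))
  where
  other : Fin (suc (suc n)) → Fin (suc (suc n))
  other zero    = suc zero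
  other (suc _) = zero
  other≢ : ∀ u → u ≢ other u
  other≢ zero    ()
  other≢ (suc _) ()
  first : ∀ {u v} → u ≢ v → Star (λ a b → A a b ≡ true) u v → ∃ λ w → A u w ≡ true
  first u≢v ε = contradiction refl u≢v
  first u≢v (e ◅ _) = _ , e
neighbour {suc zero} _ (s≤s ())

module _ {n} {A : Adj n} {F} (𝓜 : Map A F) where
  open Map 𝓜

  M-edge : ∀ {u v} → A u v ≡ true → A u (M u v) ≡ true
  M-edge {u} {v} e with A u (M u v) in e′
  ... | true  = refl
  ... | false = false≢true e (trans (cong (A u) (trans (sym (NM u v)) (N-fix e′))) e′)

  next-dart : Fin n × Fin n → Fin n × Fin n
  next-dart (u , v) = v , N v u

  next-dart-edge : ∀ p → IsDart A p → IsDart A (next-dart p)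
  next-dart-edge (u , v) e = N-edge (symm e)

  iter-next-edge : ∀ k {p} → IsDart A p → IsDart A (iter k next-dart p)
  iter-next-edge zero e = e
  iter-next-edge (suc k) {p} e = next-dart-edge (iter k next-dart p) (iter-next-edge k e)

  iter-next-face : ∀ k {p} → IsDart A p → uncurry face p ≡ uncurry face (iter k next-dart p)
  iter-next-face zero e = refl
  iter-next-face (suc k) {p} e = trans (iter-next-face k e) (face-step (iter-next-edge k {p} e))

  toSphere : n + F ≡ numEdges A + 2 → SphereGraph A
  toSphere count = simple , connected , rotation , F , (faceOf , surjective , orbits) , count
    where
    turn : Dart A → Dart A
    turn ((u , v) , e) = (u , N u v) , N-edge e
    iter-turn : ∀ k (d : Dart A) → proj₁ (iter k turn d) ≡ (proj₁ (proj₁ d) , iter k (N (proj₁ (proj₁ d))) (proj₂ (proj₁ d)))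
    iter-turn zero d = refl
    iter-turn (suc k) d rewrite iter-turn k d = refl
    rotation : Rotation A
    rotation = record
      { σ = turn
      ; σ⁻¹ = λ { ((u , v) , e) → (u , M u v) , M-edge e }
      ; σσ⁻¹ = λ { ((u , v) , e) → dart-≡ (cong (u ,_) (NM u v)) }
      ; σ⁻¹σ = λ { ((u , v) , e) → dart-≡ (cong (u ,_) (MN u v)) }
      ; σ-tail = λ _ → refl
      ; σ-cyc = λ { d@((u , v) , e) ((.u , v′) , e′) refl →
          let k , r = cyclic u e e′ in k , dart-≡ (trans (iter-turn k d) (cong (u ,_) r)) }
      }
    faceOf : Dart A → Fin F
    faceOf d = uncurry face (proj₁ d)
    surjective : ∀ f → ∃ λ d → faceOf d ≡ f
    surjective f = let u , v , e , r = face-sur f in ((u , v) , e) , r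
    φ : Dart A → Dart A
    φ = λ d → turn (rev (proj₁ simple) d)
    iter-φ : ∀ k d → proj₁ (iter k φ d) ≡ iter k next-dart (proj₁ d)
    iter-φ zero d = refl
    iter-φ (suc k) d = cong next-dart (iter-φ k d)
    orbits : ∀ d d′ → (faceOf d ≡ faceOf d′) ⇔ (∃ λ k → iter k φ d ≡ d′)
    orbits d@(p , e) d′@(p′ , e′) = mk⇔
      (λ eq → let k , r = face-orbit e e′ eq in k , dart-≡ (trans (iter-φ k d) r))
      (λ { (k , r) → trans (iter-next-face k {p} e) (cong (uncurry face) (trans (sym (iter-φ k d)) (cong proj₁ r))) })

module FromSphere {n} {A : Adj n} (simple : IsSimple A) (conn : Connected A) (R : Rotation A) {F}
                  (faces : HasFaces (proj₁ simple) R (suc F)) where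
  open Rotation R

  head′ : (f : Dart A → Dart A) → ∀ u v → Dec (A u v ≡ true) → Fin n
  head′ f u v (yes e) = proj₂ (proj₁ (f ((u , v) , e)))
  head′ f u v (no _)  = v

  module Turn (f : Dart A → Dart A) (f-tail : ∀ d → tail {A = A} (f d) ≡ tail {A = A} d) where
    T : Fin n → Fin n → Fin n
    T u v = head′ f u v (A u v Boolₚ.≟ true)

    T-form : ∀ {u v} (e : A u v ≡ true) → proj₁ (f ((u , v) , e)) ≡ (u , T u v)
    T-form {u} {v} e with A u v Boolₚ.≟ true
    ... | yes e′ rewrite uip e e′ = cong (_, proj₂ (proj₁ (f ((u , v) , e′)))) (f-tail ((u , v) , e′))
    ... | no ¬e  = contradiction e ¬e

    T-edge : ∀ {u v} → A u v ≡ true → A u (T u v) ≡ true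
    T-edge {u} {v} e = subst (IsDart A) (T-form e) (proj₂ (f ((u , v) , e)))

    T-fix : ∀ {u v} → A u v ≡ false → T u v ≡ v
    T-fix {u} {v} e with A u v Boolₚ.≟ true
    ... | yes e′ = false≢true e′ e
    ... | no _   = refl

    T-dart : ∀ {u v} (e : A u v ≡ true) → f ((u , v) , e) ≡ ((u , T u v) , T-edge e)
    T-dart e = dart-≡ (T-form e)

  open Turn σ σ-tail renaming (T to N; T-form to N-form; T-edge to N-edge; T-fix to N-fix; T-dart to N-dart)
  σ⁻¹-tail : ∀ d → tail {A = A} (σ⁻¹ d) ≡ tail {A = A} d
  σ⁻¹-tail d = trans (sym (σ-tail (σ⁻¹ d))) (cong (tail {A = A}) (σσ⁻¹ d))
  open Turn σ⁻¹ σ⁻¹-tail renaming (T to M; T-form to M-form; T-edge to M-edge′; T-fix to M-fix; T-dart to M-dart)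

  inverse : ∀ u v → N u (M u v) ≡ v × M u (N u v) ≡ v
  inverse u v = by (A u v Boolₚ.≟ true)
    where
    by : Dec (A u v ≡ true) → N u (M u v) ≡ v × M u (N u v) ≡ v
    by (no ¬e) = let e = Boolₚ.¬-not ¬e in trans (cong (N u) (M-fix e)) (N-fix e) , trans (cong (M u) (N-fix e)) (M-fix e)
    by (yes e) = cong (proj₂ ∘ proj₁) (trans (sym (N-dart (M-edge′ e))) (trans (cong σ (sym (M-dart e))) (σσ⁻¹ _)))
               , cong (proj₂ ∘ proj₁) (trans (sym (M-dart (N-edge e))) (trans (cong σ⁻¹ (sym (N-dart e))) (σ⁻¹σ _)))

  iter-σ : ∀ k {u v} (e : A u v ≡ true) → proj₁ (iter k σ ((u , v) , e)) ≡ (u , iter k (N u) v)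
  iter-σ zero e = refl
  iter-σ (suc k) {u} {v} e = trans (cong (proj₁ ∘ σ) (dart-≡ {d = iter k σ ((u , v) , e)} {d′ = (u , iter k (N u) v) , e′} (iter-σ k e))) (N-form e′)
    where e′ = subst (IsDart A) (iter-σ k e) (proj₂ (iter k σ ((u , v) , e)))

  symm : ∀ {u v} → A u v ≡ true → A v u ≡ true
  symm {u} {v} e = trans (proj₁ simple v u) e

  φ : Dart A → Dart A
  φ d = σ (rev (proj₁ simple) d)
  φ′ : Fin n × Fin n → Fin n × Fin n
  φ′ (u , v) = v , N v u

  φ-form : ∀ d → proj₁ (φ d) ≡ φ′ (proj₁ d)
  φ-form ((u , v) , e) = N-form (trans (proj₁ simple v u) e)

  iter-φ′ : ∀ k d → proj₁ (iter k φ d) ≡ iter k φ′ (proj₁ d)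
  iter-φ′ zero d = refl
  iter-φ′ (suc k) d = trans (φ-form (iter k φ d)) (cong φ′ (iter-φ′ k d))

  -- Pairs that are no darts need some face as a dummy value, hence the form `suc F` of the number
  -- of faces.
  label : ∀ u v → Dec (A u v ≡ true) → Fin (suc F)
  label u v (yes e) = proj₁ faces ((u , v) , e)
  label u v (no _)  = zero

  label-dart : ∀ {u v} (e : A u v ≡ true) → label u v (A u v Boolₚ.≟ true) ≡ proj₁ faces ((u , v) , e)
  label-dart {u} {v} e with A u v Boolₚ.≟ true
  ... | yes e′ = cong (proj₁ faces) (dart-≡ refl)
  ... | no ¬e  = contradiction e ¬e

  toMap : Map A (suc F)
  toMap = record
    { simple = simple ; connected = conn ; N = N ; M = M ; N-edge = N-edge ; N-fix = N-fix
    ; NM = λ u v → proj₁ (inverse u v)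
    ; MN = λ u v → proj₂ (inverse u v)
    ; cyclic = λ u {v} {w} e e′ → let k , r = σ-cyc ((u , v) , e) ((u , w) , e′) refl in
        k , ,-injectiveʳ (trans (sym (iter-σ k e)) (cong proj₁ r))
    ; face = λ u v → label u v (A u v Boolₚ.≟ true)
    ; face-step = λ {u} {v} e → trans (label-dart e) (trans
        (Equivalence.from (proj₂ (proj₂ faces) ((u , v) , e) ((v , N v u) , N-edge (symm e))) (1 , dart-≡ (φ-form ((u , v) , e))))
        (sym (label-dart (N-edge (symm e)))))
    ; face-sur = λ f → let ((u , v) , e) , r = proj₁ (proj₂ faces) f in u , v , e , trans (label-dart e) r
    ; face-orbit = λ {u} {v} {u′} {v′} e e′ eq →
        let k , r = Equivalence.to (proj₂ (proj₂ faces) ((u , v) , e) ((u′ , v′) , e′)) (trans (sym (label-dart e)) (trans eq (label-dart e′)))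
        in k , trans (sym (iter-φ′ k ((u , v) , e))) (cong proj₁ r)
    }

fromSphere : ∀ {n} {A : Adj n} → 2 ≤ n → SphereGraph A → ∃ λ F → Map A (suc F) × n + suc F ≡ numEdges A + 2
fromSphere {suc n} 2≤n (simple , conn , R , zero , (face , _) , count) with neighbour conn 2≤n zero
... | v , e = ⊥-elim (Finₚ.¬Fin0 (face ((zero , v) , e)))
fromSphere 2≤n (simple , conn , R , suc F , faces , count) = F , FromSphere.toMap simple conn R faces , count

length-product : ∀ {X Y : Set} (xs : List X) (ys : List Y) → length (cartesianProduct xs ys) ≡ length xs * length ys
length-product [] ys = refl
length-product (x ∷ xs) ys = trans (Listₚ.length-++ (List.map (x ,_) ys))
  (cong₂ _+_ (Listₚ.length-map (x ,_) ys) (length-product xs ys))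

module _ {n} {A : Adj n} {F} (3≤n : 3 ≤ n) (𝓜 : Map A F) where
  open Map 𝓜

  leaf-unique : ∀ {u v w} → A u v ≡ true → N u v ≡ v → A u w ≡ true → w ≡ v
  leaf-unique {u} {v} e fix e′ with cyclic u e e′
  ... | k , refl = go k
    where
    go : ∀ k → iter k (N u) v ≡ v
    go zero = refl
    go (suc k) = trans (cong (N u) (go k)) fix

  -- Both vertices would be leaves, and the two of them would exhaust the connected graph, against
  -- `3≤n`.
  no-digon : ∀ {u v} → A u v ≡ true → N v u ≡ u → N u v ≡ v → ⊥
  no-digon {u} {v} e fix-v fix-u = ℕₚ.1+n≰n (ℕₚ.≤-trans 3≤n (covering⇒n≤length (u ∷ v ∷ [])
    (closed-covers connected (u ∷ v ∷ []) (here refl) λ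
      { (here refl) e′ → here₁ (leaf-unique e fix-u e′)
      ; (here₁ refl) e′ → here (leaf-unique (symm e) fix-v e′) })))

  φ-≢ : ∀ {u v} → A u v ≡ true → (u , v) ≢ next-dart 𝓜 (u , v)
  φ-≢ e eq = edge⇒≢ e (,-injectiveˡ eq)

  φ²-≢ : ∀ {u v} → A u v ≡ true → (u , v) ≢ next-dart 𝓜 (next-dart 𝓜 (u , v))
  φ²-≢ {u} {v} e eq = no-digon e (sym (,-injectiveˡ eq))
    (trans (cong (λ t → N t v) (,-injectiveˡ eq)) (sym (,-injectiveʳ eq)))

  -- Three consecutive darts of a face walk are distinct: `φ-≢` excludes walks of length one and
  -- `φ²-≢` those of length two. Darts of different faces differ by their labels.
  3F≤2E : F * 3 ≤ 2 * numEdges A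
  3F≤2E = subst₂ _≤_ len (length-darts A simple)
    (unique-⊆⇒length≤ {ys = darts A} (Uniqueₚ.map⁺ (λ {x} {y} → injective x y)
      (Uniqueₚ.cartesianProduct⁺ (Uniqueₚ.allFin⁺ F) (Uniqueₚ.allFin⁺ 3)))
      (λ p → case ∈-map⁻ triple p of λ { (fi , _ , refl) → ∈-darts A (triple-edge fi) }))
    where
    dart : Fin F → Fin n × Fin n
    dart f = let u , v , _ = face-sur f in u , v
    dart-edge : ∀ f → IsDart A (dart f)
    dart-edge f = let _ , _ , e , _ = face-sur f in e
    dart-face : ∀ f → uncurry face (dart f) ≡ f
    dart-face f = let _ , _ , _ , r = face-sur f in r
    triple : Fin F × Fin 3 → Fin n × Fin n
    triple (f , i) = iter (toℕ i) (next-dart 𝓜) (dart f)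
    triple-edge : ∀ fi → IsDart A (triple fi)
    triple-edge (f , i) = iter-next-edge 𝓜 (toℕ i) (dart-edge f)
    triple-face : ∀ fi → uncurry face (triple fi) ≡ proj₁ fi
    triple-face (f , i) = trans (sym (iter-next-face 𝓜 (toℕ i) (dart-edge f))) (dart-face f)
    len : length (List.map triple (cartesianProduct (allFin F) (allFin 3))) ≡ F * 3
    len = trans (Listₚ.length-map triple (cartesianProduct (allFin F) (allFin 3))) (trans (length-product (allFin F) (allFin 3)) (cong (_* 3) (length-allFin F)))
    index : ∀ f i j → triple (f , i) ≡ triple (f , j) → i ≡ j
    index f zero zero _ = refl
    index f zero (suc zero) eq = ⊥-elim (φ-≢ (dart-edge f) eq)
    index f zero (suc (suc zero)) eq = ⊥-elim (φ²-≢ (dart-edge f) eq)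
    index f (suc zero) zero eq = ⊥-elim (φ-≢ (dart-edge f) (sym eq))
    index f (suc zero) (suc zero) _ = refl
    index f (suc zero) (suc (suc zero)) eq = ⊥-elim (φ-≢ (triple-edge (f , suc zero)) eq)
    index f (suc (suc zero)) zero eq = ⊥-elim (φ²-≢ (dart-edge f) (sym eq))
    index f (suc (suc zero)) (suc zero) eq = ⊥-elim (φ-≢ (triple-edge (f , suc zero)) (sym eq))
    index f (suc (suc zero)) (suc (suc zero)) _ = refl
    injective : ∀ x y → triple x ≡ triple y → x ≡ y
    injective (f , i) (g , j) eq with trans (sym (triple-face (f , i))) (trans (cong (uncurry face) eq) (triple-face (g , j)))
    ... | refl = cong (f ,_) (index f i j eq)

  edge-bound : n + F ≡ numEdges A + 2 → numEdges A + 6 ≤ 3 * n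
  edge-bound count = ℕₚ.+-cancelʳ-≤ (2 * E) (E + 6) (3 * n) (begin
    E + 6 + 2 * E    ≡⟨ arith₁ E ⟩
    3 * (E + 2)      ≡⟨ cong (3 *_) (sym count) ⟩
    3 * (n + F)      ≡⟨ arith₂ n F ⟩
    3 * n + F * 3    ≤⟨ ℕₚ.+-monoʳ-≤ (3 * n) 3F≤2E ⟩
    3 * n + 2 * E ∎)
    where
    open ℕₚ.≤-Reasoning
    E = numEdges A
    arith₁ : ∀ E → E + 6 + 2 * E ≡ 3 * (E + 2)
    arith₁ = solve-∀
    arith₂ : ∀ n F → 3 * (n + F) ≡ 3 * n + F * 3
    arith₂ = solve-∀

sphere-edge-bound : ∀ {n} {A : Adj n} → 3 ≤ n → SphereGraph A → numEdges A + 6 ≤ 3 * n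
sphere-edge-bound 3≤n S with fromSphere (ℕₚ.≤-trans (s≤s (s≤s z≤n)) 3≤n) S
... | F , 𝓜 , count = edge-bound 3≤n 𝓜 count

-- Maximal sphere graphs have triangular faces

Reach : ∀ {X : Set} → (X → X) → X → X → Set
Reach f x y = ∃ λ k → iter k f x ≡ y

module _ {X : Set} {f : X → X} where
  iter-+ : ∀ k l x → iter (k + l) f x ≡ iter k f (iter l f x)
  iter-+ zero l x = refl
  iter-+ (suc k) l x = cong f (iter-+ k l x)

  iter-shift : ∀ k x → iter (suc k) f x ≡ iter k f (f x)
  iter-shift zero x = refl
  iter-shift (suc k) x = cong f (iter-shift k x)

  reach-refl : ∀ {x} → Reach f x x
  reach-refl = 0 , refl

  reach-step : ∀ {x y} → f x ≡ y → Reach f x y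
  reach-step eq = 1 , eq

  reach-trans : ∀ {x y z} → Reach f x y → Reach f y z → Reach f x z
  reach-trans (k , refl) (l , refl) = l + k , iter-+ l k _

  -- One step may be matched by several steps or by none, so that orbits can be subdivided as well
  -- as contracted along `h`.
  reach-map : ∀ {Y : Set} {g : Y → Y} {Q : X → Set} (h : X → Y) → (∀ {x} → Q x → Q (f x)) →
    (∀ {x} → Q x → Reach g (h x) (h (f x))) → ∀ {x y} → Q x → Reach f x y → Reach g (h x) (h y)
  reach-map {g = g} {Q} h closed stepwise {x} q (k , refl) = go k
    where
    inv : ∀ k → Q (iter k f x)
    inv zero = q
    inv (suc k) = closed (inv k)
    go : ∀ k → Reach g (h x) (h (iter k f x))
    go zero = 0 , refl
    go (suc k) with go k | stepwise (inv k)
    ... | i , p | j , r = j + i , trans (iter-+′ j i (h x)) (trans (cong (iter j g) p) r)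
      where
      iter-+′ : ∀ k l y → iter (k + l) g y ≡ iter k g (iter l g y)
      iter-+′ zero l y = refl
      iter-+′ (suc k) l y = cong g (iter-+′ k l y)

sw : ∀ {n} → Fin n → Fin n → Fin n → Fin n
sw p q x with x Fin.≟ p | x Fin.≟ q
... | yes _ | _     = q
... | no  _ | yes _ = p
... | no  _ | no  _ = x

sw-left : ∀ {n} (p q : Fin n) → sw p q p ≡ q
sw-left p q with p Fin.≟ p
... | yes _  = refl
... | no p≢p = contradiction refl p≢p

sw-right : ∀ {n} (p q : Fin n) → sw p q q ≡ p
sw-right p q with q Fin.≟ p | q Fin.≟ q
... | yes q≡p | _ = q≡p
... | no _ | yes _ = refl
... | no _ | no q≢q = contradiction refl q≢q

sw-other : ∀ {n} {p q x : Fin n} → x ≢ p → x ≢ q → sw p q x ≡ x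
sw-other {p = p} {q} {x} x≢p x≢q with x Fin.≟ p | x Fin.≟ q
... | yes e | _ = contradiction e x≢p
... | no _ | yes e = contradiction e x≢q
... | no _ | no _ = refl

sw-involutive : ∀ {n} (p q x : Fin n) → sw p q (sw p q x) ≡ x
sw-involutive p q x = by (x Fin.≟ p) (x Fin.≟ q)
  where
  by : Dec (x ≡ p) → Dec (x ≡ q) → sw p q (sw p q x) ≡ x
  by (yes refl) _ = trans (cong (sw p q) (sw-left p q)) (sw-right p q)
  by (no _) (yes refl) = trans (cong (sw p q) (sw-right p q)) (sw-left p q)
  by (no x≢p) (no x≢q) = trans (cong (sw p q) (sw-other x≢p x≢q)) (sw-other x≢p x≢q)

bool-ext : ∀ {b c} → (b ≡ true → c ≡ true) → (c ≡ true → b ≡ true) → b ≡ c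
bool-ext {true}  {c}     f g = sym (f refl)
bool-ext {false} {true}  f g = g refl
bool-ext {false} {false} f g = refl

≡ᵇ-refl : ∀ {n} (x : Fin n) → (toℕ x ≡ᵇ toℕ x) ≡ true
≡ᵇ-refl x = Equivalence.to Boolₚ.T-≡ (ℕₚ.≡⇒≡ᵇ (toℕ x) (toℕ x) refl)

≡ᵇ⇒≡′ : ∀ {n} {x y : Fin n} → (toℕ x ≡ᵇ toℕ y) ≡ true → x ≡ y
≡ᵇ⇒≡′ {x = x} {y} e = Finₚ.toℕ-injective (ℕₚ.≡ᵇ⇒≡ (toℕ x) (toℕ y) (Equivalence.from Boolₚ.T-≡ e))

∨-true : ∀ b {c} → b ∨ c ≡ true → b ≡ true ⊎ c ≡ true
∨-true true  _ = inj₁ refl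
∨-true false e = inj₂ e

∧-true : ∀ b {c} → b ∧ c ≡ true → b ≡ true × c ≡ true
∧-true true e = refl , e

∨-introʳ : ∀ b {c} → c ≡ true → b ∨ c ≡ true
∨-introʳ true  _ = refl
∨-introʳ false e = e

module _ {n} (A : Adj n) (a c : Fin n) where
  addEdge-old : ∀ {x y} → A x y ≡ true → addEdge A a c x y ≡ true
  addEdge-old e rewrite e = refl

  addEdge-new : addEdge A a c a c ≡ true
  addEdge-new rewrite ≡ᵇ-refl a | ≡ᵇ-refl c = ∨-introʳ (A a c) refl

  addEdge-new′ : addEdge A a c c a ≡ true
  addEdge-new′ rewrite ≡ᵇ-refl a | ≡ᵇ-refl c = ∨-introʳ (A c a) (∨-introʳ ((toℕ c ≡ᵇ toℕ a) ∧ (toℕ a ≡ᵇ toℕ c)) refl)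

  addEdge-view : ∀ x y → addEdge A a c x y ≡ true → A x y ≡ true ⊎ (x ≡ a × y ≡ c) ⊎ (x ≡ c × y ≡ a)
  addEdge-view x y e with ∨-true (A x y) e
  ... | inj₁ old = inj₁ old
  ... | inj₂ e′ with ∨-true ((toℕ x ≡ᵇ toℕ a) ∧ (toℕ y ≡ᵇ toℕ c)) e′
  ...   | inj₁ p = let q , r = ∧-true _ p in alt₂ (≡ᵇ⇒≡′ q , ≡ᵇ⇒≡′ r)
  ...   | inj₂ p = let q , r = ∧-true _ p in inj₂ (inj₂ (≡ᵇ⇒≡′ q , ≡ᵇ⇒≡′ r))

  addEdge-simple : IsSimple A → a ≢ c → IsSimple (addEdge A a c)
  addEdge-simple (symA , irrA) a≢c = (λ x y → bool-ext (flip⁺ x y) (flip⁺ y x)) , irr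
    where
    flip⁺ : ∀ x y → (addEdge A a c) x y ≡ true → (addEdge A a c) y x ≡ true
    flip⁺ x y e with addEdge-view x y e
    ... | inj₁ old = addEdge-old (trans (symA y x) old)
    ... | alt₂ (refl , refl) = addEdge-new′
    ... | inj₂ (inj₂ (refl , refl)) = addEdge-new
    irr : ∀ x → (addEdge A a c) x x ≡ false
    irr x with addEdge A a c x x in e
    ... | false = refl
    ... | true with addEdge-view x x e
    ...   | inj₁ old = false≢true old (irrA x)
    ...   | alt₂ (refl , x≡c) = contradiction x≡c a≢c
    ...   | inj₂ (inj₂ (x≡c , refl)) = contradiction x≡c a≢c

  -- Counted through darts, where the new edge contributes exactly two entries whichever of its ends
  -- has the smaller index.
  addEdge-numEdges : IsSimple A → a ≢ c → A a c ≡ false → numEdges (addEdge A a c) ≡ suc (numEdges A)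
  addEdge-numEdges simple a≢c ¬ac = ℕₚ.*-cancelˡ-≡ _ _ 2 (trans (sym (length-darts A⁺ (addEdge-simple simple a≢c))) (trans
    (ℕₚ.≤-antisym (unique-⊆⇒length≤ (darts-unique A⁺) sub) (unique-⊆⇒length≤ uniq sub′))
    (trans (cong (2 +_) (length-darts A simple)) (sym (ℕₚ.*-suc 2 (numEdges A))))))
    where
    A⁺ = addEdge A a c
    ¬ca = trans (proj₁ simple c a) ¬ac
    not-old : ∀ {u x} → A u x ≡ false → A u x ≢ true
    not-old e e′ = false≢true e′ e
    new = (a , c) ∷ (c , a) ∷ darts A
    sub : darts A⁺ ⊆ new
    sub {u , v} i with addEdge-view u v (∈-darts⁻ A⁺ i)
    ... | inj₁ e = there (there (∈-darts A e))
    ... | alt₂ (refl , refl) = here refl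
    ... | inj₂ (inj₂ (refl , refl)) = here₁ refl
    sub′ : new ⊆ darts A⁺
    sub′ (here refl) = ∈-darts A⁺ (addEdge-new)
    sub′ (here₁ refl) = ∈-darts A⁺ (addEdge-new′)
    sub′ (there (there i)) = ∈-darts A⁺ (addEdge-old (∈-darts⁻ A i))
    uniq : Unique new
    uniq = ((λ eq → a≢c (,-injectiveˡ eq)) ∷ All.tabulate λ i eq → not-old ¬ac (∈-darts⁻ A (subst (_∈ darts A) (sym eq) i)))
         ∷ (All.tabulate λ i eq → not-old ¬ca (∈-darts⁻ A (subst (_∈ darts A) (sym eq) i)))
         ∷ darts-unique A

-- The new edge joins the ends of the face path a, b, c inside that face, cutting off the triangle abc.
module AddEdge {n} {A : Adj n} {F} (𝓜 : Map A F) {a b : Fin n} (ab : A a b ≡ true)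
               (a≢c : a ≢ Map.N 𝓜 b a) (¬ac : A a (Map.N 𝓜 b a) ≡ false) where
  open Map 𝓜

  c = N b a
  p₀ = M a b
  A⁺ = addEdge A a c

  bc : A b c ≡ true
  bc = N-edge (symm ab)

  ap₀ : A a p₀ ≡ true
  ap₀ = M-edge 𝓜 ab

  a≢b = edge⇒≢ ab
  b≢c = edge⇒≢ bc

  ¬ca : A c a ≡ false
  ¬ca = trans (proj₁ simple c a) ¬ac

  simple⁺ : IsSimple A⁺
  simple⁺ = addEdge-simple A a c simple a≢c

  -- As `N a` fixes the non-neighbour `c`, precomposing it with the transposition of `p₀` and `c`
  -- splices `c` into the cycle at `a`, between `p₀` and `b`. The transposition of `b` and `a`
  -- likewise splices `a` into the cycle at `c`, directly after `b`.
  τ′ : ∀ u → Dec (u ≡ a) → Dec (u ≡ c) → Fin n → Fin n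
  τ′ u (yes _) _       = sw p₀ c
  τ′ u (no _)  (yes _) = sw b a
  τ′ u (no _)  (no _)  = id

  τ : Fin n → Fin n → Fin n
  τ u = τ′ u (u Fin.≟ a) (u Fin.≟ c)

  τ-a : ∀ x → τ a x ≡ sw p₀ c x
  τ-a x with a Fin.≟ a
  ... | yes _ = refl
  ... | no ne = contradiction refl ne

  τ-c : ∀ x → τ c x ≡ sw b a x
  τ-c x with c Fin.≟ a | c Fin.≟ c
  ... | yes e | _ = contradiction (sym e) a≢c
  ... | no _ | yes _ = refl
  ... | no _ | no ne = contradiction refl ne

  τ-other : ∀ {u x} → u ≢ a → u ≢ c → τ u x ≡ x
  τ-other {u} u≢a u≢c with u Fin.≟ a | u Fin.≟ c
  ... | yes e | _ = contradiction e u≢a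
  ... | no _ | yes e = contradiction e u≢c
  ... | no _ | no _ = refl

  τ-involutive : ∀ u x → τ u (τ u x) ≡ x
  τ-involutive u x with u Fin.≟ a | u Fin.≟ c
  ... | yes _ | _ = sw-involutive p₀ c x
  ... | no _ | yes _ = sw-involutive b a x
  ... | no _ | no _ = refl

  N⁺ M⁺ : Fin n → Fin n → Fin n
  N⁺ u x = N u (τ u x)
  M⁺ u x = τ u (M u x)

  N⁺-ap₀ : N⁺ a p₀ ≡ c
  N⁺-ap₀ = trans (cong (N a) (trans (τ-a p₀) (sw-left p₀ c))) (N-fix ¬ac)

  N⁺-ac : N⁺ a c ≡ b
  N⁺-ac = trans (cong (N a) (trans (τ-a c) (sw-right p₀ c))) (NM a b)

  N⁺-cb : N⁺ c b ≡ a
  N⁺-cb = trans (cong (N c) (trans (τ-c b) (sw-left b a))) (N-fix ¬ca)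

  N⁺-ca : N⁺ c a ≡ N c b
  N⁺-ca = cong (N c) (trans (τ-c a) (sw-right b a))

  not-old : ∀ {u x} → A u x ≡ false → A u x ≢ true
  not-old e e′ = false≢true e′ e

  N⁺-same : ∀ u x → (u ≡ a → x ≢ p₀ × x ≢ c) → (u ≡ c → x ≢ b × x ≢ a) → N⁺ u x ≡ N u x
  N⁺-same u x at-a at-c = cong (N u) (by (u Fin.≟ a) (u Fin.≟ c))
    where
    by : Dec (u ≡ a) → Dec (u ≡ c) → τ u x ≡ x
    by (yes refl) _ = trans (τ-a x) (uncurry sw-other (at-a refl))
    by (no _) (yes refl) = trans (τ-c x) (uncurry sw-other (at-c refl))
    by (no u≢a) (no u≢c) = τ-other u≢a u≢c

  N⁺-old : ∀ {u x} → A u x ≡ true → (u , x) ≢ (a , p₀) → (u , x) ≢ (c , b) → N⁺ u x ≡ N u x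
  N⁺-old {u} {x} e ne₁ ne₂ = N⁺-same u x
    (λ { refl → (λ { refl → ne₁ refl }) , (λ { refl → not-old ¬ac e }) })
    (λ { u≡c → (λ { refl → ne₂ (cong (_, b) u≡c) }) , (λ { refl → not-old ¬ca (subst (λ t → A t a ≡ true) u≡c e) }) })

  data OldDart (u x : Fin n) : Set where
    atA  : u ≡ a → x ≡ p₀ → OldDart u x
    atC  : u ≡ c → x ≡ b → OldDart u x
    else : N⁺ u x ≡ N u x → OldDart u x

  oldDart : ∀ {u x} → A u x ≡ true → OldDart u x
  oldDart {u} {x} e with (u , x) ≟² (a , p₀) | (u , x) ≟² (c , b)
  ... | yes eq | _ = atA (,-injectiveˡ eq) (,-injectiveʳ eq)
  ... | no _ | yes eq = atC (,-injectiveˡ eq) (,-injectiveʳ eq)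
  ... | no ne₁ | no ne₂ = else (N⁺-old e ne₁ ne₂)

  N⁺-edge : ∀ {u x} → A⁺ u x ≡ true → A⁺ u (N⁺ u x) ≡ true
  N⁺-edge {u} {x} e with addEdge-view A a c u x e
  ... | alt₂ (u≡a , x≡c) rewrite u≡a | x≡c = subst (λ t → A⁺ a t ≡ true) (sym N⁺-ac) (addEdge-old A a c ab)
  ... | inj₂ (inj₂ (u≡c , x≡a)) rewrite u≡c | x≡a = subst (λ t → A⁺ c t ≡ true) (sym N⁺-ca) (addEdge-old A a c (N-edge (symm bc)))
  ... | inj₁ old with oldDart old
  ...   | atA refl refl = subst (λ t → A⁺ a t ≡ true) (sym N⁺-ap₀) (addEdge-new A a c)
  ...   | atC u≡c refl rewrite u≡c = subst (λ t → A⁺ c t ≡ true) (sym N⁺-cb) (addEdge-new′ A a c)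
  ...   | else eq = subst (λ t → A⁺ u t ≡ true) (sym eq) (addEdge-old A a c (N-edge old))

  N⁺-fix : ∀ {u x} → A⁺ u x ≡ false → N⁺ u x ≡ x
  N⁺-fix {u} {x} e = trans (N⁺-same u x
      (λ { refl → (λ { refl → false≢true (addEdge-old A a c ap₀) e }) , (λ { refl → false≢true (addEdge-new A a c) e }) })
      (λ u≡c → (λ { refl → false≢true (addEdge-old A a c (symm bc)) (trans (cong (λ t → A⁺ t b) (sym u≡c)) e) })
             , (λ { refl → false≢true (addEdge-new′ A a c) (trans (cong (λ t → A⁺ t a) (sym u≡c)) e) })))
    (N-fix (Boolₚ.¬-not λ old → false≢true (addEdge-old A a c old) e))

  old-reach : ∀ {u x} → A u x ≡ true → Reach (N⁺ u) x (N u x)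
  old-reach e with oldDart e
  ... | atA refl refl = 2 , trans (cong (N⁺ a) N⁺-ap₀) (trans N⁺-ac (sym (NM a b)))
  ... | atC refl refl = 2 , trans (cong (N⁺ c) N⁺-cb) N⁺-ca
  ... | else eq = 1 , eq

  cyclic⁺ : ∀ u {v w} → A⁺ u v ≡ true → A⁺ u w ≡ true → Reach (N⁺ u) v w
  cyclic⁺ u {v} {w} e e′ with exit e | entry e′
    where
    exit : ∀ {v} → A⁺ u v ≡ true → ∃ λ v′ → A u v′ ≡ true × Reach (N⁺ u) v v′
    exit {v} e with addEdge-view A a c u v e
    ... | inj₁ old = v , old , reach-refl
    ... | alt₂ (refl , refl) = b , ab , reach-step N⁺-ac
    ... | inj₂ (inj₂ (refl , refl)) = N c b , N-edge (symm bc) , reach-step N⁺-ca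
    entry : ∀ {v} → A⁺ u v ≡ true → ∃ λ v′ → A u v′ ≡ true × Reach (N⁺ u) v′ v
    entry {v} e with addEdge-view A a c u v e
    ... | inj₁ old = v , old , reach-refl
    ... | alt₂ (refl , refl) = p₀ , ap₀ , reach-step N⁺-ap₀
    ... | inj₂ (inj₂ (refl , refl)) = b , symm bc , reach-step N⁺-cb
  ... | v′ , uv′ , r | w′ , uw′ , r′ =
    reach-trans r (reach-trans (reach-map {Q = λ x → A u x ≡ true} id N-edge old-reach uv′ (cyclic u uv′ uw′)) r′)

  tri : List (Fin n × Fin n)
  tri = (a , b) ∷ (b , c) ∷ (c , a) ∷ []

  inTri? : ∀ p → Dec (p ∈ tri)
  inTri? p = Any.any? (p ≟²_) tri

  next next⁺ : Fin n × Fin n → Fin n × Fin n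
  next = next-dart 𝓜
  next⁺ (u , v) = v , N⁺ v u

  -- The triangle cut off is the face `zero`. The dart a → c replaces the path a, b, c on the
  -- boundary of the remaining part, which keeps the label of the old face.
  label : ∀ p → Dec (p ∈ tri) → Dec (p ≡ (a , c)) → Fin (suc F)
  label p (yes _) _ = zero
  label p (no _) (yes _) = suc (face a b)
  label p (no _) (no _) = suc (uncurry face p)

  face⁺ : Fin n × Fin n → Fin (suc F)
  face⁺ p = label p (inTri? p) (p ≟² (a , c))

  face⁺-tri : ∀ {p} → p ∈ tri → face⁺ p ≡ zero
  face⁺-tri {p} i with inTri? p
  ... | yes _ = refl
  ... | no ¬i = contradiction i ¬i

  ac∉tri : (a , c) ∉ tri
  ac∉tri (here eq) = b≢c (sym (,-injectiveʳ eq))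
  ac∉tri (here₁ eq) = a≢b (,-injectiveˡ eq)
  ac∉tri (here₂ eq) = a≢c (,-injectiveˡ eq)

  face⁺-ac : face⁺ (a , c) ≡ suc (face a b)
  face⁺-ac with inTri? (a , c) | (a , c) ≟² (a , c)
  ... | yes i | _ = contradiction i ac∉tri
  ... | no _ | yes _ = refl
  ... | no _ | no ne = contradiction refl ne

  face⁺-old : ∀ {p} → IsDart A p → p ∉ tri → face⁺ p ≡ suc (uncurry face p)
  face⁺-old {p} e ∉t with inTri? p | p ≟² (a , c)
  ... | yes i | _ = contradiction i ∉t
  ... | no _ | yes refl = contradiction e (not-old ¬ac)
  ... | no _ | no _ = refl

  face-bc : face b c ≡ face a b
  face-bc = sym (face-step ab)

  next-bc∉tri : next (b , c) ∉ tri
  next-bc∉tri (here eq) = a≢c (sym (,-injectiveˡ eq))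
  next-bc∉tri (here₁ eq) = b≢c (sym (,-injectiveˡ eq))
  next-bc∉tri (here₂ eq) = not-old ¬ca (subst (λ t → A c t ≡ true) (,-injectiveʳ eq) (N-edge (symm bc)))

  next⁺-ab : next⁺ (a , b) ≡ (b , c)
  next⁺-ab = cong (b ,_) (N⁺-old (symm ab) (λ eq → a≢b (sym (,-injectiveˡ eq))) (λ eq → b≢c (,-injectiveˡ eq)))

  next⁺-bc : next⁺ (b , c) ≡ (c , a)
  next⁺-bc = cong (c ,_) N⁺-cb

  next⁺-ca : next⁺ (c , a) ≡ (a , b)
  next⁺-ca = cong (a ,_) N⁺-ac

  next⁺-ac : next⁺ (a , c) ≡ next (b , c)
  next⁺-ac = cong (c ,_) N⁺-ca

  data OldStep (p : Fin n × Fin n) : Set where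
    entersA : next p ≡ (a , b) → next⁺ p ≡ (a , c) → OldStep p
    usual   : next⁺ p ≡ next p → next p ∉ tri → OldStep p

  oldStep : ∀ p → IsDart A p → p ∉ tri → OldStep p
  oldStep (u , v) e ∉t with oldDart (symm e)
  ... | atA refl refl = entersA (cong (a ,_) (NM a b)) (cong (a ,_) N⁺-ap₀)
  ... | atC refl refl = contradiction (here₁ refl) ∉t
  ... | else eq with (v , u) ≟² (a , p₀)
  ...   | yes refl = entersA (cong (a ,_) (NM a b)) (cong (a ,_) N⁺-ap₀)
  ...   | no ne = usual (cong (v ,_) eq) λ
    { (here eq′) → case ,-injectiveˡ eq′ of λ { refl →
        ne (cong (a ,_) (trans (sym (MN a u)) (cong (M a) (,-injectiveʳ eq′)))) }
    ; (here₁ eq′) → case ,-injectiveˡ eq′ of λ { refl →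
        ∉t (here (cong (_, b) (trans (sym (MN b u)) (trans (cong (M b) (,-injectiveʳ eq′)) (MN b a))))) }
    ; (here₂ eq′) → case ,-injectiveˡ eq′ of λ { refl →
        not-old ¬ca (subst (λ t → A c t ≡ true) (,-injectiveʳ eq′) (N-edge (symm e))) } }

  data NewDart : Fin n × Fin n → Set where
    inTri : ∀ {p} → p ∈ tri → NewDart p
    isAC  : NewDart (a , c)
    old   : ∀ {p} → IsDart A p → p ∉ tri → NewDart p

  newDart : ∀ p → IsDart A⁺ p → NewDart p
  newDart p e with inTri? p
  ... | yes i = inTri i
  ... | no ∉t with addEdge-view A a c (proj₁ p) (proj₂ p) e
  ...   | inj₁ e′ = old e′ ∉t
  ...   | alt₂ (refl , refl) = isAC
  ...   | inj₂ (inj₂ (refl , refl)) = inTri (here₂ refl)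

  face⁺-step : ∀ {p} → NewDart p → face⁺ p ≡ face⁺ (next⁺ p)
  face⁺-step (inTri (here refl)) = trans (face⁺-tri (here refl)) (sym (trans (cong face⁺ next⁺-ab) (face⁺-tri (here₁ refl))))
  face⁺-step (inTri (here₁ refl)) = trans (face⁺-tri (here₁ refl)) (sym (trans (cong face⁺ next⁺-bc) (face⁺-tri (here₂ refl))))
  face⁺-step (inTri (here₂ refl)) = trans (face⁺-tri (here₂ refl)) (sym (trans (cong face⁺ next⁺-ca) (face⁺-tri (here refl))))
  face⁺-step isAC = trans face⁺-ac (sym (trans (cong face⁺ next⁺-ac) (trans (face⁺-old (next-dart-edge 𝓜 (b , c) bc) next-bc∉tri)
    (cong suc (trans (sym (face-step bc)) face-bc)))))
  face⁺-step {p} (old e ∉t) with oldStep p e ∉t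
  ... | entersA nx nx⁺ = trans (face⁺-old e ∉t) (trans (cong suc (trans (face-step e) (cong (uncurry face) nx)))
        (sym (trans (cong face⁺ nx⁺) face⁺-ac)))
  ... | usual same nx∉t = trans (face⁺-old e ∉t) (trans (cong suc (face-step e))
        (sym (trans (cong face⁺ same) (face⁺-old (next-dart-edge 𝓜 p e) nx∉t))))

  π : Fin n × Fin n → Fin n × Fin n
  π p with inTri? p
  ... | yes _ = a , c
  ... | no _  = p

  π-tri : ∀ {p} → p ∈ tri → π p ≡ (a , c)
  π-tri {p} i with inTri? p
  ... | yes _ = refl
  ... | no ¬i = contradiction i ¬i

  π-old : ∀ {p} → p ∉ tri → π p ≡ p
  π-old {p} ∉t with inTri? p
  ... | yes i = contradiction i ∉t
  ... | no _ = refl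

  -- Contracting the path ab, bc of a face walk to the single dart ac gives a face walk of the new map.
  π-reach : ∀ {p} → IsDart A p → Reach next⁺ (π p) (π (next p))
  π-reach {p} e = by (inTri? p)
    where
    by : Dec (p ∈ tri) → Reach next⁺ (π p) (π (next p))
    by (yes (here refl)) = 0 , trans (π-tri (here refl)) (sym (π-tri (here₁ refl)))
    by (yes (here₁ refl)) = 1 , trans (cong next⁺ (π-tri (here₁ refl))) (trans next⁺-ac (sym (π-old next-bc∉tri)))
    by (yes (here₂ refl)) = contradiction e (not-old ¬ca)
    by (no ∉t) with oldStep p e ∉t
    ... | entersA nx nx⁺ = 1 , trans (cong next⁺ (π-old ∉t)) (trans nx⁺ (sym (π-tri (here nx))))
    ... | usual same nx∉t = 1 , trans (cong next⁺ (π-old ∉t)) (trans same (sym (π-old nx∉t)))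

  tri-orbit : ∀ {p q} → p ∈ tri → q ∈ tri → Reach next⁺ p q
  tri-orbit p∈ q∈ = reach-trans (to-ab p∈) (from-ab q∈)
    where
    bc→ca→ab : next⁺ (next⁺ (b , c)) ≡ (a , b)
    bc→ca→ab = trans (cong next⁺ next⁺-bc) next⁺-ca
    to-ab : ∀ {p} → p ∈ tri → Reach next⁺ p (a , b)
    to-ab (here refl) = reach-refl
    to-ab (here₁ refl) = 2 , bc→ca→ab
    to-ab (here₂ refl) = 1 , next⁺-ca
    from-ab : ∀ {p} → p ∈ tri → Reach next⁺ (a , b) p
    from-ab (here refl) = reach-refl
    from-ab (here₁ refl) = 1 , next⁺-ab
    from-ab (here₂ refl) = 2 , trans (cong next⁺ next⁺-ab) next⁺-bc

  face⁺-orbit : ∀ {p q} → NewDart p → NewDart q → face⁺ p ≡ face⁺ q → Reach next⁺ p q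
  face⁺-orbit {p} {q} vp vq eq with lift vp | lift vq
    where
    lift : ∀ {p} → NewDart p → p ∈ tri ⊎ ∃ λ p′ → IsDart A p′ × π p′ ≡ p × face⁺ p ≡ suc (uncurry face p′)
    lift (inTri i) = inj₁ i
    lift isAC = inj₂ ((a , b) , ab , π-tri (here refl) , face⁺-ac)
    lift {p} (old e ∉t) = inj₂ (p , e , π-old ∉t , face⁺-old e ∉t)
  ... | inj₁ i | inj₁ j = tri-orbit i j
  ... | inj₁ i | inj₂ (_ , _ , _ , f) = case trans (sym (face⁺-tri i)) (trans eq f) of λ ()
  ... | inj₂ (_ , _ , _ , f) | inj₁ j = case trans (sym f) (trans eq (face⁺-tri j)) of λ ()
  ... | inj₂ (p′ , e , refl , f) | inj₂ (q′ , e′ , refl , f′) =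
    reach-map {Q = IsDart A} π (λ {r} → next-dart-edge 𝓜 r) (λ {r} → π-reach {r}) e
      (face-orbit e e′ (Finₚ.suc-injective (trans (sym f) (trans eq f′))))

  map⁺ : Map A⁺ (suc F)
  map⁺ = record
    { simple = simple⁺
    ; connected = λ x y → gmap id (addEdge-old A a c) (connected x y)
    ; N = N⁺ ; M = M⁺ ; N-edge = N⁺-edge ; N-fix = N⁺-fix
    ; NM = λ u v → trans (cong (N u) (τ-involutive u (M u v))) (NM u v)
    ; MN = λ u v → trans (cong (τ u) (MN u (τ u v))) (τ-involutive u v)
    ; cyclic = cyclic⁺
    ; face = λ u v → face⁺ (u , v)
    ; face-step = λ {u} {v} e → face⁺-step (newDart (u , v) e)
    ; face-sur = sur
    ; face-orbit = λ {u} {v} {u′} {v′} e e′ → face⁺-orbit (newDart (u , v) e) (newDart (u′ , v′) e′)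
    }
    where
    sur : ∀ f → ∃₂ λ u v → A⁺ u v ≡ true × face⁺ (u , v) ≡ f
    sur zero = a , b , addEdge-old A a c ab , face⁺-tri (here refl)
    sur (suc f) with face-sur f
    ... | u , v , e , refl with inTri? (u , v)
    ...   | no ∉t = u , v , addEdge-old A a c e , face⁺-old e ∉t
    ...   | yes (here refl) = a , c , addEdge-new A a c , face⁺-ac
    ...   | yes (here₁ refl) = a , c , addEdge-new A a c , trans face⁺-ac (cong suc (sym face-bc))
    ...   | yes (here₂ refl) = contradiction e (not-old ¬ca)

  sphere⁺ : n + F ≡ numEdges A + 2 → SphereGraph A⁺
  sphere⁺ count = toSphere map⁺ (trans (ℕₚ.+-suc n F) (trans (cong suc count) (cong (_+ 2) (sym (addEdge-numEdges A a c simple a≢c ¬ac)))))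

-- t a b is the third vertex of the face to the left of the dart a → b; around v the successor of a is t a v.
record Tri {n} (A : Adj n) : Set where
  field
    simple    : IsSimple A
    connected : Connected A
    t         : Fin n → Fin n → Fin n
    t-edge    : ∀ {a b} → A a b ≡ true → A b (t a b) ≡ true
    t-rot     : ∀ {a b} → A a b ≡ true → t b (t a b) ≡ a
    link      : ∀ v {a b} → A v a ≡ true → A v b ≡ true → Reach (λ x → t x v) a b

module _ {n} {A : Adj n} (tri : Triangulation A) {F} (𝓜 : Map A F) (count : n + F ≡ numEdges A + 2) where
  open Map 𝓜

  private
    3≤n = proj₁ tri

  module _ {a b} (ab : A a b ≡ true) where
    private
      c = N b a
      bc = N-edge (symm ab)

    -- Otherwise the chord `ac` could be drawn inside the face, against maximality.
    corner-adjacent-or-≡ : a ≢ c → A a c ≡ true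
    corner-adjacent-or-≡ a≢c with A a c in e
    ... | true = refl
    ... | false = ⊥-elim (proj₂ (proj₂ tri) a c a≢c e (AddEdge.sphere⁺ 𝓜 ab a≢c e count))

  -- If the walk returned at once, `b` would be a leaf at `a`. The corner at `a` makes `b` adjacent
  -- to `N a b`, so this vertex would be `a` itself; if instead `N a b` is `b`, there is a digon.
  corner-≢ : ∀ {a b} → A a b ≡ true → a ≢ N b a
  corner-≢ {a} {b} ab a≡c with N a b Fin.≟ b
  ... | yes d≡b = no-digon 3≤n 𝓜 ab (sym a≡c) d≡b
  ... | no d≢b = edge⇒≢ (N-edge ab) (sym (leaf-unique 3≤n 𝓜 (symm ab) (sym a≡c)
                   (corner-adjacent-or-≡ (symm ab) (≢-sym d≢b))))

  corner-adjacent : ∀ {a b} → A a b ≡ true → A a (N b a) ≡ true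
  corner-adjacent ab = corner-adjacent-or-≡ ab (corner-≢ ab)

  -- In a face walk a, b, c, d with d ≢ a the chords ac and bd would cross: d lies on the
  -- face side of the cycle abc, but all neighbours of b other than c lie on the other side.
  faces-triangular : ∀ {a b} → A a b ≡ true → N (N b a) b ≡ a
  faces-triangular {a} {b} ab with N (N b a) b Fin.≟ a
  ... | yes eq = eq
  ... | no d≢a = ⊥-elim (false≢true (trans s-bd≡s-cd (trans (sym (s-face bc)) s-bc)) (s-b bd (≢-sym (edge⇒≢ cd))))
    where
    c = N b a
    d = N c b
    bc = N-edge (symm ab)
    cd = N-edge (symm bc)
    bd = corner-adjacent bc
    open Jordan (jordan 𝓜 (ℕₚ.≤-reflexive (sym count)) ab bc (symm (corner-adjacent ab)))
    d-off : Off a b c d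
    d-off = d≢a , ≢-sym (edge⇒≢ bd) , ≢-sym (edge⇒≢ cd)
    s-bd≡s-cd : s b d ≡ s c d
    s-bd≡s-cd = trans (s-off bd d-off) (trans (Homology.around 𝓜 s d
      (λ {v} dv → trans (sym (s-face (symm dv))) (s-off (symm dv) d-off)) (symm cd) (symm bd)) (sym (s-off cd d-off)))
    -- Turning around `b` from `c`, the colour is false directly after `c` and changes at no vertex
    -- off the cycle, until `a` is reached, whose successor is `c` again.
    s-b : ∀ {w} → A b w ≡ true → w ≢ c → s b w ≡ false
    s-b {w} bw w≢c with cyclic b bc bw
    ... | k , refl = [ (λ w≡c → contradiction w≡c w≢c) , id ]′ (go k)
      where
      go : ∀ k → iter k (N b) c ≡ c ⊎ s b (iter k (N b) c) ≡ false
      go zero = inj₁ refl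
      go (suc k) with iter-edge k bc | go k
      ... | e | inj₁ eq = inj₂ (trans (cong (λ x → s b (N b x)) eq) (trans (sym (s-face (symm bc))) s-cb))
      ... | e | inj₂ eq with iter k (N b) c Fin.≟ a
      ...   | yes w≡a = inj₁ (cong (N b) w≡a)
      ...   | no w≢a with iter k (N b) c Fin.≟ c
      ...     | yes w≡c = inj₂ (trans (cong (λ x → s b (N b x)) w≡c) (trans (sym (s-face (symm bc))) s-cb))
      ...     | no w≢c = inj₂ (trans (sym (s-face (symm e))) (trans (sym (s-off e (w≢a , ≢-sym (edge⇒≢ e) , w≢c))) eq))

  triangulation⇒tri : Tri A
  triangulation⇒tri = record
    { simple = simple
    ; connected = connected
    ; t = λ a b → N b a
    ; t-edge = λ ab → N-edge (symm ab)
    ; t-rot = faces-triangular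
    ; link = λ v → cyclic v
    }

-- From triangular faces back to sphere graphs

module TriProperties {n} {A : Adj n} (T : Tri A) where
  open Tri T public

  symm : ∀ {u v} → A u v ≡ true → A v u ≡ true
  symm {u} {v} e = trans (proj₁ simple v u) e

  edge⇒≢ : ∀ {u v} → A u v ≡ true → u ≢ v
  edge⇒≢ e refl = false≢true e (proj₂ simple _)

  t-edge′ : ∀ {a b} → A a b ≡ true → A (t a b) a ≡ true
  t-edge′ {a} {b} ab = subst (λ x → A (t a b) x ≡ true) (t-rot ab) (t-edge (t-edge ab))

  t-rot′ : ∀ {a b} → A a b ≡ true → t (t a b) a ≡ b
  t-rot′ {a} {b} ab = subst (λ x → t (t a b) x ≡ b) (t-rot ab) (t-rot (t-edge ab))

  t-edge″ : ∀ {a b} → A a b ≡ true → A a (t a b) ≡ true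
  t-edge″ = symm ∘ t-edge′

  φ : Fin n × Fin n → Fin n × Fin n
  φ (u , v) = v , t u v

  φ-edge : ∀ p → IsDart A p → IsDart A (φ p)
  φ-edge (u , v) = t-edge

  φ³ : ∀ p → IsDart A p → φ (φ (φ p)) ≡ p
  φ³ (u , v) e = cong₂ _,_ (t-rot e) (trans (cong (t (t u v)) (t-rot e)) (t-rot′ e))

module TriMap {n} {A : Adj n} (T : Tri A) {u₀ v₀} (d₀ : A u₀ v₀ ≡ true) where
  open TriProperties T

  N M : Fin n → Fin n → Fin n
  N v a = if A v a then t a v else a
  M v b = if A v b then t v b else b

  N-dart : ∀ {v a} → A v a ≡ true → N v a ≡ t a v
  N-dart e rewrite e = refl
  M-dart : ∀ {v a} → A v a ≡ true → M v a ≡ t v a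
  M-dart e rewrite e = refl
  N-fix : ∀ {v a} → A v a ≡ false → N v a ≡ a
  N-fix e rewrite e = refl
  M-fix : ∀ {v a} → A v a ≡ false → M v a ≡ a
  M-fix e rewrite e = refl

  NM : ∀ v b → N v (M v b) ≡ b
  NM v b = by (A v b Boolₚ.≟ true)
    where
    by : Dec (A v b ≡ true) → N v (M v b) ≡ b
    by (no ¬e) = let e = Boolₚ.¬-not ¬e in trans (cong (N v) (M-fix e)) (N-fix e)
    by (yes e) = trans (cong (N v) (M-dart e)) (trans (N-dart (t-edge″ e)) (t-rot′ e))

  MN : ∀ v a → M v (N v a) ≡ a
  MN v a = by (A v a Boolₚ.≟ true)
    where
    by : Dec (A v a ≡ true) → M v (N v a) ≡ a
    by (no ¬e) = let e = Boolₚ.¬-not ¬e in trans (cong (M v) (N-fix e)) (M-fix e)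
    by (yes e) = trans (cong (M v) (N-dart e)) (trans (M-dart (t-edge (symm e))) (t-rot (symm e)))

  -- The faces are the orbits of `φ`, of length three. The dart starting at the vertex of least
  -- index represents its face, so a filtered list enumerates the faces without a quotient.
  IsMin : Fin n × Fin n → Set
  IsMin (u , v) = toℕ u < toℕ v × toℕ u < toℕ (t u v)

  isMin? : Decidable IsMin
  isMin? (u , v) = (toℕ u ℕₚ.<? toℕ v) ×-dec (toℕ u ℕₚ.<? toℕ (t u v))

  min-φ : ∀ p → IsDart A p → IsMin p → ¬ IsMin (φ p)
  min-φ (u , v) e (u<v , _) (_ , v<u) = ℕₚ.<-asym u<v (subst (λ x → toℕ v < toℕ x) (t-rot e) v<u)

  min-φ² : ∀ p → IsDart A p → IsMin p → ¬ IsMin (φ (φ p))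
  min-φ² (u , v) e (_ , u<w) (w<u , _) = ℕₚ.<-asym u<w (subst (λ x → toℕ (t u v) < toℕ x) (t-rot e) w<u)

  some-min : ∀ p → IsDart A p → ¬ IsMin p → ¬ IsMin (φ p) → IsMin (φ (φ p))
  some-min (u , v) e ¬p ¬φp with ℕₚ.<-cmp (toℕ u) (toℕ v) | ℕₚ.<-cmp (toℕ v) (toℕ (t u v)) | ℕₚ.<-cmp (toℕ (t u v)) (toℕ u)
  ... | tri≈ _ eq _ | _ | _ = contradiction (Finₚ.toℕ-injective eq) (edge⇒≢ e)
  ... | _ | tri≈ _ eq _ | _ = contradiction (Finₚ.toℕ-injective eq) (edge⇒≢ (t-edge e))
  ... | _ | _ | tri≈ _ eq _ = contradiction (Finₚ.toℕ-injective eq) (edge⇒≢ (t-edge′ e))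
  ... | tri< u<v _ _ | _ | tri> _ _ u<w = contradiction (u<v , u<w) ¬p
  ... | tri> _ _ v<u | tri< v<w _ _ | _ =
        contradiction (v<w , subst (λ x → toℕ v < toℕ x) (sym (t-rot e)) v<u) ¬φp
  ... | tri< u<v _ _ | _ | tri< w<u _ _ =
        subst (λ x → toℕ (t u v) < toℕ x) (sym (t-rot e)) w<u ,
        subst (λ x → toℕ (t u v) < toℕ x) (sym (trans (cong (t (t u v)) (t-rot e)) (t-rot′ e))) (ℕₚ.<-trans w<u u<v)
  ... | tri> _ _ v<u | tri> _ _ w<v | _ =
        subst (λ x → toℕ (t u v) < toℕ x) (sym (t-rot e)) (ℕₚ.<-trans w<v v<u) ,
        subst (λ x → toℕ (t u v) < toℕ x) (sym (trans (cong (t (t u v)) (t-rot e)) (t-rot′ e))) w<v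

  rep′ : ∀ p → Dec (IsMin p) → Dec (IsMin (φ p)) → Fin n × Fin n
  rep′ p (yes _) _       = p
  rep′ p (no _)  (yes _) = φ p
  rep′ p (no _)  (no _)  = φ (φ p)

  rep : Fin n × Fin n → Fin n × Fin n
  rep p = rep′ p (isMin? p) (isMin? (φ p))

  rep-min : ∀ p → IsDart A p → IsMin (rep p)
  rep-min p e with isMin? p | isMin? (φ p)
  ... | yes m | _     = m
  ... | no _  | yes m = m
  ... | no ¬m | no ¬m′ = some-min p e ¬m ¬m′

  rep-dart : ∀ p → IsDart A p → IsDart A (rep p)
  rep-dart p e with isMin? p | isMin? (φ p)
  ... | yes _ | _     = e
  ... | no _  | yes _ = φ-edge p e
  ... | no _  | no _  = φ-edge (φ p) (φ-edge p e)

  rep-reach : ∀ p → Reach φ p (rep p)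
  rep-reach p with isMin? p | isMin? (φ p)
  ... | yes _ | _     = 0 , refl
  ... | no _  | yes _ = 1 , refl
  ... | no _  | no _  = 2 , refl

  reach-rep : ∀ p → IsDart A p → Reach φ (rep p) p
  reach-rep p e with isMin? p | isMin? (φ p)
  ... | yes _ | _     = 0 , refl
  ... | no _  | yes _ = 2 , φ³ p e
  ... | no _  | no _  = 1 , φ³ p e

  rep-of-min : ∀ p → IsMin p → rep p ≡ p
  rep-of-min p m with isMin? p | isMin? (φ p)
  ... | yes _ | _ = refl
  ... | no ¬m | _ = contradiction m ¬m

  rep-φ : ∀ p → IsDart A p → rep (φ p) ≡ rep p
  rep-φ p e with isMin? p | isMin? (φ p) | isMin? (φ (φ p))
  ... | yes m | yes m′ | _ = contradiction m′ (min-φ p e m)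
  ... | yes m | no _ | yes m″ = contradiction m″ (min-φ² p e m)
  ... | yes _ | no _ | no _ = φ³ p e
  ... | no _ | yes _ | _ = refl
  ... | no _ | no _ | yes _ = refl
  ... | no ¬m | no ¬m′ | no ¬m″ = contradiction (some-min p e ¬m ¬m′) ¬m″

  isRep? : Decidable (λ p → IsDart A p × IsMin p)
  isRep? p = isDart? A p ×-dec isMin? p

  reps : List (Fin n × Fin n)
  reps = filter isRep? (pairs n)

  F : ℕ
  F = length reps

  reps-unique : Unique reps
  reps-unique = Uniqueₚ.filter⁺ isRep? (pairs-unique n)

  rep∈reps : ∀ p → IsDart A p → rep p ∈ reps
  rep∈reps p e = ∈-filter⁺ isRep? (∈-pairs (rep p)) (rep-dart p e , rep-min p e)

  f₀ : Fin F
  f₀ = Any.index (rep∈reps (u₀ , v₀) d₀)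

  face′ : ∀ p → Dec (rep p ∈ reps) → Fin F
  face′ p (yes i) = Any.index i
  face′ p (no _)  = f₀

  face : Fin n → Fin n → Fin F
  face u v = face′ (u , v) (Any.any? (rep (u , v) ≟²_) reps)

  lookup-face : ∀ p → IsDart A p → List.lookup reps (uncurry face p) ≡ rep p
  lookup-face p e with Any.any? (rep p ≟²_) reps
  ... | yes i = sym (Anyₚ.lookup-index i)
  ... | no ¬i = contradiction (rep∈reps p e) ¬i

  next-φ : ∀ p → IsDart A p → (proj₂ p , N (proj₂ p) (proj₁ p)) ≡ φ p
  next-φ (u , v) e = cong (v ,_) (N-dart (symm e))

  map-of-tri : Map A F
  map-of-tri = record
    { simple = simple ; connected = connected ; N = N ; M = M
    ; N-edge = λ {u} {v} e → subst (λ x → A u x ≡ true) (sym (N-dart e)) (t-edge (symm e))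
    ; N-fix = N-fix ; NM = NM ; MN = MN
    ; cyclic = λ u e e′ → reach-map {Q = λ x → A u x ≡ true} id (λ e → t-edge (symm e)) (λ e → 1 , N-dart e) e (link u e e′)
    ; face = face
    ; face-step = λ {u} {v} e → lookup-injective reps-unique _ _ (trans (lookup-face (u , v) e) (trans (sym (rep-φ (u , v) e))
        (trans (sym (lookup-face (φ (u , v)) (t-edge e))) (cong (λ p → List.lookup reps (uncurry face p)) (sym (next-φ (u , v) e))))))
    ; face-sur = sur
    ; face-orbit = λ {u} {v} {u′} {v′} e e′ eq →
        reach-map {Q = IsDart A} id (λ {p} → φ-edge p) (λ {p} e → 1 , next-φ p e) e
          (reach-trans (rep-reach (u , v)) (subst (λ r → Reach φ r (u′ , v′))
            (trans (sym (lookup-face (u′ , v′) e′)) (trans (cong (List.lookup reps) (sym eq)) (lookup-face (u , v) e)))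
            (reach-rep (u′ , v′) e′)))
    }
    where
    sur : ∀ f → ∃₂ λ u v → A u v ≡ true × face u v ≡ f
    sur f with List.lookup reps f in eq
    ... | p = let e , m = proj₂ (∈-filter⁻ isRep? {xs = pairs n} (subst (_∈ reps) eq (∈-lookup {xs = reps} f))) in
      proj₁ p , proj₂ p , e , lookup-injective reps-unique _ _ (trans (lookup-face p e) (trans (rep-of-min p m) (sym eq)))

  -- Every dart lies zero, one or two steps of `φ` after the representative of its face.
  2E≤3F : 2 * numEdges A ≤ F * 3
  2E≤3F = subst₂ _≤_ (length-darts A simple) len (unique-⊆⇒length≤ (darts-unique A) sub)
    where
    thrice = reps ++ List.map φ reps ++ List.map (φ ∘ φ) reps
    len : length thrice ≡ F * 3
    len rewrite Listₚ.length-++ reps {List.map φ reps ++ List.map (φ ∘ φ) reps} | Listₚ.length-++ (List.map φ reps) {List.map (φ ∘ φ) reps}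
      | Listₚ.length-map φ reps | Listₚ.length-map (φ ∘ φ) reps = arith (length reps)
      where
      arith : ∀ F → F + (F + F) ≡ F * 3
      arith = solve-∀
    sub : darts A ⊆ thrice
    sub {p} i = by (isMin? p) (isMin? (φ p)) (∈-darts⁻ A i)
      where
      member : ∀ {q} → IsDart A q → IsMin q → q ∈ reps
      member {q} e m = ∈-filter⁺ isRep? (∈-pairs q) (e , m)
      by : Dec (IsMin p) → Dec (IsMin (φ p)) → IsDart A p → p ∈ thrice
      by (yes m) _ e = ∈-++⁺ˡ (member e m)
      by (no _) (yes m) e = ∈-++⁺ʳ reps (∈-++⁺ʳ (List.map φ reps)
        (subst (_∈ List.map (φ ∘ φ) reps) (φ³ p e) (∈-map⁺ (φ ∘ φ) (member (φ-edge p e) m))))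
      by (no ¬m) (no ¬m′) e = ∈-++⁺ʳ reps (∈-++⁺ˡ {xs = List.map φ reps}
        (subst (_∈ List.map φ reps) (φ³ p e) (∈-map⁺ φ (member (φ-edge (φ p) (φ-edge p e)) (some-min p e ¬m ¬m′)))))

  module _ (bound : numEdges A + 6 ≤ 3 * n) where
    private
      E = numEdges A

    euler-≥ : E + 2 ≤ n + F
    euler-≥ = ℕₚ.*-cancelˡ-≤ 3 (begin
      3 * (E + 2)        ≡⟨ arith₁ E ⟩
      (E + 6) + 2 * E    ≤⟨ ℕₚ.+-mono-≤ bound 2E≤3F ⟩
      3 * n + F * 3      ≡⟨ arith₂ n F ⟩
      3 * (n + F) ∎)
      where
      open ℕₚ.≤-Reasoning
      arith₁ : ∀ E → 3 * (E + 2) ≡ (E + 6) + 2 * E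
      arith₁ = solve-∀
      arith₂ : ∀ n F → 3 * n + F * 3 ≡ 3 * (n + F)
      arith₂ = solve-∀

    euler-≤ : n + F ≤ E + 2
    euler-≤ = Homology.euler-inequality map-of-tri f₀ u₀

    3n≤E+6 : 3 * n ≤ E + 6
    3n≤E+6 = ℕₚ.+-cancelʳ-≤ (2 * E) (3 * n) (E + 6) (begin
      3 * n + 2 * E      ≤⟨ ℕₚ.+-monoʳ-≤ (3 * n) 2E≤3F ⟩
      3 * n + F * 3      ≡⟨ arith₂ n F ⟩
      3 * (n + F)        ≤⟨ ℕₚ.*-monoʳ-≤ 3 euler-≤ ⟩
      3 * (E + 2)        ≡⟨ arith₁ E ⟩
      (E + 6) + 2 * E ∎)
      where
      open ℕₚ.≤-Reasoning
      arith₁ : ∀ E → 3 * (E + 2) ≡ (E + 6) + 2 * E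
      arith₁ = solve-∀
      arith₂ : ∀ n F → 3 * n + F * 3 ≡ 3 * (n + F)
      arith₂ = solve-∀

    -- The two Euler inequalities give a sphere graph with 3n ≤ E + 6; a further edge would break
    -- the bound E + 6 ≤ 3n valid for all sphere graphs.
    tri⇒triangulation : 3 ≤ n → Triangulation A
    tri⇒triangulation 3≤n = 3≤n , toSphere map-of-tri (ℕₚ.≤-antisym euler-≤ euler-≥) , λ u v u≢v ¬uv S →
      ℕₚ.1+n≰n (ℕₚ.≤-trans (subst (λ k → k + 6 ≤ 3 * n) (addEdge-numEdges A u v simple u≢v ¬uv) (sphere-edge-bound 3≤n S)) 3n≤E+6)

    opaque
      tri-jordan : ∀ {a b c} → A a b ≡ true → A b c ≡ true → A c a ≡ true → Jordan A (λ v u → t u v) a b c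
      tri-jordan {a} {b} {c} ab bc ca = record
        { s = s ; s-off = s-off ; s-ab = s-ab ; s-bc = s-bc ; s-ca = s-ca ; s-ba = s-ba ; s-cb = s-cb ; s-ac = s-ac
        ; s-face = λ {u} {v} e → trans (s-face e) (cong (s v) (N-dart (symm e)))
        }
        where open Jordan (jordan map-of-tri euler-≥ ab bc ca)

-- Contraction of an edge

does-true : ∀ {P : Set} (d : Dec P) → does d ≡ true → P
does-true (yes p) _ = p

-- An injective step on a finite set is periodic along each orbit, so the starting point recurs:
-- after `k` steps, going on to the next suitable multiple of the period leads back.
reach-sym : ∀ {m} {g : Fin m → Fin m} {Q : Fin m → Set} → (∀ {x} → Q x → Q (g x)) →
  (∀ {x y} → Q x → Q y → g x ≡ g y → x ≡ y) → ∀ {x y} → Q x → Reach g x y → Reach g y x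
reach-sym {m} {g} {Q} closed inj {x} q (k , refl) with Finₚ.pigeonhole (ℕₚ.n<1+n m) (λ i → iter (toℕ i) g x)
... | i , j , i<j , eq with cancel (toℕ i) (toℕ j) i<j eq
  where
  Q-iter : ∀ k → Q (iter k g x)
  Q-iter zero = q
  Q-iter (suc k) = closed (Q-iter k)
  cancel : ∀ i j → i < j → iter i g x ≡ iter j g x → ∃ λ p → iter (suc p) g x ≡ x
  cancel zero (suc j) _ eq = j , sym eq
  cancel (suc i) (suc j) (s≤s i<j) eq = cancel i j i<j (inj (Q-iter i) (Q-iter j) eq)
... | p , per = k * suc p ∸ k , trans (sym (iter-+ {f = g} (k * suc p ∸ k) k x))
      (trans (cong (λ i → iter i g x) (ℕₚ.m∸n+n≡m (ℕₚ.m≤m*n k (suc p)))) (multiple k))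
  where
  multiple : ∀ k → iter (k * suc p) g x ≡ x
  multiple zero = refl
  multiple (suc k) = trans (iter-+ {f = g} (suc p) (k * suc p) x) (trans (cong (iter (suc p) g) (multiple k)) per)

module _ {n} {A : Adj n} (T : Tri A) where
  open TriProperties T

  -- The neighbours of `v` form one cycle under the successor, so closure under a single step
  -- suffices. This is the form in which links are used below.
  link-induction : ∀ {v a} (Q : Fin n → Set) → A v a ≡ true → Q a →
    (∀ {x} → A v x ≡ true → Q x → Q (t x v)) → ∀ {b} → A v b ≡ true → Q b
  link-induction {v} {a} Q va qa closed vb with link v va vb
  ... | k , refl = proj₂ (go k)
    where
    go : ∀ k → A v (iter k (λ x → t x v) a) ≡ true × Q (iter k (λ x → t x v) a)
    go zero = va , qa
    go (suc k) = let e , q = go k in t-edge (symm e) , closed e q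

  module _ {x y} (x≢y : x ≢ y) (¬xy : A x y ≡ false) where

    -- If both faces at `uv` had the same third vertex, the links of these three vertices would
    -- close up and the graph would be a triangle, leaving no room for the non-adjacent pair `x`,
    -- `y`, later the ends of a brace.
    apexes-≢ : ∀ {u v} → A u v ≡ true → t u v ≢ t v u
    apexes-≢ {u} {v} uv r≡l = adjacent (all x) (all y)
      where
      w = t u v
      around : ∀ {a b c d} → A a b ≡ true → t b a ≡ c → t c a ≡ b → A a d ≡ true → d ∈ b ∷ c ∷ []
      around {a} {b} {c} ab ba≡c ca≡b = link-induction (_∈ b ∷ c ∷ []) ab (here refl)
        λ { _ (here refl) → here₁ ba≡c ; _ (here₁ refl) → here ca≡b }
      all : ∀ z → z ∈ u ∷ v ∷ w ∷ []
      all = closed-covers connected (u ∷ v ∷ w ∷ []) (here refl) λ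
        { (here refl) e → case around uv (sym r≡l) (t-rot′ uv) e of λ
            { (here p) → here₁ p ; (here₁ p) → here₂ p }
        ; (here₁ refl) e → case around (symm uv) refl (trans (cong (λ c → t c v) r≡l) (t-rot′ (symm uv))) e of λ
            { (here p) → here p ; (here₁ p) → here₂ p }
        ; (here₂ refl) e → case around (t-edge′ uv) (trans (cong (t u) r≡l) (t-rot (symm uv))) (t-rot uv) e of λ
            { (here p) → here p ; (here₁ p) → here₁ p } }
      adjacent : x ∈ u ∷ v ∷ w ∷ [] → y ∈ u ∷ v ∷ w ∷ [] → ⊥
      adjacent p q = [ x≢y , (λ xy → false≢true xy ¬xy) ]′ (by p q)
        where
        by : ∀ {x y} → x ∈ u ∷ v ∷ w ∷ [] → y ∈ u ∷ v ∷ w ∷ [] → x ≡ y ⊎ A x y ≡ true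
        by (here refl) (here refl) = inj₁ refl
        by (here refl) (here₁ refl) = inj₂ uv
        by (here refl) (here₂ refl) = inj₂ (t-edge″ uv)
        by (here₁ refl) (here refl) = inj₂ (symm uv)
        by (here₁ refl) (here₁ refl) = inj₁ refl
        by (here₁ refl) (here₂ refl) = inj₂ (t-edge uv)
        by (here₂ refl) (here refl) = inj₂ (t-edge′ uv)
        by (here₂ refl) (here₁ refl) = inj₂ (symm (t-edge uv))
        by (here₂ refl) (here₂ refl) = inj₁ refl

module Merge {m} {u v : Fin (suc m)} (u≢v : u ≢ v) where

  merge′ : ∀ x → Dec (v ≡ x) → Fin m
  merge′ x (yes _)  = punchOut (≢-sym u≢v)
  merge′ x (no v≢x) = punchOut v≢x

  merge : Fin (suc m) → Fin m
  merge x = merge′ x (v Fin.≟ x)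

  merge-v : merge v ≡ punchOut (≢-sym u≢v)
  merge-v with v Fin.≟ v
  ... | yes _ = refl
  ... | no ne = contradiction refl ne

  merge-other : ∀ {x} (v≢x : v ≢ x) → merge x ≡ punchOut v≢x
  merge-other {x} v≢x with v Fin.≟ x
  ... | yes e = contradiction e v≢x
  ... | no _  = Finₚ.punchOut-cong v refl

  merge-uv : merge u ≡ merge v
  merge-uv = trans (merge-other (≢-sym u≢v)) (sym merge-v)

  merge-sur : ∀ x → ∃ λ a → merge a ≡ x
  merge-sur x = punchIn v x , trans (merge-other (λ e → Finₚ.punchInᵢ≢i v x (sym e)))
    (trans (Finₚ.punchOut-cong v refl) (Finₚ.punchOut-punchIn v))

  merge-inj : ∀ a b → merge a ≡ merge b → a ≡ b ⊎ ((a ≡ u ⊎ a ≡ v) × (b ≡ u ⊎ b ≡ v))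
  merge-inj a b eq with v Fin.≟ a | v Fin.≟ b
  ... | yes refl | yes refl = inj₁ refl
  ... | yes refl | no v≢b = inj₂ (inj₂ refl , inj₁ (sym (Finₚ.punchOut-injective (≢-sym u≢v) v≢b eq)))
  ... | no v≢a | yes refl = inj₂ (inj₁ (Finₚ.punchOut-injective v≢a (≢-sym u≢v) eq) , inj₂ refl)
  ... | no v≢a | no v≢b = inj₁ (Finₚ.punchOut-injective v≢a v≢b eq)

image? : ∀ {n m} (f : Fin n → Fin m) (R : Adj n) → ∀ x y → Dec (∃ λ a → ∃ λ b → f a ≡ x × f b ≡ y × R a b ≡ true)
image? f R x y = Finₚ.any? λ a → Finₚ.any? λ b → (f a Fin.≟ x) ×-dec (f b Fin.≟ y) ×-dec (R a b Boolₚ.≟ true)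

module Contract {m} {A : Adj (suc m)} (T : Tri A) {u v : Fin (suc m)} (uv : A u v ≡ true)
  (r≢l : Tri.t T u v ≢ Tri.t T v u)
  (only : ∀ w → A u w ≡ true → A v w ≡ true → w ≡ Tri.t T u v ⊎ w ≡ Tri.t T v u) where
  open TriProperties T
  open Merge (edge⇒≢ uv) public renaming (merge to f; merge-uv to f-uv; merge-sur to f-sur; merge-inj to f-inj)

  r l : Fin (suc m)
  r = t u v
  l = t v u

  u≢v = edge⇒≢ uv
  u≢r = edge⇒≢ (t-edge″ uv)
  v≢r = edge⇒≢ (t-edge uv)
  u≢l = edge⇒≢ (t-edge (symm uv))
  v≢l = edge⇒≢ (t-edge″ (symm uv))

  A′? : ∀ x y → Dec (x ≢ y × ∃ λ a → ∃ λ b → f a ≡ x × f b ≡ y × A a b ≡ true)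
  A′? x y = ¬? (x Fin.≟ y) ×-dec image? f A x y

  A′ : Adj m
  A′ x y = does (A′? x y)

  A′-to : ∀ {x y} → A′ x y ≡ true → x ≢ y × ∃ λ a → ∃ λ b → f a ≡ x × f b ≡ y × A a b ≡ true
  A′-to {x} {y} = does-true (A′? x y)

  A′-from : ∀ {a b} → f a ≢ f b → A a b ≡ true → A′ (f a) (f b) ≡ true
  A′-from {a} {b} ne ab = dec-true (A′? (f a) (f b)) (ne , a , b , refl , refl , ab)

  -- The darts of the two faces at uv. Every dart of the quotient lifts to exactly one other dart.
  bad : List (Fin (suc m) × Fin (suc m))
  bad = (u , v) ∷ (v , r) ∷ (r , u) ∷ (v , u) ∷ (u , l) ∷ (l , v) ∷ []

  bad-φ : ∀ {p} → p ∈ bad → φ p ∈ bad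
  bad-φ (here refl) = here₁ refl
  bad-φ (here₁ refl) = here₂ (cong (r ,_) (t-rot uv))
  bad-φ (here₂ refl) = here (cong (u ,_) (t-rot′ uv))
  bad-φ (here₃ refl) = here₄ refl
  bad-φ (here₄ refl) = here₅ (cong (l ,_) (t-rot (symm uv)))
  bad-φ (here₅ refl) = here₃ (cong (v ,_) (t-rot′ (symm uv)))

  Good : Fin (suc m) × Fin (suc m) → Set
  Good p = IsDart A p × p ∉ bad

  good-φ : ∀ {p} → Good p → Good (φ p)
  good-φ {p} (e , ∉bad) = φ-edge p e , λ i → ∉bad (subst (_∈ bad) (φ³ p e) (bad-φ (bad-φ i)))

  ∉-by : ∀ {p} → All (p ≢_) bad → p ∉ bad
  ∉-by = Allₚ.All¬⇒¬Any

  -- Of two darts made parallel by the contraction, the one whose left face does not collapse is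
  -- kept: u → r, r → v, v → l and l → u.
  good-lift : ∀ {a b} → f a ≢ f b → A a b ≡ true → ∃₂ λ a′ b′ → Good (a′ , b′) × f a′ ≡ f a × f b′ ≡ f b
  good-lift {a} {b} ne ab with Any.any? ((a , b) ≟²_) bad
  ... | no ∉bad = a , b , (ab , ∉bad) , refl , refl
  ... | yes (here refl) = contradiction f-uv ne
  ... | yes (here₁ refl) = u , r , (t-edge″ uv , ∉-by
        ((v≢r ∘ sym ∘ ,-injectiveʳ) ∷ (u≢v ∘ ,-injectiveˡ) ∷ (u≢r ∘ ,-injectiveˡ) ∷ (u≢v ∘ ,-injectiveˡ)
         ∷ (r≢l ∘ ,-injectiveʳ) ∷ (u≢l ∘ ,-injectiveˡ) ∷ [])) , f-uv , refl
  ... | yes (here₂ refl) = r , v , (symm (t-edge uv) , ∉-by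
        ((u≢r ∘ sym ∘ ,-injectiveˡ) ∷ (v≢r ∘ sym ∘ ,-injectiveˡ) ∷ (u≢v ∘ sym ∘ ,-injectiveʳ) ∷ (v≢r ∘ sym ∘ ,-injectiveˡ)
         ∷ (u≢r ∘ sym ∘ ,-injectiveˡ) ∷ (r≢l ∘ ,-injectiveˡ) ∷ [])) , refl , sym f-uv
  ... | yes (here₃ refl) = contradiction (sym f-uv) ne
  ... | yes (here₄ refl) = v , l , (t-edge″ (symm uv) , ∉-by
        ((u≢v ∘ sym ∘ ,-injectiveˡ) ∷ (r≢l ∘ sym ∘ ,-injectiveʳ) ∷ (v≢r ∘ ,-injectiveˡ) ∷ (u≢l ∘ sym ∘ ,-injectiveʳ)
         ∷ (u≢v ∘ sym ∘ ,-injectiveˡ) ∷ (v≢l ∘ ,-injectiveˡ) ∷ [])) , sym f-uv , refl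
  ... | yes (here₅ refl) = l , u , (symm (t-edge (symm uv)) , ∉-by
        ((u≢l ∘ sym ∘ ,-injectiveˡ) ∷ (v≢l ∘ sym ∘ ,-injectiveˡ) ∷ (r≢l ∘ sym ∘ ,-injectiveˡ) ∷ (v≢l ∘ sym ∘ ,-injectiveˡ)
         ∷ (u≢l ∘ sym ∘ ,-injectiveˡ) ∷ (u≢v ∘ ,-injectiveʳ) ∷ [])) , refl , f-uv

  good-≢ : ∀ {a b} → Good (a , b) → f a ≢ f b
  good-≢ {a} {b} (e , ∉bad) eq with f-inj a b eq
  ... | inj₁ refl = edge⇒≢ e refl
  ... | inj₂ (inj₁ refl , inj₁ refl) = edge⇒≢ e refl
  ... | inj₂ (inj₁ refl , inj₂ refl) = ∉bad (here refl)
  ... | inj₂ (inj₂ refl , inj₁ refl) = ∉bad (here₃ refl)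
  ... | inj₂ (inj₂ refl , inj₂ refl) = edge⇒≢ e refl

  -- Two different lifts would join a common neighbour to `u` and to `v`. By `only` that neighbour
  -- is `r` or `l`, and there one of the two darts is bad.
  good-unique : ∀ {a b a′ b′} → Good (a , b) → Good (a′ , b′) → f a ≡ f a′ → f b ≡ f b′ → (a , b) ≡ (a′ , b′)
  good-unique {a} {b} {a′} {b′} g g′ ea eb with f-inj a a′ ea | f-inj b b′ eb
  ... | inj₁ refl | inj₁ refl = refl
  ... | inj₂ (inj₁ refl , inj₁ refl) | inj₁ refl = refl
  ... | inj₂ (inj₂ refl , inj₂ refl) | inj₁ refl = refl
  ... | inj₁ refl | inj₂ (inj₁ refl , inj₁ refl) = refl
  ... | inj₁ refl | inj₂ (inj₂ refl , inj₂ refl) = refl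
  ... | inj₂ (inj₁ refl , inj₂ refl) | inj₁ refl = contradiction (only b (proj₁ g) (proj₁ g′)) λ
        { (inj₁ refl) → proj₂ g′ (here₁ refl) ; (inj₂ refl) → proj₂ g (here₄ refl) }
  ... | inj₂ (inj₂ refl , inj₁ refl) | inj₁ refl = contradiction (only b (proj₁ g′) (proj₁ g)) λ
        { (inj₁ refl) → proj₂ g (here₁ refl) ; (inj₂ refl) → proj₂ g′ (here₄ refl) }
  ... | inj₁ refl | inj₂ (inj₁ refl , inj₂ refl) = contradiction (only a (symm (proj₁ g)) (symm (proj₁ g′))) λ
        { (inj₁ refl) → proj₂ g (here₂ refl) ; (inj₂ refl) → proj₂ g′ (here₅ refl) }
  ... | inj₁ refl | inj₂ (inj₂ refl , inj₁ refl) = contradiction (only a (symm (proj₁ g′)) (symm (proj₁ g))) λ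
        { (inj₁ refl) → proj₂ g′ (here₂ refl) ; (inj₂ refl) → proj₂ g (here₅ refl) }
  ... | inj₂ (pa , _) | inj₂ (pb , _) = contradiction (f-class pa pb) (good-≢ g)
    where
    f-class : ∀ {a b} → a ≡ u ⊎ a ≡ v → b ≡ u ⊎ b ≡ v → f a ≡ f b
    f-class (inj₁ refl) (inj₁ refl) = refl
    f-class (inj₁ refl) (inj₂ refl) = f-uv
    f-class (inj₂ refl) (inj₁ refl) = sym f-uv
    f-class (inj₂ refl) (inj₂ refl) = refl

  lift : ∀ {x y} → A′ x y ≡ true → ∃₂ λ a b → Good (a , b) × f a ≡ x × f b ≡ y
  lift e with A′-to e
  ... | ne , a , b , refl , refl , ab = good-lift ne ab

  apex : ∀ {x y} → Dec (A′ x y ≡ true) → Fin m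
  apex {x} (no _) = x
  apex (yes e) = let a , b , _ = lift e in f (t a b)

  t′ : Fin m → Fin m → Fin m
  t′ x y = apex (A′ x y Boolₚ.≟ true)

  good-A′ : ∀ {a b} → Good (a , b) → A′ (f a) (f b) ≡ true
  good-A′ g = A′-from (good-≢ g) (proj₁ g)

  -- By `good-unique`, the lift chosen inside `t′` is the given dart.
  t′-good : ∀ {a b} → Good (a , b) → t′ (f a) (f b) ≡ f (t a b)
  t′-good {a} {b} g with A′ (f a) (f b) Boolₚ.≟ true
  ... | no ¬e = contradiction (good-A′ g) ¬e
  ... | yes e with lift e
  ...   | a′ , b′ , g′ , ea , eb = cong (f ∘ uncurry t) (good-unique g′ g ea eb)

  simple′ : IsSimple A′
  simple′ = (λ x y → bool-ext (flip x y) (flip y x)) , λ x → Boolₚ.¬-not λ e → proj₁ (A′-to {x} {x} e) refl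
    where
    flip : ∀ x y → A′ x y ≡ true → A′ y x ≡ true
    flip x y e with A′-to {x} {y} e
    ... | ne , a , b , refl , refl , ab = A′-from (≢-sym ne) (symm ab)

  connected′ : Connected A′
  connected′ x y with f-sur x | f-sur y
  ... | a , refl | b , refl = go (connected a b)
    where
    go : ∀ {a b} → Star (λ a b → A a b ≡ true) a b → Star (λ x y → A′ x y ≡ true) (f a) (f b)
    go ε = ε
    go {a} {b} (_◅_ {j = c} e p) with f a Fin.≟ f c
    ... | yes eq = subst (λ x → Star _ x (f b)) (sym eq) (go p)
    ... | no ne = A′-from ne e ◅ go p

  t′-edge : ∀ {x y} → A′ x y ≡ true → A′ y (t′ x y) ≡ true
  t′-edge e with lift e
  ... | a , b , g , refl , refl = subst (λ z → A′ (f b) z ≡ true) (sym (t′-good g)) (good-A′ (good-φ g))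

  t′-rot : ∀ {x y} → A′ x y ≡ true → t′ y (t′ x y) ≡ x
  t′-rot e with lift e
  ... | a , b , g , refl , refl = trans (cong (t′ (f b)) (t′-good g)) (trans (t′-good (good-φ g)) (cong f (t-rot (proj₁ g))))

  symm′ : ∀ {x y} → A′ x y ≡ true → A′ y x ≡ true
  symm′ {x} {y} e = trans (proj₁ simple′ y x) e

  -- Around u every neighbour other than v reaches r without passing v, since r immediately precedes v.
  towards : ∀ {u v r} → A u v ≡ true → t u v ≡ r → (∀ {b} → A u b ≡ true → b ≢ v → b ≢ r → Good (b , u)) →
    ∀ {b} → A u b ≡ true → b ≢ v → Reach (λ x → t′ x (f u)) (f b) (f r)
  towards {u} {v} {r} uv refl good {b} ub b≢v with link u ub (t-edge″ uv)
  ... | k , eq = go k ub b≢v eq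
    where
    go : ∀ k {b} → A u b ≡ true → b ≢ v → iter k (λ x → t x u) b ≡ r → Reach (λ x → t′ x (f u)) (f b) (f r)
    go zero ub b≢v refl = reach-refl
    go (suc k) {b} ub b≢v eq with b Fin.≟ r
    ... | yes refl = reach-refl
    ... | no b≢r = reach-trans (reach-step (t′-good (good ub b≢v b≢r)))
          (go k (t-edge (symm ub)) (λ e → b≢r (trans (sym (t-rot (symm ub))) (cong (t u) e)))
            (trans (sym (iter-shift k b)) eq))

  towards-r : ∀ {b} → A u b ≡ true → b ≢ v → Reach (λ x → t′ x (f u)) (f b) (f r)
  towards-r = towards uv refl λ ub b≢v b≢r → symm ub , ∉-by
    ((u≢v ∘ ,-injectiveʳ) ∷ (u≢r ∘ ,-injectiveʳ) ∷ (b≢r ∘ ,-injectiveˡ) ∷ (b≢v ∘ ,-injectiveˡ)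
     ∷ (u≢l ∘ ,-injectiveʳ) ∷ (u≢v ∘ ,-injectiveʳ) ∷ [])

  towards-l : ∀ {b} → A v b ≡ true → b ≢ u → Reach (λ x → t′ x (f u)) (f b) (f l)
  towards-l {b} vb b≢u = subst (λ y → Reach (λ x → t′ x y) (f b) (f l)) (sym f-uv) (towards (symm uv) refl (λ vb b≢u b≢l → symm vb , ∉-by
    ((b≢u ∘ ,-injectiveˡ) ∷ (v≢r ∘ ,-injectiveʳ) ∷ (u≢v ∘ sym ∘ ,-injectiveʳ) ∷ (u≢v ∘ sym ∘ ,-injectiveʳ)
     ∷ (v≢l ∘ ,-injectiveʳ) ∷ (b≢l ∘ ,-injectiveˡ) ∷ [])) vb b≢u)

  -- The link of the merged vertex consists of two arcs: neighbours of `v` are carried to `l`, from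
  -- where the arc of `u` continues to `r`. Everything reaches `f r`, and `reach-sym` supplies the
  -- way back.
  link-merged : ∀ {x y} → A′ (f u) x ≡ true → A′ (f u) y ≡ true → Reach (λ x → t′ x (f u)) x y
  link-merged ex ey = reach-trans (to-r ex) (reach-sym {Q = λ x → A′ (f u) x ≡ true} (λ e → t′-edge (symm′ e))
    (λ {x} {y} e e′ eq → trans (sym (t′-rot (symm′ e))) (trans (cong (t′ (f u)) eq) (t′-rot (symm′ e′)))) ey (to-r ey))
    where
    l-to-r : Reach (λ x → t′ x (f u)) (f l) (f r)
    l-to-r = towards-r (t-edge (symm uv)) (≢-sym v≢l)
    to-r : ∀ {x} → A′ (f u) x ≡ true → Reach (λ x → t′ x (f u)) x (f r)
    to-r e with lift e
    ... | a , b , g , ea , refl with f-inj a u ea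
    ...   | inj₁ refl = towards-r (proj₁ g) λ { refl → proj₂ g (here refl) }
    ...   | inj₂ (inj₁ refl , _) = towards-r (proj₁ g) λ { refl → proj₂ g (here refl) }
    ...   | inj₂ (inj₂ refl , _) = reach-trans (towards-l (proj₁ g) λ { refl → proj₂ g (here₃ refl) }) l-to-r

  link-other : ∀ {y} → y ≢ u → y ≢ v → ∀ {a b} → A y a ≡ true → A y b ≡ true → Reach (λ x → t′ x (f y)) (f a) (f b)
  link-other {y} y≢u y≢v ya yb = reach-map {Q = λ a → A y a ≡ true} f (λ e → t-edge (symm e)) stepwise ya (link y ya yb)
    where
    stepwise : ∀ {a} → A y a ≡ true → Reach (λ x → t′ x (f y)) (f a) (f (t a y))
    stepwise {a} ya with Any.any? ((a , y) ≟²_) bad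
    ... | no ∉bad = reach-step (t′-good (symm ya , ∉bad))
    ... | yes (here refl) = contradiction refl y≢v
    -- At `r` and at `l` the vertices `u` and `v` are consecutive neighbours that become one, so no
    -- step is made.
    ... | yes (here₁ refl) = 0 , trans (sym f-uv) (cong f (sym (t-rot uv)))
    ... | yes (here₂ refl) = contradiction refl y≢u
    ... | yes (here₃ refl) = contradiction refl y≢u
    ... | yes (here₄ refl) = 0 , trans f-uv (cong f (sym (t-rot (symm uv))))
    ... | yes (here₅ refl) = contradiction refl y≢v

  tri′ : Tri A′
  tri′ = record { simple = simple′ ; connected = connected′ ; t = t′ ; t-edge = t′-edge ; t-rot = t′-rot ; link = link′ }
    where
    link′ : ∀ y {x z} → A′ y x ≡ true → A′ y z ≡ true → Reach (λ x → t′ x y) x z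
    link′ y ex ez with f-sur y
    ... | c , refl with c Fin.≟ u | c Fin.≟ v
    ...   | yes refl | _ = link-merged ex ez
    ...   | no _ | yes refl = subst (λ y → Reach (λ x → t′ x y) _ _) f-uv
              (link-merged (subst (λ y → A′ y _ ≡ true) (sym f-uv) ex) (subst (λ y → A′ y _ ≡ true) (sym f-uv) ez))
    ...   | no c≢u | no c≢v with lift ex | lift ez
    ...     | a , b , g , ea , refl | a′ , b′ , g′ , ea′ , refl = link-other c≢u c≢v (at ea g) (at ea′ g′)
      where
      at : ∀ {a b} → f a ≡ f c → Good (a , b) → A c b ≡ true
      at {a} ea g with f-inj a c ea
      ... | inj₁ refl = proj₁ g
      ... | inj₂ (_ , inj₁ c≡u) = contradiction c≡u c≢u
      ... | inj₂ (_ , inj₂ c≡v) = contradiction c≡v c≢v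

  -- All darts of the quotient come from darts outside `bad`, and the six darts in `bad` are
  -- distinct.
  edges-drop : numEdges A′ + 3 ≤ numEdges A
  edges-drop = ℕₚ.*-cancelˡ-≤ 2 (begin
    2 * (numEdges A′ + 3)            ≡⟨ ℕₚ.*-distribˡ-+ 2 (numEdges A′) 3 ⟩
    2 * numEdges A′ + 6              ≡⟨ cong (_+ 6) (sym (length-darts A′ simple′)) ⟩
    length (darts A′) + 6            ≤⟨ ℕₚ.+-monoˡ-≤ 6 darts′≤ ⟩
    length goods + 6                 ≡⟨ ℕₚ.+-comm (length goods) 6 ⟩
    length (bad ++ goods)            ≤⟨ unique-⊆⇒length≤ unique sub ⟩
    length (darts A)                 ≡⟨ length-darts A simple ⟩
    2 * numEdges A ∎)
    where
    open ℕₚ.≤-Reasoning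
    isGood? : Decidable (λ p → p ∉ bad)
    isGood? p = ¬? (Any.any? (p ≟²_) bad)
    goods = filter isGood? (darts A)
    f² : Fin (suc m) × Fin (suc m) → Fin m × Fin m
    f² (a , b) = f a , f b
    darts′≤ : length (darts A′) ≤ length goods
    darts′≤ = subst (length (darts A′) ≤_) (Listₚ.length-map f² goods) (unique-⊆⇒length≤ (darts-unique A′) λ {(x , y)} i →
      case lift (∈-darts⁻ A′ i) of λ { (a , b , (e , ∉bad) , refl , refl) →
        ∈-map⁺ f² (∈-filter⁺ isGood? (∈-darts A e) ∉bad) })
    unique : Unique (bad ++ goods)
    unique = Uniqueₚ.++⁺ (((u≢v ∘ ,-injectiveˡ) ∷ (u≢r ∘ ,-injectiveˡ) ∷ (u≢v ∘ ,-injectiveˡ) ∷ (v≢l ∘ ,-injectiveʳ) ∷ (u≢l ∘ ,-injectiveˡ) ∷ [])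
      ∷ ((v≢r ∘ ,-injectiveˡ) ∷ (u≢r ∘ sym ∘ ,-injectiveʳ) ∷ (u≢v ∘ sym ∘ ,-injectiveˡ) ∷ (v≢l ∘ ,-injectiveˡ) ∷ [])
      ∷ ((v≢r ∘ sym ∘ ,-injectiveˡ) ∷ (u≢r ∘ sym ∘ ,-injectiveˡ) ∷ (r≢l ∘ ,-injectiveˡ) ∷ [])
      ∷ ((u≢v ∘ sym ∘ ,-injectiveˡ) ∷ (v≢l ∘ ,-injectiveˡ) ∷ [])
      ∷ ((u≢l ∘ ,-injectiveˡ) ∷ [])
      ∷ [] ∷ []) (Uniqueₚ.filter⁺ isGood? (darts-unique A))
      λ { (i , j) → proj₂ (∈-filter⁻ isGood? {xs = darts A} j) i }
    sub : bad ++ goods ⊆ darts A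
    sub i with ∈-++⁻ bad i
    ... | inj₂ j = proj₁ (∈-filter⁻ isGood? {xs = darts A} j)
    ... | inj₁ (here refl) = ∈-darts A uv
    ... | inj₁ (here₁ refl) = ∈-darts A (t-edge uv)
    ... | inj₁ (here₂ refl) = ∈-darts A (t-edge′ uv)
    ... | inj₁ (here₃ refl) = ∈-darts A (symm uv)
    ... | inj₁ (here₄ refl) = ∈-darts A (t-edge (symm uv))
    ... | inj₁ (here₅ refl) = ∈-darts A (t-edge′ (symm uv))

  edge-bound′ : numEdges A + 6 ≤ 3 * suc m → numEdges A′ + 6 ≤ 3 * m
  edge-bound′ bound = ℕₚ.+-cancelʳ-≤ 3 (numEdges A′ + 6) (3 * m) (begin
    numEdges A′ + 6 + 3    ≡⟨ arith (numEdges A′) ⟩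
    numEdges A′ + 3 + 6    ≤⟨ ℕₚ.+-monoˡ-≤ 6 edges-drop ⟩
    numEdges A + 6         ≤⟨ bound ⟩
    3 * suc m              ≡⟨ arith′ m ⟩
    3 * m + 3 ∎)
    where
    open ℕₚ.≤-Reasoning
    arith : ∀ e → e + 6 + 3 ≡ e + 3 + 6
    arith = solve-∀
    arith′ : ∀ m → 3 * suc m ≡ 3 * m + 3
    arith′ = solve-∀

  3≤m : 3 ≤ m
  3≤m = ℕₚ.≤-pred (unique⇒length≤n {xs = u ∷ v ∷ r ∷ l ∷ []}
    ((u≢v ∷ u≢r ∷ u≢l ∷ []) ∷ (v≢r ∷ v≢l ∷ []) ∷ (r≢l ∷ []) ∷ [] ∷ []))

-- Sides of non-facial 3-cycles

OnT : ∀ {n} (a b c v : Fin n) → Set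
OnT a b c v = v ≡ a ⊎ v ≡ b ⊎ v ≡ c

off? : ∀ {n} (a b c v : Fin n) → Off a b c v ⊎ OnT a b c v
off? a b c v with v Fin.≟ a | v Fin.≟ b | v Fin.≟ c
... | yes p | _ | _ = alt₂ p
... | no _ | yes p | _ = alt₃ p
... | no _ | no _ | yes p = alt₄ p
... | no p | no q | no r = inj₁ (p , q , r)

off-not-on : ∀ {n} {a b c v : Fin n} → Off a b c v → OnT a b c v → ⊥
off-not-on (p , _ , _) (inj₁ e) = p e
off-not-on (_ , p , _) (alt₂ e) = p e
off-not-on (_ , _ , p) (inj₂ (inj₂ e)) = p e

not-false : ∀ {b} → not b ≡ true → b ≡ false
not-false {false} _ = refl

module Sides {n} {A : Adj n} (T : Tri A) (bound : numEdges A + 6 ≤ 3 * n) (3≤n : 3 ≤ n) where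
  open TriProperties T public

  opaque
    nb : Fin n → Fin n
    nb v = proj₁ (neighbour connected (ℕₚ.≤-trans (s≤s (s≤s z≤n)) 3≤n) v)

    nb-edge : ∀ v → A v (nb v) ≡ true
    nb-edge v = proj₂ (neighbour connected (ℕₚ.≤-trans (s≤s (s≤s z≤n)) 3≤n) v)

  Third : Fin n → Fin n → Fin n → Set
  Third u w z = A u w ≡ true × A w z ≡ true × A z u ≡ true × t u w ≢ z × t w u ≢ z

  third? : ∀ u w → Dec (∃ (Third u w))
  third? u w = Finₚ.any? λ z → (A u w Boolₚ.≟ true) ×-dec (A w z Boolₚ.≟ true) ×-dec (A z u Boolₚ.≟ true)
    ×-dec ¬? (t u w Fin.≟ z) ×-dec ¬? (t w u Fin.≟ z)

  -- A non-facial 3-cycle abc together with the side of it to the left of a → b.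
  record Side : Set where
    field
      a b c : Fin n
      ab    : A a b ≡ true
      bc    : A b c ≡ true
      ca    : A c a ≡ true
      left  : t a b ≢ c
      right : t b a ≢ c
      J     : Jordan A (λ v u → t u v) a b c
    open Jordan J public

    side : Fin n → Bool
    side v = s v (nb v)

    IsOff IsOn In : Fin n → Set
    IsOff = Off a b c
    IsOn  = OnT a b c
    In v  = IsOff v × side v ≡ true

    -- Turning around a vertex off the cycle crosses no edge of the cycle. Hence `side`, although
    -- read off at the arbitrary neighbour `nb v`, does not depend on that choice.
    s-around : ∀ {v w w′} → IsOff v → A v w ≡ true → A v w′ ≡ true → s v w′ ≡ s v w
    s-around {v} {w} off vw = link-induction T (λ x → s v x ≡ s v w) vw refl
      (λ e q → trans (sym (s-face (symm e))) (trans (s-off (symm e) off) q))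

    side-out : ∀ {v w} → IsOff v → A v w ≡ true → s v w ≡ side v
    side-out {v} off vw = s-around off (nb-edge v) vw

    side-in : ∀ {v w} → IsOff v → A w v ≡ true → s w v ≡ side v
    side-in off wv = trans (s-off wv off) (side-out off (symm wv))

    side-adjacent : ∀ {v w} → IsOff v → IsOff w → A v w ≡ true → side v ≡ side w
    side-adjacent ov ow vw = trans (sym (side-out ov vw)) (side-in ow vw)

    side-apex : ∀ {u v} → A u v ≡ true → IsOff (t u v) → side (t u v) ≡ s u v
    side-apex uv off = trans (sym (side-in off (t-edge uv))) (sym (s-face uv))

    in? : ∀ v → Dec (In v)
    in? v with off? a b c v
    ... | inj₂ on = no λ i → off-not-on (proj₁ i) on
    ... | inj₁ off with side v in eq
    ...   | true  = yes (off , refl)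
    ...   | false = no λ { (_ , ()) }

    in-adjacent : ∀ {v w} → In v → A v w ≡ true → In w ⊎ IsOn w
    in-adjacent {v} {w} (ov , iv) vw with off? a b c w
    ... | inj₁ ow = inj₁ (ow , trans (sym (side-adjacent ov ow vw)) iv)
    ... | inj₂ on = inj₂ on

    apex-in : In (t a b)
    apex-in = off , trans (side-apex ab off) s-ab
      where off = ≢-sym (edge⇒≢ (t-edge″ ab)) , ≢-sym (edge⇒≢ (t-edge ab)) , left

    size : ℕ
    size = length (filter in? (allFin n))

  open Side public

  face-rot : ∀ {x y z} → A x y ≡ true → t x y ≡ z → t y z ≡ x
  face-rot xy refl = t-rot xy

  face-rot² : ∀ {x y z} → A x y ≡ true → t x y ≡ z → t z x ≡ y
  face-rot² xy refl = t-rot′ xy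

  -- Reversing the cycle and negating the colour makes the other side a `Side` again, so everything
  -- need only be proved for the left.
  op rot : Side → Side
  op X = record
    { a = a X ; b = c X ; c = b X ; ab = symm (ca X) ; bc = symm (bc X) ; ca = symm (ab X)
    ; left = right X ∘ face-rot² (symm (ca X))
    ; right = left X ∘ face-rot (ca X)
    ; J = record
      { s = λ u v → not (s X u v) ; s-face = λ e → cong not (s-face X e)
      ; s-off = λ { e (p , q , r) → cong not (s-off X e (p , r , q)) }
      ; s-ab = cong not (s-ac X) ; s-bc = cong not (s-cb X) ; s-ca = cong not (s-ba X)
      ; s-ba = cong not (s-ca X) ; s-cb = cong not (s-bc X) ; s-ac = cong not (s-ab X) }
    }
  rot X = record
    { a = b X ; b = c X ; c = a X ; ab = bc X ; bc = ca X ; ca = ab X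
    ; left = left X ∘ face-rot² (bc X)
    ; right = right X ∘ face-rot (symm (bc X))
    ; J = record
      { s = s X ; s-face = s-face X
      ; s-off = λ { e (p , q , r) → s-off X e (r , p , q) }
      ; s-ab = s-bc X ; s-bc = s-ca X ; s-ca = s-ab X
      ; s-ba = s-cb X ; s-cb = s-ac X ; s-ac = s-ba X }
    }

  rot-in : ∀ X {v} → In (rot X) v → In X v
  rot-in X ((p , q , r) , i) = (r , p , q) , i

  in-rot : ∀ X {v} → In X v → In (rot X) v
  in-rot X ((p , q , r) , i) = (q , r , p) , i

  op-on : ∀ X {v} → IsOn (op X) v → IsOn X v
  op-on X (inj₁ e) = inj₁ e
  op-on X (alt₂ e) = inj₂ (inj₂ e)
  op-on X (inj₂ (inj₂ e)) = alt₂ e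

  in-or-op : ∀ X {v} → IsOff X v → In X v ⊎ In (op X) v
  in-or-op X {v} off@(p , q , r) = by (side X v) refl
    where
    by : ∀ x → side X v ≡ x → In X v ⊎ In (op X) v
    by true  eq = inj₁ (off , eq)
    by false eq = inj₂ ((p , r , q) , cong not eq)

  in-not-op : ∀ X {v} → In X v → In (op X) v → ⊥
  in-not-op X (_ , i) (_ , j) = false≢true i (not-false j)

  -- The open side together with one vertex of the 3-cycle is connected.
  side-connected : ∀ X {C : Set} (Q : Fin n → C) →
    (∀ {v w} → In X v → In X w ⊎ w ≡ a X → A v w ≡ true → Q v ≡ Q w) → ∀ {v} → In X v → Q v ≡ Q (a X)
  side-connected X Q inv {v} iv = go iv (connected v (a X))
    where
    -- When a path leaves the side at `b` or `c`, one turns around that vertex within the side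
    -- instead. On the left of the cycle the successors run from `a` to `c` around `b`, and from `b`
    -- to `a` around `c`.
    at-b : ∀ {p} → In X p → A (b X) p ≡ true → Q p ≡ Q (a X)
    at-b ip bp = link-induction T (λ w → In X w → Q w ≡ Q (a X)) (symm (ab X)) (λ i → ⊥-elim (proj₁ (proj₁ i) refl)) stepwise bp ip
      where
      stepwise : ∀ {w} → A (b X) w ≡ true → (In X w → Q w ≡ Q (a X)) → In X (t w (b X)) → Q (t w (b X)) ≡ Q (a X)
      stepwise {w} bw q i′ with off? (a X) (b X) (c X) w
      ... | alt₂ refl = inv i′ (inj₂ refl) (t-edge′ (ab X))
      ... | alt₃ refl = contradiction refl (edge⇒≢ bw)
      ... | alt₄ refl = false≢true (proj₂ i′) (trans (side-apex X (symm bw) (proj₁ i′)) (s-cb X))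
      ... | inj₁ ow = let iw = ow , trans (side-adjacent X ow (proj₁ i′) (t-edge″ (symm bw))) (proj₂ i′) in
                      trans (sym (inv iw (inj₁ i′) (t-edge″ (symm bw)))) (q iw)
    at-c : ∀ {p} → In X p → A (c X) p ≡ true → Q p ≡ Q (a X)
    at-c {p} ip cp with link (c X) cp (ca X)
    ... | k , r = walk k ip cp r
      where
      walk : ∀ k {w} → In X w → A (c X) w ≡ true → iter k (λ x → t x (c X)) w ≡ a X → Q w ≡ Q (a X)
      walk zero i cw refl = contradiction refl (proj₁ (proj₁ i))
      walk (suc k) {w} i cw r with in-adjacent X i (t-edge″ (symm cw))
      ... | inj₁ i′ = trans (inv i (inj₁ i′) (t-edge″ (symm cw))) (walk k i′ (t-edge (symm cw)) (trans (sym (iter-shift k w)) r))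
      ... | alt₂ eq = trans (inv i (inj₂ eq) (t-edge″ (symm cw))) (cong Q eq)
      ... | alt₃ eq = false≢true (proj₂ i) (trans (sym (side-in X (proj₁ i) cw′)) (trans (s-off X cw′ (proj₁ i))
              (trans (s-face X (symm cw)) (trans (cong (s X (c X)) eq) (s-cb X)))))
        where cw′ = cw
      ... | alt₄ eq = contradiction (sym eq) (edge⇒≢ (t-edge (symm cw)))
    go : ∀ {v} → In X v → Star (λ u w → A u w ≡ true) v (a X) → Q v ≡ Q (a X)
    go i ε = refl
    go i (e ◅ p) with in-adjacent X i e
    ... | inj₁ i′ = trans (inv i (inj₁ i′) e) (go i′ p)
    ... | alt₂ refl = inv i (inj₂ refl) e
    ... | alt₃ refl = at-b i (symm e)
    ... | alt₄ refl = at-c i (symm e)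

  -- As `Y` avoids the cycle of `X`, the colour of `X` is constant on `Y` together with `a Y`, by
  -- `side-connected`; at `a Y` it is the wrong colour.
  disjoint-sides : ∀ X Y → (∀ {v} → IsOn X v → ¬ In Y v) → IsOff X (a Y) → ¬ In X (a Y) → ∀ {v} → In Y v → ¬ In X v
  disjoint-sides X Y apart off ¬ia {v} iv jv =
    ¬ia (off , trans (sym (side-connected Y (side X) inv iv)) (proj₂ jv))
    where
    off-Y : ∀ {v} → In Y v → IsOff X v
    off-Y {v} i with off? (a X) (b X) (c X) v
    ... | inj₁ o = o
    ... | inj₂ on = ⊥-elim (apart on i)
    inv : ∀ {v w} → In Y v → In Y w ⊎ w ≡ a Y → A v w ≡ true → side X v ≡ side X w
    inv i (inj₁ j) e = side-adjacent X (off-Y i) (off-Y j) e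
    inv i (inj₂ refl) e = side-adjacent X (off-Y i) off e

  Within : Side → Side → Set
  Within Y X = ∀ {v} → In Y v → In X v

  SameCycle : Side → Side → Set
  SameCycle Y X = Y ≡ X ⊎ Y ≡ op X

  avoid : ∀ X {v} → IsOff X v → ∃ λ Y → SameCycle Y X × ¬ In Y v
  avoid X off with in-or-op X off
  ... | inj₁ i = op X , inj₂ refl , in-not-op X i
  ... | inj₂ i = X , inj₁ refl , λ j → in-not-op X j i

  same-on : ∀ {X Y} → SameCycle Y X → ∀ {v} → IsOn Y v → IsOn X v
  same-on (inj₁ refl) on = on
  same-on {X} (inj₂ refl) on = op-on X on

  same-on′ : ∀ {X Y} → SameCycle Y X → ∀ {v} → IsOn X v → IsOn Y v
  same-on′ (inj₁ refl) on = on
  same-on′ (inj₂ refl) (inj₁ e) = inj₁ e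
  same-on′ (inj₂ refl) (alt₂ e) = inj₂ (inj₂ e)
  same-on′ (inj₂ refl) (inj₂ (inj₂ e)) = alt₂ e

  off-same : ∀ {X Y} → SameCycle Y X → ∀ {v} → IsOff X v → IsOff Y v
  off-same (inj₁ refl) o = o
  off-same (inj₂ refl) (p , q , r) = p , r , q

  on-adjacent : ∀ X {v w} → IsOn X v → IsOn X w → v ≡ w ⊎ A v w ≡ true
  on-adjacent X (inj₁ refl) (inj₁ refl) = inj₁ refl
  on-adjacent X (inj₁ refl) (alt₂ refl) = inj₂ (ab X)
  on-adjacent X (inj₁ refl) (inj₂ (inj₂ refl)) = inj₂ (symm (ca X))
  on-adjacent X (alt₂ refl) (inj₁ refl) = inj₂ (symm (ab X))
  on-adjacent X (alt₂ refl) (alt₂ refl) = inj₁ refl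
  on-adjacent X (alt₂ refl) (inj₂ (inj₂ refl)) = inj₂ (bc X)
  on-adjacent X (inj₂ (inj₂ refl)) (inj₁ refl) = inj₂ (ca X)
  on-adjacent X (inj₂ (inj₂ refl)) (alt₂ refl) = inj₂ (symm (bc X))
  on-adjacent X (inj₂ (inj₂ refl)) (inj₂ (inj₂ refl)) = inj₁ refl

  private
    -- Take the side of `Y` that misses `a X`. Every vertex of its cycle equals or is adjacent to
    -- `d`, hence is not beyond the cycle of `X`, and `disjoint-sides` separates the chosen side
    -- from `op X`. The vertices `b X` and `c X` are adjacent to `a X`, so they are missed as well.
    within-at : ∀ X Y {d} → In X d → IsOn Y d → IsOff Y (a X) → ∃ λ Z → SameCycle Z Y × Within Z X
    within-at X Y {d} id on off with avoid Y off
    ... | Z , same , ¬ia = Z , same , inside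
      where
      Z-near : ∀ {v} → IsOn Z v → ¬ In (op X) v
      Z-near on′ i with on-adjacent Y on (same-on same on′)
      ... | inj₁ refl = in-not-op X id i
      ... | inj₂ dv with in-adjacent X id dv
      ...   | inj₁ j = in-not-op X j i
      ...   | inj₂ onX = off-not-on (proj₁ i) (op-on (op X) onX)
      inside : Within Z X
      inside {v} iv with off? (a X) (b X) (c X) v
      ... | inj₁ o with in-or-op X o
      ...   | inj₁ i = i
      ...   | inj₂ i = ⊥-elim (disjoint-sides Z (op X) Z-near (off-same same off) ¬ia i iv)
      inside {v} iv | inj₂ on′ with on-adjacent X (inj₁ refl) on′
      ... | inj₁ refl = contradiction iv ¬ia
      ... | inj₂ av = ⊥-elim (¬ia (off-same same off , trans (side-adjacent Z (off-same same off) (proj₁ iv) av) (proj₂ iv)))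

  -- Since `d` lies on the cycle of `Y`, at most two vertices of the cycle of `X` can lie there too;
  -- `within-at` applies at a third one.
  nested-side : ∀ X Y {d} → In X d → IsOn Y d → ∃ λ Z → SameCycle Z Y × Within Z X
  nested-side X Y {d} i on with off? (a Y) (b Y) (c Y) (a X) | off? (a Y) (b Y) (c Y) (b X) | off? (a Y) (b Y) (c Y) (c X)
  ... | inj₁ o | _ | _ = within-at X Y i on o
  ... | inj₂ _ | inj₁ o | _ = let Z , same , w = within-at (rot X) Y (in-rot X i) on o in Z , same , λ j → rot-in X (w j)
  ... | inj₂ _ | inj₂ _ | inj₁ o = let Z , same , w = within-at (rot (rot X)) Y (in-rot (rot X) (in-rot X i)) on o in
                                   Z , same , λ j → rot-in X (rot-in (rot X) (w j))
  ... | inj₂ p | inj₂ q | inj₂ r = ⊥-elim (ℕₚ.1+n≰n (unique-⊆⇒length≤ {xs = d ∷ a X ∷ b X ∷ c X ∷ []} {ys = a Y ∷ b Y ∷ c Y ∷ []}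
      ((proj₁ (proj₁ i) ∷ proj₁ (proj₂ (proj₁ i)) ∷ proj₂ (proj₂ (proj₁ i)) ∷ [])
       ∷ (edge⇒≢ (ab X) ∷ ≢-sym (edge⇒≢ (ca X)) ∷ []) ∷ (edge⇒≢ (bc X) ∷ []) ∷ [] ∷ [])
      λ { (here refl) → mem′ on ; (here₁ refl) → mem′ p ; (here₂ refl) → mem′ q
        ; (here₃ refl) → mem′ r }))
    where
    mem′ : ∀ {v} → IsOn Y v → v ∈ a Y ∷ b Y ∷ c Y ∷ []
    mem′ (inj₁ e) = here e
    mem′ (alt₂ e) = here₁ e
    mem′ (inj₂ (inj₂ e)) = here₂ e

  within-smaller : ∀ {X Y d} → Within Y X → In X d → ¬ In Y d → size Y < size X
  within-smaller {X} {Y} {d} w i ¬i = unique-⊆⇒length≤ {xs = d ∷ filter (in? Y) (allFin n)}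
    (All.tabulate (λ { j refl → ¬i (proj₂ (∈-filter⁻ (in? Y) {xs = allFin n} j)) })
      ∷ Uniqueₚ.filter⁺ (in? Y) (Uniqueₚ.allFin⁺ n))
    λ { (here refl) → ∈-filter⁺ (in? X) (∈-allFin d) i
      ; (there j) → ∈-filter⁺ (in? X) (∈-allFin _) (w (proj₂ (∈-filter⁻ (in? Y) {xs = allFin n} j))) }

  cycle : ∀ {u w z} → Third u w z → Side
  cycle {u} {w} {z} (uw , wz , zu , l , r) = record { a = u ; b = w ; c = z ; ab = uw ; bc = wz ; ca = zu ; left = l ; right = r
    ; J = TriMap.tri-jordan T uw bound uw wz zu }

  -- Contractibility in `P`: the common neighbours of the two ends are then the apexes of the two
  -- faces. Braces are treated separately.
  Free : Fin n → Fin n → Set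
  Free u w = A u w ≡ true × ¬ ∃ (Third u w)

  -- The non-facial 3-cycle passes through a vertex inside `X`, so one of its sides is nested in
  -- `X`, and strictly, because that vertex lies on its cycle. The first vertex is kept for the
  -- descent in `free-spoke`.
  third-within : ∀ X {u w} → In X u ⊎ In X w → ∃ (Third u w) →
    ∃ λ Z → Within Z X × size Z < size X × a Z ≡ u
  third-within X {u} {w} i (z , th) with d i
    where
    d : In X u ⊎ In X w → ∃ λ d → In X d × IsOn (cycle th) d
    d (inj₁ i) = u , i , inj₁ refl
    d (inj₂ i) = w , i , alt₂ refl
  ... | d , i′ , on with nested-side X (cycle th) i′ on
  ... | Z , same , within = Z , within , within-smaller {X} {Z} within i′ (λ j → off-not-on (proj₁ j) (same-on′ same on)) , first same
    where
    first : ∀ {Z Y} → SameCycle Z Y → a Z ≡ a Y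
    first (inj₁ refl) = refl
    first (inj₂ refl) = refl

  -- The edge from `a X` to an apex inside is free, or it lies on a non-facial 3-cycle with a
  -- smaller side inside `X` at the same vertex, and the search continues there.
  free-spoke : ∀ X → ∃ λ w → In X w × Free (a X) w
  free-spoke X = go X (<-wellFounded (size X))
    where
    go : ∀ X → Acc _<_ (size X) → ∃ λ w → In X w × Free (a X) w
    go X (acc rec) with third? (a X) (t (c X) (a X))
    ... | no ¬th = t (c X) (a X) , i , t-edge (ca X) , ¬th
      where i = rot-in X (rot-in (rot X) (apex-in (rot (rot X))))
    ... | yes th with third-within X (inj₂ (rot-in X (rot-in (rot X) (apex-in (rot (rot X)))))) th
    ...   | Z , within , smaller , refl = let w , i , f = go Z (rec smaller) in w , within i , f

  -- The form in which inclusion-minimality is used: by `third-within`, an edge at an inner vertex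
  -- that is not free would yield a smaller side.
  Minimal : Side → Set
  Minimal X = ∀ {d w} → In X d → A d w ≡ true → Free d w

  minimal-side : ∀ X → ∃ λ Z → Within Z X × Minimal Z
  minimal-side X = go X (<-wellFounded (size X))
    where
    go : ∀ X → Acc _<_ (size X) → ∃ λ Z → Within Z X × Minimal Z
    go X (acc rec) with Finₚ.any? (λ d → Finₚ.any? λ w → in? X d ×-dec third? d w)
    ... | no none = X , id , λ {d} {w} i dw → dw , λ th → none (d , w , i , th)
    ... | yes (d , w , i , th) with third-within X (inj₁ i) th
    ...   | Z , within , smaller , _ = let Z′ , within′ , min = go Z (rec smaller) in Z′ , within ∘ within′ , min

  free-apexes : ∀ {u w z} → Free u w → A w z ≡ true → A z u ≡ true → t u w ≡ z ⊎ t w u ≡ z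
  free-apexes {u} {w} {z} (uw , ¬th) wz zu with t u w Fin.≟ z | t w u Fin.≟ z
  ... | yes e | _ = inj₁ e
  ... | no _ | yes e = inj₂ e
  ... | no l | no r = ⊥-elim (¬th (z , uw , wz , zu , l , r))

  -- Both `a X` and `c X` are common neighbours of the ends of the free edge from `d` to `b X`,
  -- hence its two apexes. The opposite assignment would put `d` to the left of c → b, on the wrong
  -- side.
  free-apex : ∀ X {d} → In X d → A d (a X) ≡ true → Free d (b X) → A d (c X) ≡ true → t (a X) (b X) ≡ d
  free-apex X {d} i da free dc with free-apexes free (symm (ab X)) (symm da) | free-apexes free (bc X) (symm dc)
  ... | inj₂ e | _ = face-rot² (symm (proj₁ free)) e
  ... | inj₁ e | inj₁ e′ = contradiction (trans (sym e′) e) (edge⇒≢ (ca X))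
  ... | inj₁ e | inj₂ e′ = false≢true (proj₂ i) (trans (cong (side X) (sym cb≡d))
          (trans (side-apex X (symm (bc X)) (subst (IsOff X) (sym cb≡d) (proj₁ i))) (s-cb X)))
    where cb≡d = face-rot² (symm (proj₁ free)) e′

-- The five base triangulations

record TwoBraces {n} (B : Adj n) (x y p q : Fin n) : Set where
  field
    xy   : B x y ≡ true
    yx   : B y x ≡ true
    pq   : B p q ≡ true
    qp   : B q p ≡ true
    only : ∀ {u w} → B u w ≡ true → (u ≡ x × w ≡ y) ⊎ (u ≡ y × w ≡ x) ⊎ (u ≡ p × w ≡ q) ⊎ (u ≡ q × w ≡ p)

∈-braces : ∀ {n} {P : Fin n → Fin n → Set} {x y p q : Fin n} → P x y → P y x → P p q → P q p →
  ∀ {u w} → (u ≡ x × w ≡ y) ⊎ (u ≡ y × w ≡ x) ⊎ (u ≡ p × w ≡ q) ⊎ (u ≡ q × w ≡ p) → P u w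
∈-braces xy yx pq qp (inj₁ (refl , refl)) = xy
∈-braces xy yx pq qp (alt₂ (refl , refl)) = yx
∈-braces xy yx pq qp (alt₃ (refl , refl)) = pq
∈-braces xy yx pq qp (alt₄ (refl , refl)) = qp

mem-pair : ∀ {k} (x y : Fin k) es {i j : Fin k} → mem ((toℕ x , toℕ y) ∷ es) (toℕ i) (toℕ j) ≡ true →
  (i ≡ x × j ≡ y) ⊎ (i ≡ y × j ≡ x) ⊎ mem es (toℕ i) (toℕ j) ≡ true
mem-pair x y es {i} {j} e with ∨-true (((toℕ i ≡ᵇ toℕ x) ∧ (toℕ j ≡ᵇ toℕ y)) ∨ ((toℕ i ≡ᵇ toℕ y) ∧ (toℕ j ≡ᵇ toℕ x))) e
... | inj₂ m = inj₂ (inj₂ m)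
... | inj₁ m with ∨-true ((toℕ i ≡ᵇ toℕ x) ∧ (toℕ j ≡ᵇ toℕ y)) m
...   | inj₁ f = let g , h = ∧-true _ f in inj₁ (≡ᵇ⇒≡′ g , ≡ᵇ⇒≡′ h)
...   | inj₂ f = let g , h = ∧-true _ f in alt₂ (≡ᵇ⇒≡′ g , ≡ᵇ⇒≡′ h)

mem-here : ∀ {k} (x y : Fin k) es → mem ((toℕ x , toℕ y) ∷ es) (toℕ x) (toℕ y) ≡ true
mem-here x y es rewrite ≡ᵇ-refl x | ≡ᵇ-refl y = refl

mem-here′ : ∀ {k} (x y : Fin k) es → mem ((toℕ x , toℕ y) ∷ es) (toℕ y) (toℕ x) ≡ true
mem-here′ x y es rewrite ≡ᵇ-refl x | ≡ᵇ-refl y = cong (_∨ mem es (toℕ y) (toℕ x)) (∨-introʳ ((toℕ y ≡ᵇ toℕ x) ∧ (toℕ x ≡ᵇ toℕ y)) refl)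

FaceHolds : ∀ {k n} {A : Adj n} → Tri A → (Fin k → Fin n) → Fin k × Fin k × Fin k → Set
FaceHolds {A = A} T ν (i , j , l) = A (ν i) (ν j) ≡ true × Tri.t T (ν i) (ν j) ≡ ν l

Apart : ∀ {k n} → (Fin k → Fin n) → Fin k × Fin k → Set
Apart ν (i , j) = ν i ≢ ν j

-- The combinatorial conditions on a base triangulation are decided once by computation. A
-- realisation then has to supply only its oriented faces and the distinctness of the non-adjacent
-- pairs, since adjacent vertices are distinct anyway.
module Template {k} (R : Adj k) (faces : List (Fin k × Fin k × Fin k)) (nonedges : List (Fin k × Fin k)) where

  OnFace : Fin k → Fin k → Fin k → Set
  OnFace i j l = Any.Any (λ f → f ≡ (i , j , l) ⊎ f ≡ (j , l , i) ⊎ f ≡ (l , i , j)) faces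

  onFace? : ∀ i j l → Dec (OnFace i j l)
  onFace? i j l = Any.any? (λ f → (f ≟³ (i , j , l)) ⊎-dec (f ≟³ (j , l , i)) ⊎-dec (f ≟³ (l , i , j))) faces
    where
    _≟³_ : ∀ (f g : Fin k × Fin k × Fin k) → Dec (f ≡ g)
    _≟³_ = ≡-dec Fin._≟_ _≟²_

  Covered Neighboured Separated : Set
  Covered = ∀ i j → R i j ≡ true → ∃ λ l → R j l ≡ true × OnFace i j l
  Neighboured = ∀ i → ∃ λ j → R i j ≡ true
  Separated = ∀ i j → i ≡ j ⊎ R i j ≡ true ⊎ (i , j) ∈ nonedges ⊎ (j , i) ∈ nonedges

  covered? : Dec Covered
  covered? = Finₚ.all? λ i → Finₚ.all? λ j → (R i j Boolₚ.≟ true) →-dec (Finₚ.any? λ l → (R j l Boolₚ.≟ true) ×-dec onFace? i j l)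

  neighboured? : Dec Neighboured
  neighboured? = Finₚ.all? λ i → Finₚ.any? λ j → R i j Boolₚ.≟ true

  separated? : Dec Separated
  separated? = Finₚ.all? λ i → Finₚ.all? λ j → (i Fin.≟ j) ⊎-dec (R i j Boolₚ.≟ true)
    ⊎-dec Any.any? ((i , j) ≟²_) nonedges ⊎-dec Any.any? ((j , i) ≟²_) nonedges

  -- Vertices of a triangulation that realise all faces of the template exhaust it: they are closed under
  -- taking neighbours because the faces around each of them close up.
  module Realise (covered : Covered) (neighboured : Neighboured) (separated : Separated) (i₀ : Fin k)
    {n} {A : Adj n} (T : Tri A) (ν : Fin k → Fin n)
    (faces-hold : All (FaceHolds T ν) faces)
    (nonedges-hold : All (Apart ν) nonedges) where
    open TriProperties T

    face-holds : ∀ {i j l} → OnFace i j l → FaceHolds T ν (i , j , l)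
    face-holds {i} {j} {l} on = let h , e = All.lookupAny faces-hold on in by h e
      where
      by : ∀ {f} → FaceHolds T ν f → f ≡ (i , j , l) ⊎ f ≡ (j , l , i) ⊎ f ≡ (l , i , j) → FaceHolds T ν (i , j , l)
      by h (inj₁ refl) = h
      by (e , h) (alt₂ refl) = subst (λ z → A z (ν j) ≡ true) h (t-edge′ e) , trans (cong (λ z → t z (ν j)) (sym h)) (t-rot′ e)
      by (e , h) (inj₂ (inj₂ refl)) = subst (λ z → A (ν i) z ≡ true) h (t-edge e) , trans (cong (t (ν i)) (sym h)) (t-rot e)

    edge : ∀ {i j} → R i j ≡ true → A (ν i) (ν j) ≡ true
    edge {i} {j} e = let _ , _ , on = covered i j e in proj₁ (face-holds on)

    injective : ∀ {i j} → ν i ≡ ν j → i ≡ j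
    injective {i} {j} eq with separated i j
    ... | inj₁ i≡j = i≡j
    ... | alt₂ e = contradiction eq (edge⇒≢ (edge e))
    ... | alt₃ p = contradiction eq (All.lookup nonedges-hold p)
    ... | alt₄ p = contradiction (sym eq) (All.lookup nonedges-hold p)

    module _ (R-sym : ∀ i j → R i j ≡ R j i) where

      neighbours : ∀ i {w} → A (ν i) w ≡ true → ∃ λ j → R i j ≡ true × w ≡ ν j
      neighbours i = let j , e = neighboured i in link-induction T (λ w → ∃ λ j → R i j ≡ true × w ≡ ν j) (edge e) (j , e , refl)
        λ { _ (j , e , refl) → let l , e′ , on = covered j i (trans (R-sym j i) e) in l , e′ , proj₂ (face-holds on) }

      covers : ∀ v → ∃ λ i → ν i ≡ v
      covers v with ∈-tabulate⁻ (closed-covers connected (List.tabulate ν) (∈-tabulate⁺ i₀) closed v)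
        where
        closed : ∀ {v w} → v ∈ List.tabulate ν → A v w ≡ true → w ∈ List.tabulate ν
        closed v∈ vw with ∈-tabulate⁻ v∈
        ... | i , refl with neighbours i vw
        ...   | j , _ , refl = ∈-tabulate⁺ j
      ... | i , refl = i , refl

      isomorphism : ∀ {B : Adj n} (x y p q : Fin k) → TwoBraces B (ν x) (ν y) (ν p) (ν q) →
        Iso (braced k R (fromList ((toℕ x , toℕ y) ∷ (toℕ p , toℕ q) ∷ []))) (braced n A B)
      isomorphism {B} x y p q braces = ν , (λ v → proj₁ (covers v)) , (λ i → injective (proj₂ (covers (ν i)))) , (λ v → proj₂ (covers v))
        , (λ i j → bool-ext (λ e → case neighbours i e of λ { (j′ , e′ , eq) → trans (cong (R i) (injective eq)) e′ }) edge)
        , (λ i j → bool-ext (to i j) (from i j))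
        where
        open TwoBraces braces
        C : Adj k
        C = fromList ((toℕ x , toℕ y) ∷ (toℕ p , toℕ q) ∷ [])
        later : ∀ {i j} → mem ((toℕ p , toℕ q) ∷ []) (toℕ i) (toℕ j) ≡ true → C i j ≡ true
        later {i} {j} = ∨-introʳ (((toℕ i ≡ᵇ toℕ x) ∧ (toℕ j ≡ᵇ toℕ y)) ∨ ((toℕ i ≡ᵇ toℕ y) ∧ (toℕ j ≡ᵇ toℕ x)))
        to : ∀ i j → B (ν i) (ν j) ≡ true → C i j ≡ true
        to i j e = ∈-braces {P = λ u w → C u w ≡ true} (mem-here x y ((toℕ p , toℕ q) ∷ [])) (mem-here′ x y ((toℕ p , toℕ q) ∷ []))
            (later {p} {q} (mem-here p q [])) (later {q} {p} (mem-here′ p q [])) (pull (only e))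
          where
          pull : ∀ {i j} → (ν i ≡ ν x × ν j ≡ ν y) ⊎ (ν i ≡ ν y × ν j ≡ ν x) ⊎ (ν i ≡ ν p × ν j ≡ ν q) ⊎ (ν i ≡ ν q × ν j ≡ ν p) →
                 (i ≡ x × j ≡ y) ⊎ (i ≡ y × j ≡ x) ⊎ (i ≡ p × j ≡ q) ⊎ (i ≡ q × j ≡ p)
          pull (inj₁ (a , b)) = inj₁ (injective a , injective b)
          pull (alt₂ (a , b)) = alt₂ (injective a , injective b)
          pull (alt₃ (a , b)) = alt₃ (injective a , injective b)
          pull (alt₄ (a , b)) = alt₄ (injective a , injective b)
        from : ∀ i j → C i j ≡ true → B (ν i) (ν j) ≡ true
        from i j e with mem-pair x y ((toℕ p , toℕ q) ∷ []) {i} {j} e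
        ... | inj₁ (refl , refl) = xy
        ... | alt₂ (refl , refl) = yx
        ... | inj₂ (inj₂ e′) with mem-pair p q [] {i} {j} e′
        ...   | inj₁ (refl , refl) = pq
        ...   | alt₂ (refl , refl) = qp
        ...   | inj₂ (inj₂ ())

symmetric? : ∀ {k} (R : Adj k) → Dec (∀ i j → R i j ≡ R j i)
symmetric? R = Finₚ.all? λ i → Finₚ.all? λ j → R i j Boolₚ.≟ R j i

Realisation : ∀ {k} (R : Adj k) (faces : List (Fin k × Fin k × Fin k)) (nonedges : List (Fin k × Fin k))
  {n} {A : Adj n} (T : Tri A) (ν : Fin k → Fin n) → Set
Realisation R faces nonedges {A = A} T ν =
  All (FaceHolds T ν) faces × All (Apart ν) nonedges

realise : ∀ {k} (R : Adj (suc k)) faces nonedges → True (Template.covered? R faces nonedges) → True (Template.neighboured? R faces nonedges) →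
  True (Template.separated? R faces nonedges) → True (symmetric? R) →
  ∀ {n} {A : Adj n} (T : Tri A) ν → Realisation R faces nonedges T ν → ∀ {B : Adj n} x y p q → TwoBraces B (ν x) (ν y) (ν p) (ν q) →
  Iso (braced (suc k) R (fromList ((toℕ x , toℕ y) ∷ (toℕ p , toℕ q) ∷ []))) (braced n A B)
realise R faces nonedges c nbd sep symm T ν (h , h′) =
  Template.Realise.isomorphism R faces nonedges (toWitness c) (toWitness nbd) (toWitness sep) zero T ν h h′ (toWitness symm)

faces₁ faces₂ : List (Fin 6 × Fin 6 × Fin 6)
faces₁ = (0F , 2F , 1F) ∷ (1F , 2F , 3F) ∷ (3F , 2F , 4F) ∷ (4F , 2F , 0F) ∷ (1F , 5F , 0F) ∷ (0F , 5F , 4F) ∷ (4F , 5F , 3F) ∷ (3F , 5F , 1F) ∷ []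
faces₂ = (2F , 4F , 1F) ∷ (4F , 0F , 1F) ∷ (0F , 2F , 1F) ∷ (0F , 4F , 3F) ∷ (2F , 0F , 3F) ∷ (4F , 2F , 5F) ∷ (2F , 3F , 5F) ∷ (3F , 4F , 5F) ∷ []

faces₄ faces₅ faces₅′ : List (Fin 7 × Fin 7 × Fin 7)
faces₄ = (0F , 2F , 5F) ∷ (2F , 1F , 5F) ∷ (1F , 0F , 5F) ∷ (1F , 2F , 4F) ∷ (0F , 1F , 4F) ∷ (2F , 0F , 6F) ∷ (0F , 3F , 6F) ∷ (3F , 2F , 6F) ∷ (0F , 4F , 3F) ∷ (4F , 2F , 3F) ∷ []
faces₅ = (2F , 0F , 5F) ∷ (0F , 1F , 5F) ∷ (1F , 2F , 5F) ∷ (1F , 0F , 4F) ∷ (2F , 1F , 4F) ∷ (4F , 0F , 3F) ∷ (0F , 6F , 3F) ∷ (6F , 4F , 3F) ∷ (0F , 2F , 6F) ∷ (2F , 4F , 6F) ∷ []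
-- faces₅ with the opposite orientation
faces₅′ = (0F , 2F , 5F) ∷ (2F , 1F , 5F) ∷ (1F , 0F , 5F) ∷ (1F , 2F , 4F) ∷ (0F , 1F , 4F) ∷ (0F , 4F , 3F) ∷ (4F , 6F , 3F) ∷ (6F , 0F , 3F) ∷ (2F , 0F , 6F) ∷ (4F , 2F , 6F) ∷ []

nonedges₁ nonedges₂ : List (Fin 6 × Fin 6)
nonedges₁ = (0F , 3F) ∷ (1F , 4F) ∷ (2F , 5F) ∷ []
nonedges₂ = (1F , 3F) ∷ (1F , 5F) ∷ (0F , 5F) ∷ []

nonedges₄ nonedges₅ : List (Fin 7 × Fin 7)
nonedges₄ = (1F , 3F) ∷ (3F , 5F) ∷ (4F , 5F) ∷ (4F , 6F) ∷ (5F , 6F) ∷ (1F , 6F) ∷ []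
nonedges₅ = (1F , 3F) ∷ (1F , 6F) ∷ (2F , 3F) ∷ (3F , 5F) ∷ (4F , 5F) ∷ (5F , 6F) ∷ []

module _ {n} {A : Adj n} (T : Tri A) {B : Adj n} where

  realise₁ : ∀ ν → Realisation (fromList octaEdges) faces₁ nonedges₁ T ν → TwoBraces B (ν 0F) (ν 3F) (ν 1F) (ν 4F) → Iso baseI (braced n A B)
  realise₁ ν h = realise (fromList octaEdges) faces₁ nonedges₁ _ _ _ _ T ν h 0F 3F 1F 4F

  realise₂ : ∀ ν → Realisation (fromList P₂) faces₂ nonedges₂ T ν → TwoBraces B (ν 1F) (ν 3F) (ν 5F) (ν 0F) → Iso baseII (braced n A B)
  realise₂ ν h = realise (fromList P₂) faces₂ nonedges₂ _ _ _ _ T ν h 1F 3F 5F 0F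

  realise₃ : ∀ ν → Realisation (fromList P₂) faces₂ nonedges₂ T ν → TwoBraces B (ν 1F) (ν 3F) (ν 1F) (ν 5F) → Iso baseIII (braced n A B)
  realise₃ ν h = realise (fromList P₂) faces₂ nonedges₂ _ _ _ _ T ν h 1F 3F 1F 5F

  realise₄ : ∀ ν → Realisation (fromList P₄) faces₄ nonedges₄ T ν → TwoBraces B (ν 4F) (ν 5F) (ν 4F) (ν 6F) → Iso baseIV (braced n A B)
  realise₄ ν h = realise (fromList P₄) faces₄ nonedges₄ _ _ _ _ T ν h 4F 5F 4F 6F

  realise₅ : ∀ ν → Realisation (fromList P₅) faces₅ nonedges₅ T ν → TwoBraces B (ν 4F) (ν 5F) (ν 3F) (ν 2F) → Iso baseV (braced n A B)
  realise₅ ν h = realise (fromList P₅) faces₅ nonedges₅ _ _ _ _ T ν h 4F 5F 3F 2F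

  realise₅′ : ∀ ν → Realisation (fromList P₅) faces₅′ nonedges₅ T ν → TwoBraces B (ν 4F) (ν 5F) (ν 3F) (ν 2F) → Iso baseV (braced n A B)
  realise₅′ ν h = realise (fromList P₅) faces₅′ nonedges₅ _ _ _ _ T ν h 4F 5F 3F 2F

  covers₂ : ∀ ν → Realisation (fromList P₂) faces₂ nonedges₂ T ν → ∀ v → ∃ λ i → ν i ≡ v
  covers₂ ν (h , h′) = Template.Realise.covers R faces₂ nonedges₂ (toWitness {a? = Template.covered? R faces₂ nonedges₂} _)
    (toWitness {a? = Template.neighboured? R faces₂ nonedges₂} _) (toWitness {a? = Template.separated? R faces₂ nonedges₂} _) zero
    T ν h h′ (toWitness {a? = symmetric? R} _)
    where
    R : Adj 6
    R = fromList P₂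

-- Irreducible braced triangulations

module Endgame {n} {A : Adj n} (T : Tri A) (bound : numEdges A + 6 ≤ 3 * n) (3≤n : 3 ≤ n) (B : Adj n)
  (disjoint : ∀ {u w} → B u w ≡ true → A u w ≡ true → ⊥) where
  open Sides T bound 3≤n

  BraceTriangle : Fin n → Fin n → Set
  BraceTriangle u w = ∃ λ s → (B u s ≡ true × A w s ≡ true) ⊎ (B w s ≡ true × A u s ≡ true) ⊎ (B u s ≡ true × B w s ≡ true)

  record Cap (ξ a b c : Fin n) : Set where
    field
      eab : A a b ≡ true
      ebc : A b c ≡ true
      eca : A c a ≡ true
      tab : t a b ≡ ξ
      tbc : t b c ≡ ξ
      tca : t c a ≡ ξ

    ξa : A ξ a ≡ true
    ξa = subst (λ z → A z a ≡ true) tab (t-edge′ eab)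
    ξb : A ξ b ≡ true
    ξb = subst (λ z → A z b ≡ true) tbc (t-edge′ ebc)
    ξc : A ξ c ≡ true
    ξc = subst (λ z → A z c ≡ true) tca (t-edge′ eca)

    neighbours : ∀ {w} → A ξ w ≡ true → OnT a b c w
    neighbours = link-induction T (OnT a b c) ξa (inj₁ refl) λ
      { _ (inj₁ refl) → inj₂ (inj₂ (face-rot eca tca))
      ; _ (alt₂ refl) → inj₁ (face-rot eab tab)
      ; _ (inj₂ (inj₂ refl)) → alt₂ (face-rot ebc tbc) }

  open Cap using (neighbours; ξa; ξb; ξc)

  rotCap : ∀ {ξ a b c} → Cap ξ a b c → Cap ξ b c a
  rotCap C = record { eab = ebc ; ebc = eca ; eca = eab ; tab = tbc ; tbc = tca ; tca = tab }
    where open Cap C using (eab; ebc; eca; tab; tbc; tca)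

  complete-cap : ∀ {ξ a b c u w} → Cap ξ a b c → A ξ u ≡ true → A ξ w ≡ true → u ≢ w → ∃ λ e → Cap ξ u w e ⊎ Cap ξ w u e
  complete-cap C ξu ξw u≢w with neighbours C ξu | neighbours C ξw
  ... | inj₁ refl | inj₁ refl = contradiction refl u≢w
  ... | inj₁ refl | alt₂ refl = _ , inj₁ C
  ... | inj₁ refl | inj₂ (inj₂ refl) = _ , inj₂ (rotCap (rotCap C))
  ... | alt₂ refl | inj₁ refl = _ , inj₂ C
  ... | alt₂ refl | alt₂ refl = contradiction refl u≢w
  ... | alt₂ refl | inj₂ (inj₂ refl) = _ , inj₁ (rotCap C)
  ... | inj₂ (inj₂ refl) | inj₁ refl = _ , inj₁ (rotCap (rotCap C))
  ... | inj₂ (inj₂ refl) | alt₂ refl = _ , inj₂ (rotCap C)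
  ... | inj₂ (inj₂ refl) | inj₂ (inj₂ refl) = contradiction refl u≢w

  -- Once the three outer faces share the vertex `η`, the links of all five vertices close up, and
  -- connectedness does the rest.
  bipyramid-covers : ∀ {ξ η a b c} → Cap ξ a b c → t b a ≡ η → t c b ≡ η → t a c ≡ η → ∀ v → v ∈ ξ ∷ η ∷ a ∷ b ∷ c ∷ []
  bipyramid-covers {ξ} {η} {a} {b} {c} C tba tcb tac = closed-covers connected _ (here refl) closed
    where
    open Cap C using (eab; ebc; eca; tab; tbc; tca)
    ac = symm eca
    cb = symm ebc
    ba = symm eab
    D : Cap η b a c
    D = record { eab = ba ; ebc = ac ; eca = cb ; tab = tba ; tbc = tac ; tca = tcb }
    near : ∀ {x a b c y} → A a x ≡ true → t x a ≡ b → t b a ≡ c → t c a ≡ y → t y a ≡ x → ∀ {w} → A a w ≡ true → w ∈ x ∷ b ∷ c ∷ y ∷ []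
    near ax e₁ e₂ e₃ e₄ = link-induction T (_∈ _) ax (here refl) λ
      { _ (here refl) → here₁ e₁ ; _ (here₁ refl) → here₂ e₂
      ; _ (here₂ refl) → here₃ e₃ ; _ (here₃ refl) → here e₄ }
    pick : ∀ {a b c v} → OnT a b c v → v ∈ a ∷ b ∷ c ∷ []
    pick (inj₁ e) = here e
    pick (alt₂ e) = here₁ e
    pick (inj₂ (inj₂ e)) = here₂ e
    closed : ∀ {v w} → v ∈ ξ ∷ η ∷ a ∷ b ∷ c ∷ [] → A v w ≡ true → w ∈ ξ ∷ η ∷ a ∷ b ∷ c ∷ []
    closed (here refl) e = there (there (pick (neighbours C e)))
    closed (here₁ refl) e = there (there (pick (case neighbours D e of λ
      { (inj₁ p) → alt₂ p ; (alt₂ p) → inj₁ p ; (inj₂ (inj₂ p)) → inj₂ (inj₂ p) })))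
    closed (here₂ refl) e with near ac tca (face-rot² eab tab) tba (face-rot² ac tac) e
    ... | here p = here₄ p
    ... | here₁ p = here p
    ... | here₂ p = here₃ p
    ... | here₃ p = here₁ p
    closed (here₃ refl) e with near ba tab (face-rot² ebc tbc) tcb (face-rot² ba tba) e
    ... | here p = here₂ p
    ... | here₁ p = here p
    ... | here₂ p = here₄ p
    ... | here₃ p = here₁ p
    closed (here₄ refl) e with near cb tbc (face-rot² eca tca) tac (face-rot² cb tcb) e
    ... | here p = here₃ p
    ... | here₁ p = here p
    ... | here₂ p = here₂ p
    ... | here₃ p = here₁ p

  cap-of : ∀ X {d} → Minimal X → In X d → A d (a X) ≡ true → A d (b X) ≡ true → A d (c X) ≡ true → Cap d (a X) (b X) (c X)
  cap-of X min i da db dc = record { eab = ab X ; ebc = bc X ; eca = ca X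
    ; tab = free-apex X i da (min i db) dc
    ; tbc = free-apex (rot X) (in-rot X i) db (min i dc) da
    ; tca = free-apex (rot (rot X)) (in-rot (rot X) (in-rot X i)) dc (min i da) db }

  apex₁ apex₂ apex₃ : Side → Fin n
  apex₁ X = t (a X) (b X)
  apex₂ X = t (b X) (c X)
  apex₃ X = t (c X) (a X)

  apex₂-in : ∀ X → In X (apex₂ X)
  apex₂-in X = rot-in X (apex-in (rot X))

  apex₃-in : ∀ X → In X (apex₃ X)
  apex₃-in X = rot-in X (rot-in (rot X) (apex-in (rot (rot X))))

  equal-apexes : ∀ X → Minimal X → apex₁ X ≡ apex₂ X → Cap (apex₁ X) (a X) (b X) (c X)
  equal-apexes X min eq = cap-of X min (apex-in X) (t-edge′ (ab X)) (symm (t-edge (ab X)))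
    (subst (λ z → A z (c X) ≡ true) (sym eq) (symm (t-edge (bc X))))

  HasCap : Side → Set
  HasCap X = ∃ λ ξ → In X ξ × ∃ λ a → ∃ λ b → ∃ λ c → Cap ξ a b c

  rot-HasCap : ∀ X → HasCap (rot X) → HasCap X
  rot-HasCap X (ξ , i , C) = ξ , rot-in X i , C

  rot-Minimal : ∀ X → Minimal X → Minimal (rot X)
  rot-Minimal X min i = min (rot-in X i)

  capped : ∀ Z → Minimal Z → A (a Z) (apex₂ Z) ≡ true ⊎ A (c Z) (apex₁ Z) ≡ true → HasCap Z
  capped Z minZ (inj₁ e) = _ , apex₂-in Z , _ , _ , _ , cap-of Z minZ (apex₂-in Z) (symm e) (t-edge′ (bc Z)) (symm (t-edge (bc Z)))
  capped Z minZ (inj₂ e) = _ , apex-in Z , _ , _ , _ , cap-of Z minZ (apex-in Z) (t-edge′ (ab Z)) (symm (t-edge (ab Z))) (symm e)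

  -- It remains to exclude three distinct apexes; two of them then form a brace, say the first two after rotation.
  minimal-cap : ∀ X → Minimal X →
    (∀ Z → Minimal Z → Within Z X → apex₁ Z ≢ apex₂ Z → apex₂ Z ≢ apex₃ Z → apex₃ Z ≢ apex₁ Z →
       B (apex₁ Z) (apex₂ Z) ≡ true → A (a Z) (apex₂ Z) ≡ true ⊎ A (c Z) (apex₁ Z) ≡ true) →
    (apex₁ X ≢ apex₂ X → apex₂ X ≢ apex₃ X → apex₃ X ≢ apex₁ X →
       B (apex₁ X) (apex₂ X) ≡ true ⊎ B (apex₂ X) (apex₃ X) ≡ true ⊎ B (apex₃ X) (apex₁ X) ≡ true) → HasCap X
  minimal-cap X min close pair with apex₁ X Fin.≟ apex₂ X | apex₂ X Fin.≟ apex₃ X | apex₃ X Fin.≟ apex₁ X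
  ... | yes eq | _ | _ = _ , apex-in X , _ , _ , _ , equal-apexes X min eq
  ... | no _ | yes eq | _ = rot-HasCap X (_ , apex-in (rot X) , _ , _ , _ , equal-apexes (rot X) (rot-Minimal X min) eq)
  ... | no _ | no _ | yes eq = rot-HasCap X (rot-HasCap (rot X) (_ , apex-in (rot (rot X)) , _ , _ , _ ,
          equal-apexes (rot (rot X)) (rot-Minimal (rot X) (rot-Minimal X min)) eq))
  ... | no ne₁ | no ne₂ | no ne₃ with pair ne₁ ne₂ ne₃
  ... | inj₁ β = capped X min (close X min id ne₁ ne₂ ne₃ β)
  ... | alt₂ β = rot-HasCap X (capped (rot X) min₁ (close (rot X) min₁ (rot-in X) ne₂ ne₃ ne₁ β))
    where min₁ = rot-Minimal X min
  ... | inj₂ (inj₂ β) = rot-HasCap X (rot-HasCap (rot X) (capped (rot (rot X)) min₂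
          (close (rot (rot X)) min₂ (λ i → rot-in X (rot-in (rot X) i)) ne₃ ne₁ ne₂ β)))
    where min₂ = rot-Minimal (rot X) (rot-Minimal X min)

  -- Either `e` lies on the cycle `uwz`, or a path whose later vertices avoid the cycle joins it to
  -- `ξ`. In neither case can `e` belong to a side that misses `ξ`.
  data Away (u w z ξ : Fin n) : Fin n → Set where
    on    : ∀ {e} → OnT u w z e → Away u w z ξ e
    stays : Away u w z ξ ξ
    via   : ∀ {e f} → A e f ≡ true → Off u w z f → Away u w z ξ f → Away u w z ξ e

  -- If no brace end can be separated from ξ by the 3-cycle uwz, the side of it not containing ξ has no cap, so uwz is a face.
  facial : (ends : List (Fin n)) → (∀ X → ∃ λ e → In X e × e ∈ ends) → ∀ {u w z ξ} → A u w ≡ true → A w z ≡ true → A z u ≡ true →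
    t w u ≢ z → Off u w z ξ → All (Away u w z ξ) ends → t u w ≡ z
  facial ends capIn {u} {w} {z} {ξ} uw wz zu r off away with t u w Fin.≟ z
  ... | yes eq = eq
  ... | no l with avoid (cycle (uw , wz , zu , l , r)) off
  ...   | W , same , ¬iξ with capIn W
  ...     | e , ie , e∈ = ⊥-elim (¬iξ (escape (All.lookup away e∈) ie))
    where
    escape : ∀ {e} → Away u w z ξ e → In W e → In W ξ
    escape (on o) i = ⊥-elim (off-not-on (proj₁ i) (same-on′ same o))
    escape stays i = i
    escape (via ef off′ aw) i with in-adjacent W i ef
    ... | inj₁ j = escape aw j
    ... | inj₂ o = ⊥-elim (off-not-on off′ (same-on same o))

module _ {n} {B : Adj n} {x y p q : Fin n} (tb : TwoBraces B x y p q) where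
  open TwoBraces tb

  swapFirst : TwoBraces B y x p q
  swapFirst = record { xy = yx ; yx = xy ; pq = pq ; qp = qp ; only = λ e → case only e of λ
    { (inj₁ h) → alt₂ h ; (alt₂ h) → inj₁ h ; (inj₂ (inj₂ h)) → inj₂ (inj₂ h) } }

  swapSecond : TwoBraces B x y q p
  swapSecond = record { xy = xy ; yx = yx ; pq = qp ; qp = pq ; only = λ e → case only e of λ
    { (inj₁ h) → inj₁ h ; (alt₂ h) → alt₂ h ; (alt₃ h) → alt₄ h ; (alt₄ h) → alt₃ h } }

  swapPairs : TwoBraces B p q x y
  swapPairs = record { xy = pq ; yx = qp ; pq = xy ; qp = yx ; only = λ e → case only e of λ
    { (inj₁ h) → alt₃ h ; (alt₂ h) → alt₄ h ; (alt₃ h) → inj₁ h ; (alt₄ h) → alt₂ h } }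

module Irreducible {n} {A : Adj n} (T : Tri A) (bound : numEdges A + 6 ≤ 3 * n) (3≤n : 3 ≤ n) (B : Adj n)
  (disjoint : ∀ {u w} → B u w ≡ true → A u w ≡ true → ⊥)
  (irreducible : ∀ {u w} → Sides.Free T bound 3≤n u w → Endgame.BraceTriangle T bound 3≤n B disjoint u w) where
  open Sides T bound 3≤n
  open Endgame T bound 3≤n B disjoint
  open Cap using (neighbours; ξa; ξb; ξc)

  IsBase : Set
  IsBase = ∃ λ i → Iso (base i) (braced n A B)

  End : Fin n → Set
  End e = ∃ λ s → B e s ≡ true

  -- What the classification around a cap needs to know about all sides. It is established
  -- separately for disjoint braces and for braces with a common end.
  CapIn : Set
  CapIn = ∀ X → ∃ λ e → In X e × End e × ∃ λ a → ∃ λ b → ∃ λ c → Cap e a b c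

  ¬self : ∀ {u} → A u u ≡ true → ⊥
  ¬self e = edge⇒≢ e refl

  cap-free-first : ∀ {ξ a b c} → Cap ξ a b c → Free ξ a
  cap-free-first {ξ} {a} {b} {c} C = ξa C , λ { (z , _ , az , zξ , l , r) → case neighbours C (symm zξ) of λ
    { (inj₁ refl) → ¬self az
    ; (alt₂ refl) → l (face-rot² (Cap.eab C) (Cap.tab C))
    ; (inj₂ (inj₂ refl)) → r (face-rot (Cap.eca C) (Cap.tca C)) } }

  cap-free : ∀ {ξ a b c w} → Cap ξ a b c → A ξ w ≡ true → Free ξ w
  cap-free C e with neighbours C e
  ... | inj₁ refl = cap-free-first C
  ... | alt₂ refl = cap-free-first (rotCap C)
  ... | inj₂ (inj₂ refl) = cap-free-first (rotCap (rotCap C))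

  cap-adjacent : ∀ {ξ a b c u w} → Cap ξ a b c → A ξ u ≡ true → A ξ w ≡ true → u ≡ w ⊎ A u w ≡ true
  cap-adjacent C ξu ξw with neighbours C ξu | neighbours C ξw
  ... | inj₁ refl | inj₁ refl = inj₁ refl
  ... | inj₁ refl | alt₂ refl = inj₂ (Cap.eab C)
  ... | inj₁ refl | inj₂ (inj₂ refl) = inj₂ (symm (Cap.eca C))
  ... | alt₂ refl | inj₁ refl = inj₂ (symm (Cap.eab C))
  ... | alt₂ refl | alt₂ refl = inj₁ refl
  ... | alt₂ refl | inj₂ (inj₂ refl) = inj₂ (Cap.ebc C)
  ... | inj₂ (inj₂ refl) | inj₁ refl = inj₂ (Cap.eca C)
  ... | inj₂ (inj₂ refl) | alt₂ refl = inj₂ (symm (Cap.ebc C))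
  ... | inj₂ (inj₂ refl) | inj₂ (inj₂ refl) = inj₁ refl

  spoke-at : ∀ X {v} → IsOn X v → ∃ λ w → In X w × Free v w
  spoke-at X (inj₁ refl) = free-spoke X
  spoke-at X (alt₂ refl) = let w , i , f = free-spoke (rot X) in w , rot-in X i , f
  spoke-at X (inj₂ (inj₂ refl)) = let w , i , f = free-spoke (rot (rot X)) in w , rot-in X (rot-in (rot X) i) , f

  -- ξ has degree three with neighbours a, b, c, all adjacent to the other end η of its brace.
  -- Here q = η is allowed: the braces then share the vertex η.
  module Config {ξ η p q : Fin n} (tb : TwoBraces B ξ η p q) (ξ≢η : ξ ≢ η) (p≢q : p ≢ q) (p≢ξ : p ≢ ξ) (p≢η : p ≢ η) (q≢ξ : q ≢ ξ)
                (capIn : CapIn) where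

    record Hub (a b c : Fin n) : Set where
      constructor hub
      field
        C  : Cap ξ a b c
        aη : A a η ≡ true
        bη : A b η ≡ true
        cη : A c η ≡ true

    rotHub : ∀ {a b c} → Hub a b c → Hub b c a
    rotHub (hub C aη bη cη) = hub (rotCap C) bη cη aη

    record Region (a b c : Fin n) : Set where
      field
        Z     : Side
        first : Side.a Z ≡ b
        on-Z  : ∀ {v} → OnT b a η v → IsOn Z v
        Z-on  : ∀ {v} → IsOn Z v → OnT b a η v
        ¬ξ    : ¬ In Z ξ
        ¬c    : ¬ In Z c
        ζ κ   : Fin n
        iζ    : In Z ζ
        tbζ   : TwoBraces B ξ η ζ κ
        ζ≢κ   : ζ ≢ κ
        κ≢ξ   : κ ≢ ξ
        {a′ b′ c′} : Fin n
        Cζ    : Cap ζ a′ b′ c′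

    opaque
      -- The side of `b a η` away from `ξ` contains a cap by `capIn`. It is an end of the second
      -- brace, here written `ζ` and `κ`, because `ξ` is outside and `η` lies on the cycle. Also `c`
      -- is outside, being adjacent to `ξ`.
      region : ∀ {a b c} → Hub a b c → t b a ≢ η → Region a b c
      region {a} {b} {c} (hub C aη bη cη) ne = build (avoid X₀ offξ)
        where
        X₀ : Side
        X₀ = cycle (symm (Cap.eab C) , aη , symm bη , ne , λ e → ξ≢η (trans (sym (Cap.tab C)) e))
        offξ : IsOff X₀ ξ
        offξ = edge⇒≢ (ξb C) , edge⇒≢ (ξa C) , ξ≢η
        build : (∃ λ Z → SameCycle Z X₀ × ¬ In Z ξ) → Region a b c
        build (Z , same , ¬ξ) with capIn Z
        ... | e , ie , (s , β) , _ , _ , _ , Ce = by (TwoBraces.only tb β)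
          where
          make : ∀ {κ} → TwoBraces B ξ η e κ → e ≢ κ → κ ≢ ξ → Region a b c
          make tbζ e≢κ κ≢ξ = record { Z = Z ; first = first′ same ; on-Z = same-on′ same ; Z-on = same-on same ; ¬ξ = ¬ξ
            ; ¬c = λ i → case in-adjacent Z i (symm (ξc C)) of λ
                { (inj₁ j) → ¬ξ j ; (inj₂ o) → off-not-on offξ (same-on same o) }
            ; iζ = ie ; tbζ = tbζ ; ζ≢κ = e≢κ ; κ≢ξ = κ≢ξ ; Cζ = Ce }
            where
            first′ : SameCycle Z X₀ → Side.a Z ≡ b
            first′ (inj₁ refl) = refl
            first′ (inj₂ refl) = refl
          by : (e ≡ ξ × s ≡ η) ⊎ (e ≡ η × s ≡ ξ) ⊎ (e ≡ p × s ≡ q) ⊎ (e ≡ q × s ≡ p) → Region a b c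
          by (inj₁ (refl , _)) = ⊥-elim (¬ξ ie)
          by (alt₂ (refl , _)) = ⊥-elim (off-not-on (proj₁ ie) (same-on′ same (inj₂ (inj₂ refl))))
          by (alt₃ (refl , _)) = make tb p≢q q≢ξ
          by (alt₄ (refl , _)) = make (swapSecond tb) (≢-sym p≢q) p≢ξ

    module InRegion {a b c} (H : Hub a b c) (R : Region a b c) where
      open Hub H public
      open Region R public

      ¬on : ∀ {v} → OnT b a η v → ¬ In Z v
      ¬on o i = off-not-on (proj₁ i) (on-Z o)

      ¬abc : ∀ {v} → OnT a b c v → ¬ In Z v
      ¬abc (inj₁ e) = ¬on (alt₂ e)
      ¬abc (alt₂ e) = ¬on (inj₁ e)
      ¬abc (inj₂ (inj₂ refl)) = ¬c

      ¬ξ-near : ∀ {w} → In Z w → A ξ w ≡ true → ⊥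
      ¬ξ-near i e = ¬abc (neighbours C e) i

      ζ≢ξ : ζ ≢ ξ
      ζ≢ξ refl = ¬ξ iζ

      ζ≢η : ζ ≢ η
      ζ≢η e = ¬on (inj₂ (inj₂ e)) iζ

      ¬ζξ : A ζ ξ ≡ true → ⊥
      ¬ζξ e = ¬ξ-near iζ (symm e)

      ¬ζκ : A ζ κ ≡ true → ⊥
      ¬ζκ = disjoint (TwoBraces.pq tbζ)

      -- Edges at a cap are free, so each lies in a triangle with a brace. Such a triangle cannot
      -- contain `ξ`, which has no neighbour inside the region and is not adjacent to `ζ`; the brace
      -- is therefore the one from `ζ` to `κ`.
      near-κ : ∀ {w} → A ζ w ≡ true → A w κ ≡ true
      near-κ {w} ζw with irreducible (cap-free Cζ ζw)
      ... | s , inj₁ (β , ws) = case TwoBraces.only tbζ β of λ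
        { (inj₁ (e , _)) → ⊥-elim (ζ≢ξ e) ; (alt₂ (e , _)) → ⊥-elim (ζ≢η e)
        ; (alt₃ (_ , refl)) → ws ; (alt₄ (e , _)) → ⊥-elim (ζ≢κ e) }
      ... | s , alt₂ (β , ζs) = case TwoBraces.only tbζ β of λ
        { (inj₁ (refl , _)) → ⊥-elim (¬ζξ ζw) ; (alt₂ (_ , refl)) → ⊥-elim (¬ζξ ζs)
        ; (alt₃ (refl , _)) → ⊥-elim (¬self ζw) ; (alt₄ (refl , _)) → ⊥-elim (¬ζκ ζw) }
      ... | s , inj₂ (inj₂ (β , γ)) = case TwoBraces.only tbζ β of λ
        { (inj₁ (e , _)) → ⊥-elim (ζ≢ξ e) ; (alt₂ (e , _)) → ⊥-elim (ζ≢η e)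
        ; (alt₃ (_ , refl)) → case TwoBraces.only tbζ γ of λ
            { (inj₁ (refl , _)) → ⊥-elim (¬ζξ ζw) ; (alt₂ (_ , e)) → ⊥-elim (κ≢ξ e)
            ; (alt₃ (refl , _)) → ⊥-elim (¬self ζw) ; (alt₄ (refl , _)) → ⊥-elim (¬ζκ ζw) }
        ; (alt₄ (e , _)) → ⊥-elim (ζ≢κ e) }

      -- A contractible edge of P leading from the 3-cycle into the region must meet the brace ζκ.
      on-region : ∀ {v} → OnT b a η v → A ζ v ≡ true ⊎ v ≡ κ
      on-region {v} o with spoke-at Z (on-Z o)
      ... | w , iw , free = by (irreducible free)
        where
        v≢ξ : v ≢ ξ
        v≢ξ refl = case o of λ { (inj₁ e) → edge⇒≢ (ξb C) e ; (alt₂ e) → edge⇒≢ (ξa C) e ; (inj₂ (inj₂ e)) → ξ≢η e }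
        by : BraceTriangle v w → A ζ v ≡ true ⊎ v ≡ κ
        by (s , inj₁ (β , ws)) with TwoBraces.only tbζ β
        ... | inj₁ (e , _) = ⊥-elim (v≢ξ e)
        ... | alt₂ (_ , refl) = ⊥-elim (¬ξ-near iw (symm ws))
        ... | alt₃ (refl , _) = ⊥-elim (¬on o iζ)
        ... | alt₄ (e , _) = inj₂ e
        by (s , alt₂ (β , vs)) with TwoBraces.only tbζ β
        ... | inj₁ (refl , _) = ⊥-elim (¬ξ iw)
        ... | alt₂ (refl , _) = ⊥-elim (¬on (inj₂ (inj₂ refl)) iw)
        ... | alt₃ (refl , _) = inj₁ (symm (proj₁ free))
        ... | alt₄ (_ , refl) = inj₁ (symm vs)
        by (s , inj₂ (inj₂ (β , γ))) with TwoBraces.only tbζ β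
        ... | inj₁ (e , _) = ⊥-elim (v≢ξ e)
        ... | alt₃ (refl , _) = ⊥-elim (¬on o iζ)
        ... | alt₄ (e , _) = inj₂ e
        ... | alt₂ (_ , refl) with TwoBraces.only tbζ γ
        ...   | inj₁ (refl , _) = ⊥-elim (¬ξ iw)
        ...   | alt₂ (refl , _) = ⊥-elim (¬on (inj₂ (inj₂ refl)) iw)
        ...   | alt₃ (_ , e) = ⊥-elim (κ≢ξ (sym e))
        ...   | alt₄ (_ , e) = ⊥-elim (ζ≢ξ (sym e))

      off-c : IsOff Z c
      off-c with off? (Side.a Z) (Side.b Z) (Side.c Z) c
      ... | inj₁ o = o
      ... | inj₂ o = case Z-on o of λ { (inj₁ refl) → ⊥-elim (¬self (Cap.ebc C)) ; (alt₂ refl) → ⊥-elim (¬self (Cap.eca C)) ; (inj₂ (inj₂ refl)) → ⊥-elim (¬self cη) }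

      ¬ζc : A ζ c ≡ true → ⊥
      ¬ζc e with in-adjacent Z iζ e
      ... | inj₁ i = ¬c i
      ... | inj₂ o = off-not-on off-c o

      capIn′ : ∀ X → ∃ λ e → In X e × e ∈ ξ ∷ η ∷ ζ ∷ κ ∷ []
      capIn′ X with capIn X
      ... | e , i , (s , β) , _ = e , i , (case TwoBraces.only tbζ β of λ
        { (inj₁ (eq , _)) → here eq ; (alt₂ (eq , _)) → here₁ eq
        ; (alt₃ (eq , _)) → here₂ eq ; (alt₄ (eq , _)) → here₃ eq })

      module OneRegion (tcb : t c b ≡ η) (tac : t a c ≡ η) where
        open Cap C using (eab; ebc; eca; tab; tbc; tca)

        private
          eba = symm eab
          ecb = symm ebc
          eac = symm eca
          ηa = symm aη
          ηb = symm bη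
          ηc = symm cη

        tbη : t b η ≡ c
        tbη = face-rot ecb tcb
        tηa : t η a ≡ c
        tηa = face-rot² eac tac

        b≢ζ : b ≢ ζ
        b≢ζ e = ¬on (inj₁ refl) (subst (In Z) (sym e) iζ)
        a≢ζ : a ≢ ζ
        a≢ζ e = ¬on (alt₂ refl) (subst (In Z) (sym e) iζ)
        c≢ζ : c ≢ ζ
        c≢ζ e = ¬c (subst (In Z) (sym e) iζ)

        ζ-neighbour≢c : ∀ {e} → A ζ e ≡ true → c ≢ e
        ζ-neighbour≢c ζe refl = ¬ζc ζe
        ζ-neighbour≢ξ : ∀ {e} → A ζ e ≡ true → ξ ≢ e
        ζ-neighbour≢ξ ζe refl = ¬ζξ ζe

        ¬tab : ∀ {e} → ¬ Cap ζ a b e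
        ¬tab D = ζ≢ξ (trans (sym (Cap.tab D)) tab)

        closes : ∀ {u w z} → A u w ≡ true → A w z ≡ true → A z u ≡ true → t w u ≢ z → Off u w z ξ →
          Away u w z ξ η → Away u w z ξ ζ → Away u w z ξ κ → t u w ≡ z
        closes uw wz zu r off awη awζ awκ = facial _ capIn′ uw wz zu r off (stays ∷ awη ∷ awζ ∷ awκ ∷ [])

        ξ-off-bae : ∀ {e} → A ζ e ≡ true → Off b a e ξ
        ξ-off-bae ζe = edge⇒≢ (ξb C) , edge⇒≢ (ξa C) , ζ-neighbour≢ξ ζe

        ξ-off-aηe : ∀ {e} → A ζ e ≡ true → Off a η e ξ
        ξ-off-aηe ζe = edge⇒≢ (ξa C) , ξ≢η , ζ-neighbour≢ξ ζe

        ξ-off-ηbe : ∀ {e} → A ζ e ≡ true → Off η b e ξ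
        ξ-off-ηbe ζe = ξ≢η , edge⇒≢ (ξb C) , ζ-neighbour≢ξ ζe

        via-c : ∀ {e} → A ζ e ≡ true → Away b a e ξ η
        via-c ζe = via ηc (≢-sym (edge⇒≢ ebc) , edge⇒≢ eca , ζ-neighbour≢c ζe) (via (symm (ξc C)) (ξ-off-bae ζe) stays)

        via-b : ∀ {e} → A ζ b ≡ true → A ζ e ≡ true → b ≢ e → Away a η e ξ ζ
        via-b ζb ζe b≢e = via ζb (edge⇒≢ eba , edge⇒≢ bη , b≢e) (via (symm (ξb C)) (ξ-off-aηe ζe) stays)

        via-a : ∀ {e} → A ζ a ≡ true → A ζ e ≡ true → a ≢ e → Away η b e ξ ζ
        via-a ζa ζe a≢e = via ζa (edge⇒≢ aη , edge⇒≢ eab , a≢e) (via (symm (ξa C)) (ξ-off-ηbe ζe) stays)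

        -- The neighbours of `ζ` are `b`, `a`, `η`, so six vertices exhaust the graph. Among them
        -- `κ` is neither `ξ` nor `ζ` nor a neighbour of `ζ`, which leaves `c`.
        caseII : A ζ η ≡ true → A ζ a ≡ true → A ζ b ≡ true → IsBase
        caseII ζη ζa ζb with complete-cap Cζ ζb ζa (edge⇒≢ eba)
        ... | _ , inj₂ D = ⊥-elim (¬tab D)
        ... | e , inj₁ D with neighbours D ζη
        ...   | inj₁ refl = ⊥-elim (¬self bη)
        ...   | alt₂ refl = ⊥-elim (¬self aη)
        ...   | inj₂ (inj₂ refl) = suc zero , realise₂ T ν real (subst (TwoBraces B ξ η ζ) (κ≡c (covers₂ T {B} ν real κ)) tbζ)
          where
          ν : Fin 6 → Fin n
          ν = lookup (c ∷ ξ ∷ a ∷ η ∷ b ∷ ζ ∷ [])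
          real = ((eab , tab) ∷ (ebc , tbc) ∷ (eca , tca) ∷ (ecb , tcb) ∷ (eac , tac) ∷ (eba , Cap.tab D) ∷ (aη , Cap.tbc D) ∷ (ηb , Cap.tca D) ∷ [])
               , (ξ≢η ∷ ≢-sym ζ≢ξ ∷ c≢ζ ∷ [])
          κ≡c : (∃ λ i → ν i ≡ κ) → κ ≡ c
          κ≡c (0F , e) = sym e
          κ≡c (1F , e) = ⊥-elim (κ≢ξ (sym e))
          κ≡c (2F , refl) = ⊥-elim (¬ζκ ζa)
          κ≡c (3F , refl) = ⊥-elim (¬ζκ ζη)
          κ≡c (4F , refl) = ⊥-elim (¬ζκ ζb)
          κ≡c (5F , e) = ⊥-elim (ζ≢κ e)

        -- The third neighbour `e` of `ζ` is adjacent to `κ`, that is, to `a`. The 3-cycles `b a e`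
        -- and `a η e` separate no brace end from `ξ`, so they are faces, and the triangulation is
        -- complete.
        caseV : A ζ η ≡ true → A ζ b ≡ true → a ≡ κ → IsBase
        caseV ζη ζb a≡κ with complete-cap Cζ ζη ζb (edge⇒≢ ηb)
        ... | _ , inj₂ D = ⊥-elim (c≢ζ (trans (sym tbη) (Cap.tab D)))
        ... | e , inj₁ D = 4F , realise₅ T (lookup (b ∷ c ∷ a ∷ ζ ∷ η ∷ ξ ∷ e ∷ []))
              ( ((eab , tab) ∷ (ebc , tbc) ∷ (eca , tca) ∷ (ecb , tcb) ∷ (eac , tac)
                 ∷ (ηb , Cap.tab D) ∷ (Cap.ebc D , Cap.tbc D) ∷ (Cap.eca D , Cap.tca D) ∷ (eba , tba) ∷ (aη , taη) ∷ [])
              , (c≢ζ ∷ ζ-neighbour≢c ζe ∷ a≢ζ ∷ ζ≢ξ ∷ ≢-sym ξ≢η ∷ ζ-neighbour≢ξ ζe ∷ []))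
              (swapFirst (subst (TwoBraces B ξ η ζ) (sym a≡κ) tbζ))
          where
          ζe = ξc D
          ea : A e a ≡ true
          ea = subst (λ z → A e z ≡ true) (sym a≡κ) (near-κ ζe)
          tba : t b a ≡ e
          tba = closes eba (symm ea) (symm (Cap.ebc D)) (λ eq → ζ-neighbour≢ξ ζe (trans (sym tab) eq)) (ξ-off-bae ζe)
            (via-c ζe) (via ζη (edge⇒≢ ηb , edge⇒≢ ηa , ≢-sym (edge⇒≢ (Cap.eca D))) (via-c ζe)) (on (alt₂ (sym a≡κ)))
          taη : t a η ≡ e
          taη = closes aη (symm (Cap.eca D)) ea (λ eq → ζ-neighbour≢c ζe (trans (sym tηa) eq)) (ξ-off-aηe ζe)
            (on (alt₂ refl)) (via-b ζb ζe (edge⇒≢ (Cap.ebc D))) (on (inj₁ (sym a≡κ)))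

        -- The mirror image of `caseV`, with `a` and `b` exchanged; this is where the reversed face
        -- list is needed.
        caseV′ : A ζ η ≡ true → A ζ a ≡ true → b ≡ κ → IsBase
        caseV′ ζη ζa b≡κ with complete-cap Cζ ζa ζη (edge⇒≢ aη)
        ... | _ , inj₂ D = ⊥-elim (c≢ζ (trans (sym tηa) (Cap.tab D)))
        ... | e , inj₁ D = 4F , realise₅′ T (lookup (a ∷ c ∷ b ∷ ζ ∷ η ∷ ξ ∷ e ∷ []))
              ( ((eab , tab) ∷ (ebc , tbc) ∷ (eca , tca) ∷ (ecb , tcb) ∷ (eac , tac)
                 ∷ (aη , Cap.tab D) ∷ (Cap.ebc D , Cap.tbc D) ∷ (Cap.eca D , Cap.tca D) ∷ (eba , tba) ∷ (ηb , tηb) ∷ [])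
              , (c≢ζ ∷ ζ-neighbour≢c ζe ∷ b≢ζ ∷ ζ≢ξ ∷ ≢-sym ξ≢η ∷ ζ-neighbour≢ξ ζe ∷ []))
              (swapFirst (subst (TwoBraces B ξ η ζ) (sym b≡κ) tbζ))
          where
          ζe = ξc D
          eb : A e b ≡ true
          eb = subst (λ z → A e z ≡ true) (sym b≡κ) (near-κ ζe)
          tba : t b a ≡ e
          tba = closes eba (symm (Cap.eca D)) eb (λ eq → ζ-neighbour≢ξ ζe (trans (sym tab) eq)) (ξ-off-bae ζe)
            (via-c ζe) (via ζη (edge⇒≢ ηb , edge⇒≢ ηa , edge⇒≢ (Cap.ebc D)) (via-c ζe)) (on (inj₁ (sym b≡κ)))
          tηb : t η b ≡ e
          tηb = closes ηb (symm eb) (symm (Cap.ebc D)) (λ eq → ζ-neighbour≢c ζe (trans (sym tbη) eq)) (ξ-off-ηbe ζe)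
            (on (inj₁ refl)) (via-a ζa ζe (≢-sym (edge⇒≢ (Cap.eca D)))) (on (alt₂ (sym b≡κ)))

        -- Now the braces share the end `η`. The third neighbour `e` of `ζ` is adjacent to `η` by
        -- `near-κ`, and the 3-cycles `a η e` and `η b e` are faces because they separate no brace
        -- end from `ξ`.
        caseIV : A ζ a ≡ true → A ζ b ≡ true → η ≡ κ → IsBase
        caseIV ζa ζb η≡κ with complete-cap Cζ ζb ζa (edge⇒≢ eba)
        ... | _ , inj₂ D = ⊥-elim (¬tab D)
        ... | e , inj₁ D = 3F , realise₄ T (lookup (a ∷ c ∷ b ∷ e ∷ η ∷ ξ ∷ ζ ∷ []))
              ( ((eab , tab) ∷ (ebc , tbc) ∷ (eca , tca) ∷ (ecb , tcb) ∷ (eac , tac)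
                 ∷ (eba , Cap.tab D) ∷ (Cap.ebc D , Cap.tbc D) ∷ (Cap.eca D , Cap.tca D) ∷ (aη , taη) ∷ (ηb , tηb) ∷ [])
              , (ζ-neighbour≢c ζe ∷ ≢-sym (ζ-neighbour≢ξ ζe) ∷ ≢-sym ξ≢η ∷ ≢-sym ζ≢η ∷ ≢-sym ζ≢ξ ∷ c≢ζ ∷ []))
              (swapFirst (swapSecond (subst (TwoBraces B ξ η ζ) (sym η≡κ) tbζ)))
          where
          ζe = ξc D
          eη : A e η ≡ true
          eη = subst (λ z → A e z ≡ true) (sym η≡κ) (near-κ ζe)
          taη : t a η ≡ e
          taη = closes aη (symm eη) (symm (Cap.ebc D)) (λ eq → ζ-neighbour≢c ζe (trans (sym tηa) eq)) (ξ-off-aηe ζe)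
            (on (alt₂ refl)) (via-b ζb ζe (≢-sym (edge⇒≢ (Cap.eca D)))) (on (alt₂ (sym η≡κ)))
          tηb : t η b ≡ e
          tηb = closes ηb (symm (Cap.eca D)) eη (λ eq → ζ-neighbour≢c ζe (trans (sym tbη) eq)) (ξ-off-ηbe ζe)
            (on (inj₁ refl)) (via-a ζa ζe (edge⇒≢ (Cap.ebc D))) (on (inj₁ (sym η≡κ)))

        result : IsBase
        result with on-region (inj₂ (inj₂ refl)) | on-region (alt₂ refl) | on-region (inj₁ refl)
        ... | inj₁ ζη | inj₁ ζa | inj₁ ζb = caseII ζη ζa ζb
        ... | inj₁ ζη | inj₂ a≡κ | inj₁ ζb = caseV ζη ζb a≡κ
        ... | inj₁ ζη | inj₁ ζa | inj₂ b≡κ = caseV′ ζη ζa b≡κ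
        ... | inj₂ η≡κ | inj₁ ζa | inj₁ ζb = caseIV ζa ζb η≡κ
        ... | _ | inj₂ a≡κ | inj₂ b≡κ = contradiction (trans a≡κ (sym b≡κ)) (edge⇒≢ eab)
        ... | inj₂ η≡κ | inj₂ a≡κ | _ = contradiction (trans a≡κ (sym η≡κ)) (edge⇒≢ aη)
        ... | inj₂ η≡κ | _ | inj₂ b≡κ = contradiction (trans b≡κ (sym η≡κ)) (edge⇒≢ bη)

    -- The two regions are disjoint, so the second brace joins their caps. By `near-κ` each
    -- neighbour of one cap is adjacent to the other, hence lies on both cycles, which share only
    -- `b` and `η`; but a cap has three neighbours.
    two-regions-absurd : ∀ {a b c} → Hub a b c → Region a b c → Region b c a → ⊥
    two-regions-absurd {a} {b} {c} H R₁ R₂ = ℕₚ.1+n≰n (unique-⊆⇒length≤ {xs = (Region.a′ R₁) ∷ (Region.b′ R₁) ∷ (Region.c′ R₁) ∷ []} {ys = b ∷ η ∷ []}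
        ((edge⇒≢ (Cap.eab (Region.Cζ R₁)) ∷ ≢-sym (edge⇒≢ (Cap.eca (Region.Cζ R₁))) ∷ []) ∷ (edge⇒≢ (Cap.ebc (Region.Cζ R₁)) ∷ []) ∷ [] ∷ [])
        λ { (here refl) → common (ξa (Region.Cζ R₁)) ; (here₁ refl) → common (ξb (Region.Cζ R₁)) ; (here₂ refl) → common (ξc (Region.Cζ R₁)) })
      where
      H₂ : Hub b c a
      H₂ = rotHub H
      apart : ∀ {v} → In (Region.Z R₂) v → ¬ In (Region.Z R₁) v
      apart = disjoint-sides (Region.Z R₁) (Region.Z R₂)
        (λ o i → case (Region.Z-on R₁) o of λ
          { (inj₁ e) → InRegion.¬on H₂ R₂ (alt₂ e) i ; (alt₂ refl) → (Region.¬c R₂) i ; (inj₂ (inj₂ e)) → InRegion.¬on H₂ R₂ (inj₂ (inj₂ e)) i })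
        (subst (IsOff (Region.Z R₁)) (sym (Region.first R₂)) (InRegion.off-c H R₁)) (λ i → (Region.¬c R₁) (subst (In (Region.Z R₁)) (Region.first R₂) i))
      κ₁≡ζ₂ : (Region.κ R₁) ≡ (Region.ζ R₂)
      κ₁≡ζ₂ with TwoBraces.only (Region.tbζ R₁) (TwoBraces.pq (Region.tbζ R₂))
      ... | inj₁ (e , _) = ⊥-elim (InRegion.ζ≢ξ H₂ R₂ e)
      ... | alt₂ (e , _) = ⊥-elim (InRegion.ζ≢η H₂ R₂ e)
      ... | alt₃ (e , _) = ⊥-elim (apart (Region.iζ R₂) (subst (In (Region.Z R₁)) (sym e) (Region.iζ R₁)))
      ... | alt₄ (e , _) = sym e
      common : ∀ {w} → A (Region.ζ R₁) w ≡ true → w ∈ b ∷ η ∷ []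
      common {w} ζw with in-adjacent (Region.Z R₁) (Region.iζ R₁) ζw | in-adjacent (Region.Z R₂) (Region.iζ R₂) (subst (λ z → A z w ≡ true) κ₁≡ζ₂ (symm (InRegion.near-κ H R₁ ζw)))
      ... | inj₁ i | inj₁ j = ⊥-elim (apart j i)
      ... | inj₁ i | inj₂ o = case (Region.Z-on R₂) o of λ
        { (inj₁ refl) → ⊥-elim ((Region.¬c R₁) i) ; (alt₂ e) → ⊥-elim (InRegion.¬on H R₁ (inj₁ e) i) ; (inj₂ (inj₂ e)) → ⊥-elim (InRegion.¬on H R₁ (inj₂ (inj₂ e)) i) }
      ... | inj₂ o | j = case (Region.Z-on R₁) o of λ
        { (inj₁ e) → here e
        ; (alt₂ refl) → ⊥-elim ([ (Region.¬c R₂) , (λ o′ → off-not-on (InRegion.off-c H₂ R₂) o′) ]′ j)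
        ; (inj₂ (inj₂ e)) → here₁ e }

    -- The triangulation would be the bipyramid over `abc` with poles `ξ` and `η`, whose poles are
    -- its only non-adjacent pair; the second brace has no place.
    all-facial-absurd : ∀ {a b c} → Hub a b c → t b a ≡ η → t c b ≡ η → t a c ≡ η → ⊥
    all-facial-absurd {a} {b} {c} (hub C aη bη cη) e₁ e₂ e₃ = by (covers p) (covers q)
      where
      covers = bipyramid-covers C e₁ e₂ e₃
      adjacent : ∀ {u w} → u ∈ a ∷ b ∷ c ∷ [] → w ∈ η ∷ a ∷ b ∷ c ∷ [] → u ≡ w ⊎ A u w ≡ true
      adjacent (here refl) (here refl) = inj₂ aη
      adjacent (here₁ refl) (here refl) = inj₂ bη
      adjacent (here₂ refl) (here refl) = inj₂ cη
      adjacent u∈ (there w∈) = cap-adjacent C (near u∈) (near w∈)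
        where
        near : ∀ {u} → u ∈ a ∷ b ∷ c ∷ [] → A ξ u ≡ true
        near (here refl) = ξa C
        near (here₁ refl) = ξb C
        near (here₂ refl) = ξc C
      by : p ∈ ξ ∷ η ∷ a ∷ b ∷ c ∷ [] → q ∈ ξ ∷ η ∷ a ∷ b ∷ c ∷ [] → ⊥
      by (here e) _ = p≢ξ e
      by (here₁ e) _ = p≢η e
      by (there (there _)) (here e) = q≢ξ e
      by (there (there p∈)) (there q∈) = [ p≢q , disjoint (TwoBraces.pq tb) ]′ (adjacent p∈ q∈)

    classify : ∀ {a b c} → Hub a b c → IsBase
    classify {a} {b} {c} H with t b a Fin.≟ η | t c b Fin.≟ η | t a c Fin.≟ η
    ... | yes e₁ | yes e₂ | yes e₃ = ⊥-elim (all-facial-absurd H e₁ e₂ e₃)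
    ... | no n₁ | yes e₂ | yes e₃ = InRegion.OneRegion.result H (region H n₁) e₂ e₃
    ... | yes e₁ | no n₂ | yes e₃ = InRegion.OneRegion.result (rotHub H) (region (rotHub H) n₂) e₃ e₁
    ... | yes e₁ | yes e₂ | no n₃ = InRegion.OneRegion.result (rotHub (rotHub H)) (region (rotHub (rotHub H)) n₃) e₁ e₂
    ... | no n₁ | no n₂ | _ = ⊥-elim (two-regions-absurd H (region H n₁) (region (rotHub H) n₂))
    ... | _ | no n₂ | no n₃ = ⊥-elim (two-regions-absurd (rotHub H) (region (rotHub H) n₂) (region (rotHub (rotHub H)) n₃))
    ... | no n₁ | _ | no n₃ = ⊥-elim (two-regions-absurd (rotHub (rotHub H)) (region (rotHub (rotHub H)) n₃) (region H n₁))

module BaseCases {n} {A : Adj n} (T : Tri A) (bound : numEdges A + 6 ≤ 3 * n) (3≤n : 3 ≤ n) (B : Adj n)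
  (disjoint : ∀ {u w} → B u w ≡ true → A u w ≡ true → ⊥)
  (irreducible : ∀ {u w} → Sides.Free T bound 3≤n u w → Endgame.BraceTriangle T bound 3≤n B disjoint u w) where
  open Sides T bound 3≤n
  open Endgame T bound 3≤n B disjoint
  open Irreducible T bound 3≤n B disjoint irreducible
  open Cap using (neighbours; ξa; ξb; ξc)

  end? : ∀ u → Dec (End u)
  end? u = Finₚ.any? λ s → B u s Boolₚ.≟ true

  clash : ∀ {w w′ x y} → B x y ≡ true → B y x ≡ true → w ≡ x ⊎ w ≡ y → w′ ≡ x ⊎ w′ ≡ y → A w w′ ≡ true → ⊥
  clash xy yx (inj₁ refl) (inj₁ refl) e = ¬self e
  clash xy yx (inj₁ refl) (inj₂ refl) e = disjoint xy e
  clash xy yx (inj₂ refl) (inj₁ refl) e = disjoint yx e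
  clash xy yx (inj₂ refl) (inj₂ refl) e = ¬self e

  non-end-edge : ∀ {u w} → ¬ End u → Free u w → ∃ λ s → B w s ≡ true × A u s ≡ true
  non-end-edge ¬end free with irreducible free
  ... | s , inj₁ (β , _) = contradiction (s , β) ¬end
  ... | s , alt₂ h = s , h
  ... | s , inj₂ (inj₂ (β , _)) = contradiction (s , β) ¬end

  module _ {x y p q} (tb : TwoBraces B x y p q) where
    end-∈ : ∀ {u} → End u → u ∈ x ∷ y ∷ p ∷ q ∷ []
    end-∈ (s , β) = case TwoBraces.only tb β of λ
      { (inj₁ (e , _)) → here e ; (alt₂ (e , _)) → here₁ e
      ; (alt₃ (e , _)) → here₂ e ; (alt₄ (e , _)) → here₃ e }

  third-side : (∃ λ u → ∃ λ w → ∃ (Third u w)) → Side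
  third-side (u , w , z , th) = cycle th

  anyThird? : Dec (∃ λ u → ∃ λ w → ∃ (Third u w))
  anyThird? = Finₚ.any? λ u → Finₚ.any? λ w → third? u w

  -- Two braces without a common end

  module Disjoint where

    record Distinct (x y p q : Fin n) : Set where
      constructor distinct
      field
        x≢y : x ≢ y
        x≢p : x ≢ p
        x≢q : x ≢ q
        y≢p : y ≢ p
        y≢q : y ≢ q
        p≢q : p ≢ q

    swapFirst′ : ∀ {x y p q} → Distinct x y p q → Distinct y x p q
    swapFirst′ (distinct a b c d e f) = distinct (≢-sym a) d e b c f
    swapSecond′ : ∀ {x y p q} → Distinct x y p q → Distinct x y q p
    swapSecond′ (distinct a b c d e f) = distinct a c b e d (≢-sym f)
    swapPairs′ : ∀ {x y p q} → Distinct x y p q → Distinct p q x y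
    swapPairs′ (distinct a b c d e f) = distinct f (≢-sym b) (≢-sym d) (≢-sym c) (≢-sym e) a

    mate : ∀ {x y p q} → TwoBraces B x y p q → Distinct x y p q → ∀ {s} → B x s ≡ true → s ≡ y
    mate tb d β with TwoBraces.only tb β
    ... | inj₁ (_ , e) = e
    ... | alt₂ (e , _) = contradiction e (Distinct.x≢y d)
    ... | alt₃ (e , _) = contradiction e (Distinct.x≢p d)
    ... | alt₄ (e , _) = contradiction e (Distinct.x≢q d)

    B-unique : ∀ {x y p q} → TwoBraces B x y p q → Distinct x y p q → ∀ {u s s′} → B u s ≡ true → B u s′ ≡ true → s ≡ s′
    B-unique tb d β β′ with TwoBraces.only tb β
    ... | inj₁ (refl , refl) = sym (mate tb d β′)
    ... | alt₂ (refl , refl) = sym (mate (swapFirst tb) (swapFirst′ d) β′)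
    ... | alt₃ (refl , refl) = sym (mate (swapPairs tb) (swapPairs′ d) β′)
    ... | alt₄ (refl , refl) = sym (mate (swapPairs (swapSecond tb)) (swapPairs′ (swapSecond′ d)) β′)

    module Full {x y p q} (tb : TwoBraces B x y p q) (d : Distinct x y p q) {u} (¬end : ¬ End u)
                (free : ∀ {w} → A u w ≡ true → Free u w) where
      open TwoBraces tb
      open Distinct d

      class : ∀ {w} → A u w ≡ true → ((w ≡ x ⊎ w ≡ y) × A u x ≡ true × A u y ≡ true) ⊎ ((w ≡ p ⊎ w ≡ q) × A u p ≡ true × A u q ≡ true)
      class uw with non-end-edge ¬end (free uw)
      ... | s , β , us with only β
      ...   | inj₁ (refl , refl) = inj₁ (inj₁ refl , uw , us)
      ...   | alt₂ (refl , refl) = inj₁ (inj₂ refl , us , uw)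
      ...   | alt₃ (refl , refl) = inj₂ (inj₁ refl , uw , us)
      ...   | alt₄ (refl , refl) = inj₂ (inj₂ refl , us , uw)

      -- Consecutive neighbours of `u` are adjacent, hence never the two ends of one brace. So ends
      -- of both braces occur, and by `class` each occurs together with its mate.
      full : (A u x ≡ true × A u y ≡ true) × A u p ≡ true × A u q ≡ true
      full with class (nb-edge u) | class (t-edge (symm (nb-edge u)))
      ... | inj₁ (_ , ux , uy) | inj₂ (_ , up , uq) = (ux , uy) , up , uq
      ... | inj₂ (_ , up , uq) | inj₁ (_ , ux , uy) = (ux , uy) , up , uq
      ... | inj₁ (i , _) | inj₁ (j , _) = ⊥-elim (clash xy yx i j (t-edge″ (symm (nb-edge u))))
      ... | inj₂ (i , _) | inj₂ (j , _) = ⊥-elim (clash pq qp i j (t-edge″ (symm (nb-edge u))))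

      after-first : ∀ {w} → A u w ≡ true → w ≡ x ⊎ w ≡ y → t w u ≡ p ⊎ t w u ≡ q
      after-first uw i with class (t-edge (symm uw))
      ... | inj₁ (j , _) = ⊥-elim (clash xy yx i j (t-edge″ (symm uw)))
      ... | inj₂ (j , _) = j

      after-second : ∀ {w} → A u w ≡ true → w ≡ p ⊎ w ≡ q → t w u ≡ x ⊎ t w u ≡ y
      after-second uw i with class (t-edge (symm uw))
      ... | inj₁ (j , _) = j
      ... | inj₂ (j , _) = ⊥-elim (clash pq qp i j (t-edge″ (symm uw)))

      t-injective : ∀ {w w′} → A u w ≡ true → A u w′ ≡ true → t w u ≡ t w′ u → w ≡ w′
      t-injective e e′ eq = trans (sym (t-rot (symm e))) (trans (cong (t u) eq) (t-rot (symm e′)))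

      -- Successors around `u` alternate between the braces. If `x` followed `p`, the link would
      -- close up without `y`; the other choices follow because distinct neighbours have distinct
      -- successors.
      circuit : t x u ≡ p → t p u ≡ y × t y u ≡ q × t q u ≡ x
      circuit h with full
      ... | (ux , uy) , up , uq with after-second up (inj₁ refl) | after-first uy (inj₂ refl) | after-second uq (inj₂ refl)
      ...   | inj₁ pu≡x | _ | _ = ⊥-elim ([ ≢-sym x≢y , y≢p ]′ (link-induction T (λ w → w ≡ x ⊎ w ≡ p) ux (inj₁ refl)
                (λ { _ (inj₁ refl) → inj₂ h ; _ (inj₂ refl) → inj₁ pu≡x }) uy))
      ...   | inj₂ _ | inj₁ yu≡p | _ = contradiction (t-injective ux uy (trans h (sym yu≡p))) x≢y
      ...   | inj₂ pu≡y | inj₂ _ | inj₂ qu≡y = contradiction (t-injective up uq (trans pu≡y (sym qu≡y))) p≢q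
      ...   | inj₂ pu≡y | inj₂ yu≡q | inj₁ qu≡x = pu≡y , yu≡q , qu≡x

    module _ {x y p q} (tb : TwoBraces B x y p q) (d : Distinct x y p q) where
      open TwoBraces tb
      open Distinct d

      kind : ∀ {u} → End u → (u ≡ x ⊎ u ≡ y) ⊎ (u ≡ p ⊎ u ≡ q)
      kind (s , β) = case only β of λ
        { (inj₁ (e , _)) → inj₁ (inj₁ e) ; (alt₂ (e , _)) → inj₁ (inj₂ e)
        ; (alt₃ (e , _)) → alt₂ e ; (alt₄ (e , _)) → inj₂ (inj₂ e) }

      mates : ∀ {u w x y} → B x y ≡ true → B y x ≡ true → u ≡ x ⊎ u ≡ y → w ≡ x ⊎ w ≡ y → u ≢ w → B u w ≡ true
      mates xy yx (inj₁ refl) (inj₁ refl) ne = contradiction refl ne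
      mates xy yx (inj₁ refl) (inj₂ refl) ne = xy
      mates xy yx (inj₂ refl) (inj₁ refl) ne = yx
      mates xy yx (inj₂ refl) (inj₂ refl) ne = contradiction refl ne

      B-sym : ∀ {u w} → B u w ≡ true → B w u ≡ true
      B-sym β = ∈-braces {P = λ u w → B w u ≡ true} yx xy qp pq (only β)

      -- Of three distinct apexes two belong to the same brace. The edges joining these two to `a`
      -- and to `c` are free; unless a brace triangle supplies the desired adjacency, both `a` and
      -- `c` are brace ends, and with the apexes that makes five ends instead of four.
      ends-cap : ∀ Z → Minimal Z → (∀ {e} → In Z e → End e) → HasCap Z
      ends-cap Z min ends = minimal-cap Z min close pair
        where
        pair : apex₁ Z ≢ apex₂ Z → apex₂ Z ≢ apex₃ Z → apex₃ Z ≢ apex₁ Z →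
          B (apex₁ Z) (apex₂ Z) ≡ true ⊎ B (apex₂ Z) (apex₃ Z) ≡ true ⊎ B (apex₃ Z) (apex₁ Z) ≡ true
        pair n₁ n₂ n₃ with kind (ends (apex-in Z)) | kind (ends (apex₂-in Z)) | kind (ends (apex₃-in Z))
        ... | inj₁ i | inj₁ j | _      = inj₁ (mates xy yx i j n₁)
        ... | inj₂ i | inj₂ j | _      = inj₁ (mates pq qp i j n₁)
        ... | _      | inj₁ j | inj₁ k = alt₂ (mates xy yx j k n₂)
        ... | _      | inj₂ j | inj₂ k = alt₂ (mates pq qp j k n₂)
        ... | inj₁ i | _      | inj₁ k = inj₂ (inj₂ (mates xy yx k i n₃))
        ... | inj₂ i | _      | inj₂ k = inj₂ (inj₂ (mates pq qp k i n₃))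
        close : ∀ Z′ → Minimal Z′ → Within Z′ Z → apex₁ Z′ ≢ apex₂ Z′ → apex₂ Z′ ≢ apex₃ Z′ → apex₃ Z′ ≢ apex₁ Z′ →
          B (apex₁ Z′) (apex₂ Z′) ≡ true → A (a Z′) (apex₂ Z′) ≡ true ⊎ A (c Z′) (apex₁ Z′) ≡ true
        close Z′ min′ within n₁ n₂ n₃ β = by (irreducible (min′ (apex-in Z′) (t-edge′ (ab Z′)))) (irreducible (min′ (apex₂-in Z′) (symm (t-edge (bc Z′)))))
          where
          five : End (a Z′) → End (c Z′) → ⊥
          five ea ec = ℕₚ.1+n≰n (unique-⊆⇒length≤ {xs = a Z′ ∷ c Z′ ∷ apex₁ Z′ ∷ apex₂ Z′ ∷ apex₃ Z′ ∷ []} {ys = x ∷ y ∷ p ∷ q ∷ []}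
            ((≢-sym (edge⇒≢ (ca Z′)) ∷ ≢-sym (not-a (apex-in Z′)) ∷ ≢-sym (not-a (apex₂-in Z′)) ∷ ≢-sym (not-a (apex₃-in Z′)) ∷ [])
             ∷ (≢-sym (not-c (apex-in Z′)) ∷ ≢-sym (not-c (apex₂-in Z′)) ∷ ≢-sym (not-c (apex₃-in Z′)) ∷ [])
             ∷ (n₁ ∷ ≢-sym n₃ ∷ []) ∷ (n₂ ∷ []) ∷ [] ∷ [])
            λ { (here refl) → end-∈ tb ea ; (here₁ refl) → end-∈ tb ec ; (here₂ refl) → end-∈ tb (ends (within (apex-in Z′)))
              ; (here₃ refl) → end-∈ tb (ends (within (apex₂-in Z′)))
              ; (here₄ refl) → end-∈ tb (ends (within (apex₃-in Z′))) })
            where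
            not-a : ∀ {v} → In Z′ v → v ≢ a Z′
            not-a i = proj₁ (proj₁ i)
            not-c : ∀ {v} → In Z′ v → v ≢ c Z′
            not-c i = proj₂ (proj₂ (proj₁ i))
          by : BraceTriangle (apex₁ Z′) (a Z′) → BraceTriangle (apex₂ Z′) (c Z′) → A (a Z′) (apex₂ Z′) ≡ true ⊎ A (c Z′) (apex₁ Z′) ≡ true
          by (s , inj₁ (γ , e)) _ = inj₁ (subst (λ v → A (a Z′) v ≡ true) (B-unique tb d γ β) e)
          by _ (s , inj₁ (γ , e)) = inj₂ (subst (λ v → A (c Z′) v ≡ true) (B-unique tb d γ (B-sym β)) e)
          by (s , inj₂ h) (s′ , inj₂ h′) = ⊥-elim (five ([ (λ k → s , proj₁ k) , (λ k → s , proj₂ k) ]′ h) ([ (λ k → s′ , proj₁ k) , (λ k → s′ , proj₂ k) ]′ h′))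

      -- If a minimal side contains a vertex that is no brace end, that vertex is adjacent to all four brace ends;
      -- this cannot happen on both sides of a 3-cycle, for then the 3-cycle would contain all brace ends.
      capIn : CapIn
      capIn X with minimal-side X
      ... | Z , within , min with Finₚ.any? (λ u → in? Z u ×-dec ¬? (end? u))
      ...   | no none = let e , i , C = ends-cap Z min (λ {e} i → decidable-stable (end? e) λ ¬end → none (e , i , ¬end))
                        in e , within i , decidable-stable (end? e) (λ ¬end → none (e , i , ¬end)) , C
      ...   | yes (u , iu , ¬end) with minimal-side (op X)
      ...     | Z₂ , within₂ , min₂ = ⊥-elim (two-full (end? (apex₁ Z₂)))
        where
        near : ∀ {w} → A u w ≡ true → In X w ⊎ IsOn X w
        near = in-adjacent X (within iu)
        v = apex₁ Z₂
        iv : In (op X) v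
        iv = within₂ (apex-in Z₂)
        u-full = Full.full tb d ¬end (min iu)
        reach : ∀ {w} → w ∈ x ∷ y ∷ p ∷ q ∷ [] → A u w ≡ true
        reach (here refl) = proj₁ (proj₁ u-full)
        reach (here₁ refl) = proj₂ (proj₁ u-full)
        reach (here₂ refl) = proj₁ (proj₂ u-full)
        reach (here₃ refl) = proj₂ (proj₂ u-full)
        on-both : ∀ {w} → A u w ≡ true → A v w ≡ true → IsOn X w
        on-both uw vw with near uw
        ... | inj₂ o = o
        ... | inj₁ i with in-adjacent (op X) iv vw
        ...   | inj₁ j = ⊥-elim (in-not-op X i j)
        ...   | inj₂ o = ⊥-elim (off-not-on (proj₁ i) (op-on X o))
        two-full : Dec (End v) → ⊥
        two-full (yes e) with near (reach (end-∈ tb e))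
        ... | inj₁ i = in-not-op X i iv
        ... | inj₂ o = off-not-on (proj₁ iv) (same-on′ {X = X} (inj₂ refl) o)
        two-full (no ¬end′) with Full.full tb d ¬end′ (min₂ (apex-in Z₂))
        ... | (vx , vy) , _ with on-adjacent X (on-both (reach (here refl)) vx) (on-both (reach (here₁ refl)) vy)
        ...   | inj₁ e = x≢y e
        ...   | inj₂ e = disjoint xy e

      -- An edge at the cap is free, so it lies in a brace triangle. The second brace cannot be
      -- involved, since both its ends would be neighbours of the cap, and these are pairwise
      -- adjacent.
      near-mate : ∀ {a b c} → Cap x a b c → ∀ {w} → A x w ≡ true → A w y ≡ true
      near-mate C {w} xw with irreducible (cap-free C xw)
      ... | s , inj₁ (β , ws) = subst (λ v → A w v ≡ true) (mate tb d β) ws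
      ... | s , alt₂ (β , xs) = case only β of λ
        { (inj₁ (refl , _)) → ⊥-elim (¬self xw) ; (alt₂ (refl , _)) → ⊥-elim (disjoint xy xw)
        ; (alt₃ (refl , refl)) → ⊥-elim ([ p≢q , disjoint pq ]′ (cap-adjacent C xw xs))
        ; (alt₄ (refl , refl)) → ⊥-elim ([ p≢q , disjoint pq ]′ (cap-adjacent C xs xw)) }
      ... | s , inj₂ (inj₂ (β , γ)) = ⊥-elim (edge⇒≢ xw (B-unique tb d (B-sym β) (B-sym γ)))

      from-cap : ∀ {a b c} → Cap x a b c → IsBase
      from-cap C = Config.classify tb x≢y p≢q (≢-sym x≢p) (≢-sym y≢p) (≢-sym x≢q) capIn
        (Config.hub C (near-mate C (ξa C)) (near-mate C (ξb C)) (near-mate C (ξc C)))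

      module _ (none : ¬ (∃ λ u → ∃ λ w → ∃ (Third u w))) where

        free-of : ∀ {u w} → A u w ≡ true → Free u w
        free-of e = e , λ th → none (_ , _ , th)

        -- The edge `xp` has the apexes `u` and `u′`. Being adjacent to both `x` and `p`, the vertex
        -- `u′` is no brace end either, so `circuit` applies at both apexes and yields the eight
        -- faces.
        octahedron : ∀ {u} → ¬ End u → A x u ≡ true → t x u ≡ p → IsBase
        octahedron {u} ¬end xu h = 0F , realise₁ T (lookup (x ∷ p ∷ u ∷ y ∷ q ∷ u′ ∷ []))
            ( ((xu , h) ∷ (symm up , pu) ∷ (symm uy , yu) ∷ (symm uq , qu)
               ∷ (symm u′p , pu′) ∷ (symm u′x , xu′) ∷ (symm u′q , qu′) ∷ (symm u′y , yu′) ∷ [])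
            , (x≢y ∷ p≢q ∷ (λ u≡u′ → apexes-≢ T x≢y (Boolₚ.¬-not (disjoint xy)) xp (trans (sym u≡u′) (sym (face-rot² xu h)))) ∷ []))
            tb
          where
          xp : A x p ≡ true
          xp = subst (λ z → A x z ≡ true) h (t-edge″ xu)
          u′ = t x p
          xu′ᵉ = t-edge″ xp
          pu′ᵉ = t-edge xp
          ¬end′ : ¬ End u′
          ¬end′ (s , β) with only β
          ... | inj₁ (e , _) = edge⇒≢ xu′ᵉ (sym e)
          ... | alt₂ (e , _) = disjoint xy (subst (λ z → A x z ≡ true) e xu′ᵉ)
          ... | alt₃ (e , _) = edge⇒≢ pu′ᵉ (sym e)
          ... | alt₄ (e , _) = disjoint pq (subst (λ z → A p z ≡ true) e pu′ᵉ)
          u-full = Full.full tb d ¬end free-of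
          uy = proj₂ (proj₁ u-full)
          up = proj₁ (proj₂ u-full)
          uq = proj₂ (proj₂ u-full)
          u-circuit = Full.circuit tb d ¬end free-of h
          pu = proj₁ u-circuit
          yu = proj₁ (proj₂ u-circuit)
          qu = proj₂ (proj₂ u-circuit)
          u′-full = Full.full tb d ¬end′ free-of
          u′x = proj₁ (proj₁ u′-full)
          u′y = proj₂ (proj₁ u′-full)
          u′p = proj₁ (proj₂ u′-full)
          u′q = proj₂ (proj₂ u′-full)
          pu′ : t p u′ ≡ x
          pu′ = t-rot xp
          u′-circuit = Full.circuit (swapPairs tb) (swapPairs′ d) ¬end′ free-of pu′
          xu′ = proj₁ u′-circuit
          qu′ = proj₁ (proj₂ u′-circuit)
          yu′ = proj₂ (proj₂ u′-circuit)

    module _ {x y p q} (tb : TwoBraces B x y p q) (d : Distinct x y p q) where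
      open TwoBraces tb
      open Distinct d

      -- Of two consecutive neighbours of `x` one is no brace end: ends near `x` are `p` or `q`,
      -- which are not adjacent.
      no-third : ¬ (∃ λ u → ∃ λ w → ∃ (Third u w)) → IsBase
      no-third none = by (end? (nb x))
        where
        octa : ∀ {u} → ¬ End u → A x u ≡ true → IsBase
        octa ¬end xu with Full.after-first tb d ¬end (free-of tb d none) (symm xu) (inj₁ refl)
        ... | inj₁ h = octahedron tb d none ¬end xu h
        ... | inj₂ h = octahedron (swapSecond tb) (swapSecond′ d) none ¬end xu h
        end-near : ∀ {w} → A x w ≡ true → End w → w ≡ p ⊎ w ≡ q
        end-near xw e with kind tb d e
        ... | inj₁ (inj₁ refl) = ⊥-elim (¬self xw)
        ... | inj₁ (inj₂ refl) = ⊥-elim (disjoint xy xw)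
        ... | inj₂ h = h
        by : Dec (End (nb x)) → IsBase
        by (no ¬end) = octa ¬end (nb-edge x)
        by (yes e) = octa (λ e′ → clash pq qp (end-near (nb-edge x) e) (end-near (t-edge (symm (nb-edge x))) e′) (t-edge″ (symm (nb-edge x))))
          (t-edge (symm (nb-edge x)))

      disjoint-braces : IsBase
      disjoint-braces with anyThird?
      ... | no none = no-third none
      ... | yes th with capIn tb d (third-side th)
      ...   | e , _ , (s , β) , _ , _ , _ , C with only β
      ...     | inj₁ (refl , _) = from-cap tb d C
      ...     | alt₂ (refl , _) = from-cap (swapFirst tb) (swapFirst′ d) C
      ...     | alt₃ (refl , _) = from-cap (swapPairs tb) (swapPairs′ d) C
      ...     | alt₄ (refl , _) = from-cap (swapPairs (swapSecond tb)) (swapPairs′ (swapSecond′ d)) C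

-- Two braces with a common end

module SharedEnd {n} {A : Adj n} (T : Tri A) (bound : numEdges A + 6 ≤ 3 * n) (3≤n : 3 ≤ n) (B : Adj n)
  (disjoint : ∀ {u w} → B u w ≡ true → A u w ≡ true → ⊥)
  (irreducible : ∀ {u w} → Sides.Free T bound 3≤n u w → Endgame.BraceTriangle T bound 3≤n B disjoint u w) where
  open Sides T bound 3≤n
  open Endgame T bound 3≤n B disjoint
  open Irreducible T bound 3≤n B disjoint irreducible
  open BaseCases T bound 3≤n B disjoint irreducible
  open Cap using (neighbours; ξa; ξb; ξc)

  module _ {x y z} (tb : TwoBraces B x y x z) (x≢y : x ≢ y) (x≢z : x ≢ z) (y≢z : y ≢ z) where
    open TwoBraces tb

    kind : ∀ {u} → End u → u ≡ x ⊎ u ≡ y ⊎ u ≡ z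
    kind (s , β) = case only β of λ
      { (inj₁ (e , _)) → inj₁ e ; (alt₂ (e , _)) → alt₂ e
      ; (alt₃ (e , _)) → inj₁ e ; (alt₄ (e , _)) → inj₂ (inj₂ e) }

    only-x : ∀ {u s} → u ≢ x → B u s ≡ true → s ≡ x
    only-x u≢x β = case only β of λ
      { (inj₁ (e , _)) → contradiction e u≢x ; (alt₂ (_ , e)) → e
      ; (alt₃ (e , _)) → contradiction e u≢x ; (alt₄ (_ , e)) → e }

    not-near-x : ∀ {w} → A x w ≡ true → ¬ End w
    not-near-x xw e with kind e
    ... | inj₁ refl = ¬self xw
    ... | alt₂ refl = disjoint xy xw
    ... | inj₂ (inj₂ refl) = disjoint pq xw

    -- Every brace contains `x`, so a non-end all of whose edges are free is adjacent to `x`. Its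
    -- next neighbour after `x` must then be a brace end adjacent to `x`, which does not exist.
    free-vertex-end : ∀ {u} → (∀ {w} → A u w ≡ true → Free u w) → End u
    free-vertex-end {u} free = decidable-stable (end? u) λ ¬end →
      let ux = near-x ¬end (nb-edge u)
          s , β , _ = non-end-edge ¬end (free (t-edge (symm ux)))
      in not-near-x (t-edge″ (symm ux)) (s , β)
      where
      near-x : ∀ {w} → ¬ End u → A u w ≡ true → A u x ≡ true
      near-x ¬end uw with non-end-edge ¬end (free uw)
      ... | s , β , us with only β
      ...   | inj₁ (refl , _) = uw
      ...   | alt₂ (_ , refl) = us
      ...   | alt₃ (refl , _) = uw
      ...   | alt₄ (_ , refl) = us

    -- All vertices of the side are brace ends, so three distinct apexes are `x`, `y`, `z`, and any
    -- two of them including `x` form a brace. The cycle then contains no brace end, and a free edge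
    -- from an apex other than `x` makes its end on the cycle adjacent to `x`.
    ends-cap : ∀ Z → Minimal Z → HasCap Z
    ends-cap Z min = minimal-cap Z min close pair
      where
      ends : ∀ {e} → In Z e → End e
      ends i = free-vertex-end (min i)
      pair : apex₁ Z ≢ apex₂ Z → apex₂ Z ≢ apex₃ Z → apex₃ Z ≢ apex₁ Z →
        B (apex₁ Z) (apex₂ Z) ≡ true ⊎ B (apex₂ Z) (apex₃ Z) ≡ true ⊎ B (apex₃ Z) (apex₁ Z) ≡ true
      pair = by (kind (ends (apex-in Z))) (kind (ends (apex₂-in Z))) (kind (ends (apex₃-in Z)))
        where
        by : ∀ {α β γ} → α ≡ x ⊎ α ≡ y ⊎ α ≡ z → β ≡ x ⊎ β ≡ y ⊎ β ≡ z → γ ≡ x ⊎ γ ≡ y ⊎ γ ≡ z →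
          α ≢ β → β ≢ γ → γ ≢ α → B α β ≡ true ⊎ B β γ ≡ true ⊎ B γ α ≡ true
        by (inj₁ refl) (inj₁ refl) _ n₁ _ _ = contradiction refl n₁
        by (inj₁ refl) (alt₂ refl) _ _ _ _ = inj₁ xy
        by (inj₁ refl) (inj₂ (inj₂ refl)) _ _ _ _ = inj₁ pq
        by (alt₂ refl) (inj₁ refl) _ _ _ _ = inj₁ yx
        by (inj₂ (inj₂ refl)) (inj₁ refl) _ _ _ _ = inj₁ qp
        by (inj₂ _) (alt₂ refl) (inj₁ refl) _ _ _ = alt₂ yx
        by (inj₂ _) (inj₂ (inj₂ refl)) (inj₁ refl) _ _ _ = alt₂ qp
        by (alt₂ refl) (alt₂ refl) _ n₁ _ _ = contradiction refl n₁
        by (inj₂ (inj₂ refl)) (inj₂ (inj₂ refl)) _ n₁ _ _ = contradiction refl n₁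
        by (alt₂ refl) (inj₂ (inj₂ refl)) (alt₂ refl) _ _ n₃ = contradiction refl n₃
        by (alt₂ refl) (inj₂ (inj₂ refl)) (inj₂ (inj₂ refl)) _ n₂ _ = contradiction refl n₂
        by (inj₂ (inj₂ refl)) (alt₂ refl) (alt₂ refl) _ n₂ _ = contradiction refl n₂
        by (inj₂ (inj₂ refl)) (alt₂ refl) (inj₂ (inj₂ refl)) _ _ n₃ = contradiction refl n₃
      close : ∀ Z′ → Minimal Z′ → Within Z′ Z → apex₁ Z′ ≢ apex₂ Z′ → apex₂ Z′ ≢ apex₃ Z′ → apex₃ Z′ ≢ apex₁ Z′ →
        B (apex₁ Z′) (apex₂ Z′) ≡ true → A (a Z′) (apex₂ Z′) ≡ true ⊎ A (c Z′) (apex₁ Z′) ≡ true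
      close Z′ min′ within n₁ n₂ n₃ β = by (apex₁ Z′ Fin.≟ x)
        where
        off-ends : ∀ {v} → IsOn Z′ v → ¬ End v
        off-ends {v} o e = ℕₚ.1+n≰n (unique-⊆⇒length≤ {xs = v ∷ apex₁ Z′ ∷ apex₂ Z′ ∷ apex₃ Z′ ∷ []} {ys = x ∷ y ∷ z ∷ []}
          ((apart (apex-in Z′) ∷ apart (apex₂-in Z′) ∷ apart (apex₃-in Z′) ∷ []) ∷ (n₁ ∷ ≢-sym n₃ ∷ []) ∷ (n₂ ∷ []) ∷ [] ∷ [])
          λ { (here refl) → listed e ; (here₁ refl) → listed (ends (within (apex-in Z′)))
            ; (here₂ refl) → listed (ends (within (apex₂-in Z′))) ; (here₃ refl) → listed (ends (within (apex₃-in Z′))) })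
          where
          apart : ∀ {w} → In Z′ w → v ≢ w
          apart i refl = off-not-on (proj₁ i) o
          listed : ∀ {u} → End u → u ∈ x ∷ y ∷ z ∷ []
          listed e with kind e
          ... | inj₁ p = here p
          ... | alt₂ p = here₁ p
          ... | inj₂ (inj₂ p) = here₂ p
        common : ∀ {u w} → ¬ End w → u ≢ x → Free u w → A w x ≡ true
        common {u} {w} ¬end u≢x free with irreducible free
        ... | s , inj₁ (γ , ws) = subst (λ v → A w v ≡ true) (only-x u≢x γ) ws
        ... | s , alt₂ (γ , _) = contradiction (s , γ) ¬end
        ... | s , inj₂ (inj₂ (_ , γ)) = contradiction (s , γ) ¬end
        by : Dec (apex₁ Z′ ≡ x) → A (a Z′) (apex₂ Z′) ≡ true ⊎ A (c Z′) (apex₁ Z′) ≡ true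
        by (yes α≡x) = inj₂ (subst (λ v → A (c Z′) v ≡ true) (sym α≡x)
          (common (off-ends (inj₂ (inj₂ refl))) (λ e → n₁ (trans α≡x (sym e))) (min′ (apex₂-in Z′) (symm (t-edge (bc Z′))))))
        by (no α≢x) = inj₁ (subst (λ v → A (a Z′) v ≡ true) (sym (only-x α≢x β))
          (common (off-ends (inj₁ refl)) α≢x (min′ (apex-in Z′) (t-edge′ (ab Z′)))))

    opaque
      capIn : CapIn
      capIn X = let Z , within , min = minimal-side X
                    e , i , C = ends-cap Z min
                in e , within i , free-vertex-end (min i) , C

    -- As `y` and `z` are not adjacent, the brace `xz` forms no triangle with an edge at `y`. So
    -- every neighbour of `y` is adjacent to `x`, a hub with `x` in the role of `η`.
    two-outer-caps : ∀ {a b c} → Cap y a b c → (A y z ≡ true → ⊥) → IsBase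
    two-outer-caps C ¬yz = Config.classify (swapSecond (swapFirst tb)) (≢-sym x≢y) (≢-sym x≢z) (≢-sym y≢z) (≢-sym x≢z) x≢y capIn
      (Config.hub C (near-x (ξa C)) (near-x (ξb C)) (near-x (ξc C)))
      where
      near-x : ∀ {w} → A y w ≡ true → A w x ≡ true
      near-x {w} yw with irreducible (cap-free C yw)
      ... | s , inj₁ (β , ws) = subst (λ v → A w v ≡ true) (only-x (≢-sym x≢y) β) ws
      ... | s , alt₂ (β , ys) = case only β of λ
        { (inj₁ (refl , _)) → ⊥-elim (disjoint yx yw) ; (alt₂ (refl , _)) → ⊥-elim (¬self yw)
        ; (alt₃ (refl , _)) → ⊥-elim (disjoint yx yw) ; (alt₄ (refl , _)) → ⊥-elim (¬yz yw) }
      ... | s , inj₂ (inj₂ (_ , β)) = case only β of λ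
        { (inj₁ (refl , _)) → ⊥-elim (disjoint yx yw) ; (alt₂ (refl , _)) → ⊥-elim (¬self yw)
        ; (alt₃ (refl , _)) → ⊥-elim (disjoint yx yw) ; (alt₄ (refl , _)) → ⊥-elim (¬yz yw) }

    -- The free edge `xc` needs a brace triangle; as `c` is not adjacent to `z`, this makes `c`
    -- adjacent to `y`. The last two faces, both with third vertex `y`, are closed by `facial`.
    baseIII-from : ∀ {a b c} → Cap x a b c → Cap z y b a → IsBase
    baseIII-from {a} {b} {c} C D = 2F , realise₃ T (lookup (c ∷ x ∷ a ∷ y ∷ b ∷ z ∷ []))
        ( ((eab , tab) ∷ (ebc , tbc) ∷ (eca , tca) ∷ (cb , tcb) ∷ (ac , tac) ∷ (Cap.ebc D , Cap.tbc D) ∷ (Cap.eca D , Cap.tca D) ∷ (Cap.eab D , Cap.tab D) ∷ [])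
        , (x≢y ∷ x≢z ∷ (λ { refl → disjoint pq (ξc C) }) ∷ [])) tb
      where
      open Cap C using (eab; ebc; eca; tab; tbc; tca)
      cb = symm ebc
      ac = symm eca
      x≢-apex : ∀ {v} → v ≡ x → v ≢ y
      x≢-apex e e′ = x≢y (trans (sym e) e′)
      ¬zc : A z c ≡ true → ⊥
      ¬zc e with neighbours D e
      ... | inj₁ refl = disjoint xy (ξc C)
      ... | alt₂ refl = ¬self ebc
      ... | inj₂ (inj₂ refl) = ¬self eca
      cy : A c y ≡ true
      cy with irreducible (cap-free C (ξc C))
      ... | s , inj₁ (β , cs) = case only β of λ
        { (inj₁ (_ , refl)) → cs ; (alt₂ (e , _)) → contradiction e x≢y
        ; (alt₃ (_ , refl)) → ⊥-elim (¬zc (symm cs)) ; (alt₄ (e , _)) → contradiction e x≢z }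
      ... | s , alt₂ (β , _) = contradiction (s , β) (not-near-x (ξc C))
      ... | s , inj₂ (inj₂ (_ , β)) = contradiction (s , β) (not-near-x (ξc C))
      capIn′ : ∀ X → ∃ λ e → In X e × e ∈ x ∷ y ∷ z ∷ []
      capIn′ X with capIn X
      ... | e , i , end , _ = e , i , (case kind end of λ { (inj₁ p) → here p ; (alt₂ p) → here₁ p ; (inj₂ (inj₂ p)) → here₂ p })
      tcb : t c b ≡ y
      tcb = facial _ capIn′ cb (symm (Cap.eab D)) (symm cy) (x≢-apex tbc) (edge⇒≢ (ξc C) , edge⇒≢ (ξb C) , x≢y)
        (stays ∷ on (inj₂ (inj₂ refl)) ∷ via (ξc D) (≢-sym (edge⇒≢ eca) , edge⇒≢ eab , edge⇒≢ (Cap.eca D))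
          (via (symm (ξa C)) (edge⇒≢ (ξc C) , edge⇒≢ (ξb C) , x≢y) stays) ∷ [])
      tac : t a c ≡ y
      tac = facial _ capIn′ ac cy (symm (Cap.eca D)) (x≢-apex tca) (edge⇒≢ (ξa C) , edge⇒≢ (ξc C) , x≢y)
        (stays ∷ on (inj₂ (inj₂ refl)) ∷ via (ξb D) (≢-sym (edge⇒≢ eab) , edge⇒≢ ebc , ≢-sym (edge⇒≢ (Cap.eab D)))
          (via (symm (ξb C)) (edge⇒≢ (ξa C) , edge⇒≢ (ξc C) , x≢y) stays) ∷ [])

    ¬same-face : ∀ {a b c e} → Cap x a b c → ¬ Cap z a b e
    ¬same-face C D = x≢z (trans (sym (Cap.tab C)) (Cap.tab D))

    inner-cap-with-y : ∀ {a b c u w} → Cap x a b c → Cap z y u w → OnT a b c u → OnT a b c w → IsBase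
    inner-cap-with-y C D (inj₁ refl) o = second (rotCap (rotCap C)) D (case o of λ { (inj₁ e) → alt₂ e ; (alt₂ e) → inj₂ (inj₂ e) ; (inj₂ (inj₂ e)) → inj₁ e })
      where
      second : ∀ {a b c w} → Cap x a b c → Cap z y b w → OnT a b c w → IsBase
      second C D (inj₁ refl) = baseIII-from C D
      second C D (alt₂ refl) = ⊥-elim (¬self (Cap.ebc D))
      second C D (inj₂ (inj₂ refl)) = ⊥-elim (¬same-face (rotCap C) (rotCap D))
    inner-cap-with-y C D (alt₂ refl) (inj₁ refl) = baseIII-from C D
    inner-cap-with-y C D (alt₂ refl) (alt₂ refl) = ⊥-elim (¬self (Cap.ebc D))
    inner-cap-with-y C D (alt₂ refl) (inj₂ (inj₂ refl)) = ⊥-elim (¬same-face (rotCap C) (rotCap D))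
    inner-cap-with-y C D (inj₂ (inj₂ refl)) (inj₁ refl) = ⊥-elim (¬same-face (rotCap (rotCap C)) (rotCap D))
    inner-cap-with-y C D (inj₂ (inj₂ refl)) (alt₂ refl) = baseIII-from (rotCap C) D
    inner-cap-with-y C D (inj₂ (inj₂ refl)) (inj₂ (inj₂ refl)) = ⊥-elim (¬self (Cap.ebc D))

    -- Each neighbour of `z` is `y` or is adjacent to `x`, hence one of `a`, `b`, `c`. If `y`
    -- occurs, the configuration is (III). Otherwise `x` and `z` are caps of the same triangle, and
    -- the resulting bipyramid leaves no place for `y`.
    inner-and-outer-cap : ∀ {a b c a′ b′ c′} → Cap x a b c → Cap z a′ b′ c′ → IsBase
    inner-and-outer-cap {a} {b} {c} {a′} {b′} {c′} C D = by (near (ξa D)) (near (ξb D)) (near (ξc D))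
      where
      near : ∀ {w} → A z w ≡ true → OnT a b c w ⊎ w ≡ y
      near {w} zw with irreducible (cap-free D zw)
      ... | s , inj₁ (β , ws) = inj₁ (neighbours C (symm (subst (λ v → A w v ≡ true) (only-x (≢-sym x≢z) β) ws)))
      ... | s , alt₂ (β , _) = case only β of λ
        { (inj₁ (refl , _)) → ⊥-elim (disjoint qp zw) ; (alt₂ (e , _)) → inj₂ e
        ; (alt₃ (refl , _)) → ⊥-elim (disjoint qp zw) ; (alt₄ (refl , _)) → ⊥-elim (¬self zw) }
      ... | s , inj₂ (inj₂ (_ , β)) = case only β of λ
        { (inj₁ (refl , _)) → ⊥-elim (disjoint qp zw) ; (alt₂ (e , _)) → inj₂ e
        ; (alt₃ (refl , _)) → ⊥-elim (disjoint qp zw) ; (alt₄ (refl , _)) → ⊥-elim (¬self zw) }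
      on-C : ∀ {w} → A y w ≡ true → OnT a b c w ⊎ w ≡ y → OnT a b c w
      on-C yw (inj₁ o) = o
      on-C yw (inj₂ refl) = ⊥-elim (¬self yw)
      same : ∀ {a b c u w} → Cap x a b c → Cap z a u w → OnT a b c u → OnT a b c w → IsBase
      same C D (inj₁ refl) _ = ⊥-elim (¬self (Cap.eab D))
      same C D (alt₂ refl) _ = ⊥-elim (¬same-face C D)
      same C D (inj₂ (inj₂ refl)) (inj₁ refl) = ⊥-elim (¬self (Cap.eca D))
      same C D (inj₂ (inj₂ refl)) (inj₂ (inj₂ refl)) = ⊥-elim (¬self (Cap.ebc D))
      same C D (inj₂ (inj₂ refl)) (alt₂ refl) with bipyramid-covers C (Cap.tca D) (Cap.tbc D) (Cap.tab D) y
      ... | here e = contradiction (sym e) x≢y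
      ... | here₁ e = contradiction e y≢z
      ... | here₂ refl = ⊥-elim (disjoint xy (ξa C))
      ... | here₃ refl = ⊥-elim (disjoint xy (ξb C))
      ... | here₄ refl = ⊥-elim (disjoint xy (ξc C))
      turn : ∀ {a b c v : Fin n} → OnT a b c v → OnT b c a v
      turn (inj₁ e) = inj₂ (inj₂ e)
      turn (alt₂ e) = inj₁ e
      turn (inj₂ (inj₂ e)) = alt₂ e
      by : OnT a b c a′ ⊎ a′ ≡ y → OnT a b c b′ ⊎ b′ ≡ y → OnT a b c c′ ⊎ c′ ≡ y → IsBase
      by (inj₂ refl) o₂ o₃ = inner-cap-with-y C D (on-C (Cap.eab D) o₂) (on-C (symm (Cap.eca D)) o₃)
      by o₁ (inj₂ refl) o₃ = inner-cap-with-y C (rotCap D) (on-C (Cap.ebc D) o₃) (on-C (symm (Cap.eab D)) o₁)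
      by o₁ o₂ (inj₂ refl) = inner-cap-with-y C (rotCap (rotCap D)) (on-C (Cap.eca D) o₁) (on-C (symm (Cap.ebc D)) o₂)
      by (inj₁ (inj₁ refl)) (inj₁ o₂) (inj₁ o₃) = same C D o₂ o₃
      by (inj₁ (alt₂ refl)) (inj₁ o₂) (inj₁ o₃) = same (rotCap C) D (turn o₂) (turn o₃)
      by (inj₁ (inj₂ (inj₂ refl))) (inj₁ o₂) (inj₁ o₃) = same (rotCap (rotCap C)) D (turn (turn o₂)) (turn (turn o₃))

  -- Without a non-facial 3-cycle every vertex would be a brace end, yet no neighbour of `x` is one.
  -- Otherwise both sides of such a cycle contain caps, at two different brace ends: either `x` and
  -- an outer end, or both outer ends.
  shared-brace-end : ∀ {x y z} → TwoBraces B x y x z → x ≢ y → x ≢ z → y ≢ z → IsBase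
  shared-brace-end {x} {y} {z} tb x≢y x≢z y≢z with anyThird?
  ... | no none = ⊥-elim (not-near-x tb x≢y x≢z y≢z (nb-edge x)
          (free-vertex-end tb x≢y x≢z y≢z λ e → e , λ th → none (_ , _ , th)))
  ... | yes th = by (capIn tb x≢y x≢z y≢z X₀) (capIn tb x≢y x≢z y≢z (op X₀))
    where
    X₀ : Side
    X₀ = third-side th
    Found : Side → Set
    Found W = ∃ λ e → In W e × End e × ∃ λ a → ∃ λ b → ∃ λ c → Cap e a b c
    separated : ∀ {u w} → In X₀ u → In (op X₀) w → A u w ≡ true → ⊥
    separated i j uw with in-adjacent X₀ i uw
    ... | inj₁ i′ = in-not-op X₀ i′ j
    ... | inj₂ o = off-not-on (proj₁ j) (same-on′ {X = X₀} (inj₂ refl) o)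
    tb′ = swapPairs tb
    by : Found X₀ → Found (op X₀) → IsBase
    by (_ , i , end , _ , _ , _ , C) (_ , j , end′ , _ , _ , _ , D) with kind tb x≢y x≢z y≢z end | kind tb x≢y x≢z y≢z end′
    ... | inj₁ refl | inj₂ (inj₂ refl) = inner-and-outer-cap tb x≢y x≢z y≢z C D
    ... | inj₁ refl | alt₂ refl = inner-and-outer-cap tb′ x≢z x≢y (≢-sym y≢z) C D
    ... | inj₂ (inj₂ refl) | inj₁ refl = inner-and-outer-cap tb x≢y x≢z y≢z D C
    ... | alt₂ refl | inj₁ refl = inner-and-outer-cap tb′ x≢z x≢y (≢-sym y≢z) D C
    ... | alt₂ refl | inj₂ (inj₂ refl) = two-outer-caps tb x≢y x≢z y≢z C (separated i j)
    ... | inj₂ (inj₂ refl) | alt₂ refl = two-outer-caps tb′ x≢z x≢y (≢-sym y≢z) C (separated i j)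
    ... | inj₁ refl | inj₁ refl = ⊥-elim (in-not-op X₀ i j)
    ... | alt₂ refl | alt₂ refl = ⊥-elim (in-not-op X₀ i j)
    ... | inj₂ (inj₂ refl) | inj₂ (inj₂ refl) = ⊥-elim (in-not-op X₀ i j)

-- Induction on the number of vertices

-- The fields `differ` and `differ′` say that the two braces are distinct as unordered pairs; a
-- common end is allowed.
record Stage {n} (P B : Adj n) : Set where
  field
    T           : Tri P
    bound       : numEdges P + 6 ≤ 3 * n
    3≤n         : 3 ≤ n
    {x y p q}   : Fin n
    braces      : TwoBraces B x y p q
    x≢y         : x ≢ y
    p≢q         : p ≢ q
    differ      : x ≡ p → y ≢ q
    differ′     : x ≡ q → y ≢ p
    disjoint    : ∀ {u w} → B u w ≡ true → P u w ≡ true → ⊥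

  B-sym : ∀ {u w} → B u w ≡ true → B w u ≡ true
  B-sym β = ∈-braces {P = λ u w → B w u ≡ true} yx xy qp pq (only β)
    where open TwoBraces braces

  B-irr : ∀ {u} → B u u ≡ true → ⊥
  B-irr β with TwoBraces.only braces β
  ... | inj₁ (refl , e) = x≢y e
  ... | alt₂ (refl , e) = x≢y (sym e)
  ... | alt₃ (refl , e) = p≢q e
  ... | alt₄ (refl , e) = p≢q (sym e)

  braceTriangle? : ∀ u w → Dec (Endgame.BraceTriangle T bound 3≤n B disjoint u w)
  braceTriangle? u w = Finₚ.any? λ s → ((B u s Boolₚ.≟ true) ×-dec (P w s Boolₚ.≟ true))
    ⊎-dec ((B w s Boolₚ.≟ true) ×-dec (P u s Boolₚ.≟ true)) ⊎-dec ((B u s Boolₚ.≟ true) ×-dec (B w s Boolₚ.≟ true))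

  Contractible : Fin n → Fin n → Set
  Contractible u w = P u w ≡ true × ¬ ∃ (Sides.Third T bound 3≤n u w) × ¬ Endgame.BraceTriangle T bound 3≤n B disjoint u w

  contractible? : Dec (∃ λ u → ∃ λ w → Contractible u w)
  contractible? = Finₚ.any? λ u → Finₚ.any? λ w →
    (P u w Boolₚ.≟ true) ×-dec ¬? (Sides.third? T bound 3≤n u w) ×-dec ¬? (braceTriangle? u w)

  irreducible-base : ¬ (∃ λ u → ∃ λ w → Contractible u w) → ∃ λ i → Iso (base i) (braced n P B)
  irreducible-base none = by braces x≢y p≢q differ differ′ (x Fin.≟ p) (x Fin.≟ q) (y Fin.≟ p) (y Fin.≟ q)
    where
    irreducible : ∀ {u w} → Sides.Free T bound 3≤n u w → Endgame.BraceTriangle T bound 3≤n B disjoint u w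
    irreducible {u} {w} (e , ¬th) = decidable-stable (braceTriangle? u w) λ ¬bt → none (u , w , e , ¬th , ¬bt)
    shared : ∀ {x y z} → TwoBraces B x y x z → x ≢ y → x ≢ z → y ≢ z → ∃ λ i → Iso (base i) (braced n P B)
    shared = SharedEnd.shared-brace-end T bound 3≤n B disjoint irreducible
    by : ∀ {x y p q} → TwoBraces B x y p q → x ≢ y → p ≢ q → (x ≡ p → y ≢ q) → (x ≡ q → y ≢ p) →
      Dec (x ≡ p) → Dec (x ≡ q) → Dec (y ≡ p) → Dec (y ≡ q) → ∃ λ i → Iso (base i) (braced n P B)
    by tb x≢y p≢q d d′ (yes refl) _ _ _ = shared tb x≢y p≢q (d refl)
    by tb x≢y p≢q d d′ _ (yes refl) _ _ = shared (swapSecond tb) x≢y (≢-sym p≢q) (d′ refl)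
    by tb x≢y p≢q d d′ _ _ (yes refl) _ = shared (swapFirst tb) (≢-sym x≢y) p≢q (λ x≡q → d′ x≡q refl)
    by tb x≢y p≢q d d′ _ _ _ (yes refl) = shared (swapFirst (swapSecond tb)) (≢-sym x≢y) (≢-sym p≢q) (λ x≡p → d x≡p refl)
    by tb x≢y p≢q d d′ (no x≢p) (no x≢q) (no y≢p) (no y≢q) = BaseCases.Disjoint.disjoint-braces T bound 3≤n B disjoint irreducible
      tb (BaseCases.Disjoint.distinct x≢y x≢p x≢q y≢p y≢q p≢q)

module Reduce {m} {P B : Adj (suc m)} (S : Stage P B) {u v} (contractible : Stage.Contractible S u v) where
  open Stage S
  open TriProperties T using (symm; t-edge; t-edge′; t-edge″)

  uv : P u v ≡ true
  uv = proj₁ contractible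

  ¬triangle : ∀ {s} → (B u s ≡ true × P v s ≡ true) ⊎ (B v s ≡ true × P u s ≡ true) ⊎ (B u s ≡ true × B v s ≡ true) → ⊥
  ¬triangle {s} h = proj₂ (proj₂ contractible) (s , h)

  only-apexes : ∀ w → P u w ≡ true → P v w ≡ true → w ≡ Tri.t T u v ⊎ w ≡ Tri.t T v u
  only-apexes w uw vw with Tri.t T u v Fin.≟ w | Tri.t T v u Fin.≟ w
  ... | yes e | _ = inj₁ (sym e)
  ... | no _ | yes e = inj₂ (sym e)
  ... | no l | no r = ⊥-elim (proj₁ (proj₂ contractible) (w , uv , vw , symm uw , l , r))

  r≢l : Tri.t T u v ≢ Tri.t T v u
  r≢l = apexes-≢ T x≢y (Boolₚ.¬-not (disjoint (TwoBraces.xy braces))) uv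

  open Contract T uv r≢l only-apexes using (f; f-uv; f-sur; f-inj; A′; A′?; A′-to; tri′; edge-bound′; 3≤m)

  B′ : Adj m
  B′ x y = does (image? f B x y)

  B′-to : ∀ {x y} → B′ x y ≡ true → ∃ λ a → ∃ λ b → f a ≡ x × f b ≡ y × B a b ≡ true
  B′-to {x} {y} = does-true (image? f B x y)

  B′-from : ∀ {a b} → B a b ≡ true → B′ (f a) (f b) ≡ true
  B′-from {a} {b} β = dec-true (image? f B (f a) (f b)) (a , b , refl , refl , β)

  f-brace : ∀ {a b} → B a b ≡ true → f a ≢ f b
  f-brace {a} {b} β eq with f-inj a b eq
  ... | inj₁ refl = B-irr β
  ... | inj₂ (inj₁ refl , inj₁ refl) = B-irr β
  ... | inj₂ (inj₁ refl , inj₂ refl) = disjoint β uv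
  ... | inj₂ (inj₂ refl , inj₁ refl) = disjoint β (symm uv)
  ... | inj₂ (inj₂ refl , inj₂ refl) = B-irr β

  f-class : ∀ {a b} → a ≡ u ⊎ a ≡ v → b ≡ u ⊎ b ≡ v → f a ≡ f b
  f-class (inj₁ refl) (inj₁ refl) = refl
  f-class (inj₁ refl) (inj₂ refl) = f-uv
  f-class (inj₂ refl) (inj₁ refl) = sym f-uv
  f-class (inj₂ refl) (inj₂ refl) = refl

  -- Two braces could become parallel only by joining `u` and `v` to a common vertex, which would
  -- form a 3-cycle with `uv`. Hence their number remains two.
  f-braces : ∀ {a b a′ b′} → B a b ≡ true → B a′ b′ ≡ true → f a ≡ f a′ → f b ≡ f b′ → a ≡ a′ × b ≡ b′
  f-braces {a} {b} {a′} {b′} β γ ea eb with f-inj a a′ ea | f-inj b b′ eb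
  ... | inj₁ refl | inj₁ refl = refl , refl
  ... | inj₁ refl | inj₂ (inj₁ refl , inj₁ refl) = refl , refl
  ... | inj₁ refl | inj₂ (inj₂ refl , inj₂ refl) = refl , refl
  ... | inj₁ refl | inj₂ (inj₁ refl , inj₂ refl) = ⊥-elim (¬triangle (inj₂ (inj₂ (B-sym β , B-sym γ))))
  ... | inj₁ refl | inj₂ (inj₂ refl , inj₁ refl) = ⊥-elim (¬triangle (inj₂ (inj₂ (B-sym γ , B-sym β))))
  ... | inj₂ (inj₁ refl , inj₁ refl) | inj₁ refl = refl , refl
  ... | inj₂ (inj₂ refl , inj₂ refl) | inj₁ refl = refl , refl
  ... | inj₂ (inj₁ refl , inj₂ refl) | inj₁ refl = ⊥-elim (¬triangle (inj₂ (inj₂ (β , γ))))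
  ... | inj₂ (inj₂ refl , inj₁ refl) | inj₁ refl = ⊥-elim (¬triangle (inj₂ (inj₂ (γ , β))))
  ... | inj₂ (i , _) | inj₂ (j , _) = contradiction (f-class i j) (f-brace β)

  -- A brace at `u` parallel to an edge at `v`, or conversely, would form a 3-cycle with `uv`, which
  -- contractibility excludes.
  disjoint′ : ∀ {x y} → B′ x y ≡ true → A′ x y ≡ true → ⊥
  disjoint′ {x} {y} β e with B′-to {x} {y} β | A′-to {x} {y} e
  ... | a , b , refl , refl , ab | _ , a′ , b′ , ea , eb , ab′ with f-inj a a′ (sym ea) | f-inj b b′ (sym eb)
  ...   | inj₁ refl | inj₁ refl = disjoint ab ab′
  ...   | inj₁ refl | inj₂ (inj₁ refl , inj₁ refl) = disjoint ab ab′
  ...   | inj₁ refl | inj₂ (inj₂ refl , inj₂ refl) = disjoint ab ab′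
  ...   | inj₁ refl | inj₂ (inj₁ refl , inj₂ refl) = ¬triangle (inj₁ (B-sym ab , symm ab′))
  ...   | inj₁ refl | inj₂ (inj₂ refl , inj₁ refl) = ¬triangle (alt₂ (B-sym ab , symm ab′))
  ...   | inj₂ (inj₁ refl , inj₁ refl) | inj₁ refl = disjoint ab ab′
  ...   | inj₂ (inj₂ refl , inj₂ refl) | inj₁ refl = disjoint ab ab′
  ...   | inj₂ (inj₁ refl , inj₂ refl) | inj₁ refl = ¬triangle (inj₁ (ab , ab′))
  ...   | inj₂ (inj₂ refl , inj₁ refl) | inj₁ refl = ¬triangle (alt₂ (ab , ab′))
  ...   | inj₂ (i , _) | inj₂ (j , _) = f-brace ab (f-class i j)

  reduced : Stage A′ B′
  reduced = record
    { T = tri′ ; bound = edge-bound′ bound ; 3≤n = 3≤m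
    ; braces = record { xy = B′-from xy ; yx = B′-from yx ; pq = B′-from pq ; qp = B′-from qp ; only = only′ }
    ; x≢y = f-brace xy
    ; p≢q = f-brace pq
    ; differ = λ e e′ → uncurry differ (f-braces xy pq e e′)
    ; differ′ = λ e e′ → uncurry differ′ (f-braces xy qp e e′)
    ; disjoint = λ {x} {y} → disjoint′ {x} {y}
    }
    where
    open TwoBraces braces
    only′ : ∀ {i j} → B′ i j ≡ true → (i ≡ f x × j ≡ f y) ⊎ (i ≡ f y × j ≡ f x) ⊎ (i ≡ f p × j ≡ f q) ⊎ (i ≡ f q × j ≡ f p)
    only′ {i} {j} β with B′-to {i} {j} β
    ... | a , b , refl , refl , γ = ∈-braces {P = λ u w → (f u ≡ f x × f w ≡ f y) ⊎ (f u ≡ f y × f w ≡ f x) ⊎ (f u ≡ f p × f w ≡ f q) ⊎ (f u ≡ f q × f w ≡ f p)}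
          (inj₁ (refl , refl)) (alt₂ (refl , refl)) (alt₃ (refl , refl)) (alt₄ (refl , refl)) (only γ)

  split : Split (braced m A′ B′) (braced (suc m) P B)
  split = (TriMap.tri⇒triangulation T uv bound 3≤n , ((λ x y → bool-ext B-sym B-sym) , λ x → Boolₚ.¬-not B-irr) , λ x y β → Boolₚ.¬-not (disjoint β))
    , f , u , v
    , ((uv , Tri.t T u v , Tri.t T v u , r≢l , t-edge″ uv , t-edge uv , t-edge (symm uv) , t-edge″ (symm uv) , only-apexes) , no-brace)
    , f-uv , f-sur , f-inj
    , (λ x y → mk⇔ (A′-to {x} {y}) (dec-true (A′? x y)))
    , (λ x y → mk⇔ (B′-to {x} {y}) (dec-true (image? f B x y)))
    where
    no-brace : ∀ w → ¬ ((B u w ≡ true × Gr (braced (suc m) P B) v w ≡ true) ⊎ (Gr (braced (suc m) P B) u w ≡ true × B v w ≡ true))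
    no-brace w (inj₁ (β , g)) = ¬triangle ([ (λ e → inj₁ (β , e)) , (λ γ → inj₂ (inj₂ (β , γ))) ]′ (∨-true (P v w) g))
    no-brace w (inj₂ (g , β)) = ¬triangle ([ (λ e → alt₂ (β , e)) , (λ γ → inj₂ (inj₂ (γ , β))) ]′ (∨-true (P u w) g))

stage-constructible : ∀ {n} {P B : Adj n} → Stage P B → Constructible (braced n P B)
stage-constructible {zero} S with () ← Stage.3≤n S
stage-constructible {suc m} S with Stage.contractible? S
... | yes (_ , _ , c) = step (stage-constructible (Reduce.reduced S c)) (Reduce.split S c)
... | no none = let i , iso = Stage.irreducible-base S none in start i iso

initial-stage : ∀ {n} {P B : Adj n} → IsBracedTriangulation (braced n P B) → numEdges B ≡ 2 → Stage P B
initial-stage {n} {P} {B} (tri , simpleB , apart) two with fromSphere (ℕₚ.≤-trans (s≤s (s≤s z≤n)) (proj₁ tri)) (proj₁ (proj₂ tri))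
... | F , 𝓜 , count = by (edges B) refl (trans (length-edges B) two)
  where
  by : ∀ es → es ≡ edges B → length es ≡ 2 → Stage P B
  by ((x , y) ∷ (p , q) ∷ []) eq _ = record
    { T = triangulation⇒tri tri 𝓜 count ; bound = sphere-edge-bound (proj₁ tri) (proj₁ (proj₂ tri)) ; 3≤n = proj₁ tri
    ; braces = record { xy = proj₂ xy ; yx = flip (proj₂ xy) ; pq = proj₂ pq ; qp = flip (proj₂ pq) ; only = only }
    ; x≢y = λ { refl → ℕₚ.<-irrefl refl (proj₁ xy) }
    ; p≢q = λ { refl → ℕₚ.<-irrefl refl (proj₁ pq) }
    ; differ = λ { refl refl → distinct (subst Unique (sym eq) (edges-unique B)) }
    -- The list `edges B` holds every brace with its smaller end first, so a reversed copy cannot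
    -- occur.
    ; differ′ = λ { refl refl → ℕₚ.<-asym (proj₁ xy) (proj₁ pq) }
    ; disjoint = λ β e → false≢true e (apart _ _ β)
    }
    where
    flip : ∀ {u w} → B u w ≡ true → B w u ≡ true
    flip {u} {w} e = trans (proj₁ simpleB w u) e
    xy = ∈-edges⁻ B (subst ((x , y) ∈_) eq (here refl))
    pq = ∈-edges⁻ B (subst ((p , q) ∈_) eq (here₁ refl))
    distinct : ∀ {e : Fin n × Fin n} → Unique (e ∷ e ∷ []) → ⊥
    distinct ((e≢e ∷ _) ∷ _) = e≢e refl
    only : ∀ {u w} → B u w ≡ true → (u ≡ x × w ≡ y) ⊎ (u ≡ y × w ≡ x) ⊎ (u ≡ p × w ≡ q) ⊎ (u ≡ q × w ≡ p)
    only {u} {w} e with ∈-++⁻ (edges B) (darts⊆edges² B simpleB (∈-darts B e))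
    ... | inj₁ i with subst ((u , w) ∈_) (sym eq) i
    ...   | here refl = inj₁ (refl , refl)
    ...   | here₁ refl = alt₃ (refl , refl)
    only {u} {w} e | inj₂ i with ∈-map⁻ swap i
    ... | (a , b) , j , refl with subst ((a , b) ∈_) (sym eq) j
    ...   | here refl = alt₂ (refl , refl)
    ...   | here₁ refl = alt₄ (refl , refl)

theorem4p7 : (G : Braced) → IsBracedTriangulation G → numEdges (B G) ≡ 2 →
    Constructible G
theorem4p7 (braced n P B) isBraced two = stage-constructible (initial-stage isBraced two)
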